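{- Let $p$ be a prime, let $a$ be a positive integer, and let $l,m,n\in\mathbb{N}$ with $m<p$ and $2\le n-l-m\le p$. Then for every $d\in\{1,\ldots,\max\{p^{a-2},1\}\}$, $$\frac{1}{p^{n-l}}\sum_{l<k\le n}\binom{p^an-p^{a-1}m-d}{p^ak-p^{a-1}m-d}(-1)^{pk}\binom{k-1}{l}\equiv\frac{(-1)^{l-1}n!/l!}{\prod_{k=0}^m(n-l-k)}B^{(m+1)}_{p-n+l+m}\pmod p.$$
   Context: For $m\in\mathbb{N}$ the $m$th order Bernoulli numbers $B^{(m)}_k$ are defined by $\left(\frac{x}{e^x-1}\right)^m=\sum_{k\ge0}B^{(m)}_k\frac{x^k}{k!}$. Congruences between rationals modulo $p$ mean the difference divided by $p$ is a $p$-adic integer. -}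

module Defs where

open import Data.Nat as ℕ using (ℕ; zero; suc; _∸_; _!)
open import Data.Nat.Divisibility using (_∣_)
open import Data.Integer as ℤ using (ℤ; +_)
open import Data.Rational as ℚ using (ℚ; _/_; 0ℚ; 1ℚ; _*_; _+_; _-_; -_)
open import Data.List using (List; []; _∷_; map; upTo; zipWith; foldr; length)
open import Data.Product using (∃; _×_)
open import Relation.Nullary using (¬_)
open import Relation.Binary.PropositionalEquality using (_≡_)

-- Division of an integer by a natural number, as a rational.
-- Convention: division by 0 yields 0 (never used with d = 0 below).
divℕ : ℤ → ℕ → ℚ
divℕ n zero    = 0ℚ
divℕ n (suc d) = n / suc d

sumℚ : List ℚ → ℚ
sumℚ = foldr _+_ 0ℚ

sumℤ : List ℤ → ℤ
sumℤ = foldr ℤ._+_ (ℤ.+ 0)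

-- Formal power series over ℚ, represented by their coefficient sequences.
Series : Set
Series = ℕ → ℚ

_⊛_ : Series → Series → Series
(f ⊛ g) k = sumℚ (map (λ i → f i * g (k ∸ i)) (upTo (suc k)))

oneS : Series
oneS zero    = 1ℚ
oneS (suc _) = 0ℚ

_^S_ : Series → ℕ → Series
f ^S zero  = oneS
f ^S suc m = f ⊛ (f ^S m)

expm1/x : Series
expm1/x j = divℕ (+ 1) (suc j !)

-- Coefficients of the multiplicative inverse of expm1/x, i.e. of x/(e^x - 1).
-- invRev n = [g_n, g_{n-1}, ..., g_0] where g = 1 / expm1/x, computed by the
-- recursion g_0 = 1, g_{n+1} = - Σ_{j=0}^{n} (expm1/x)_{j+1} g_{n-j}.
invRev : ℕ → List ℚ
invRev zero    = 1ℚ ∷ []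
invRev (suc n) =
  (- sumℚ (zipWith _*_ (map (λ j → expm1/x (suc j)) (upTo (suc n))) (invRev n)))
  ∷ invRev n

headℚ : List ℚ → ℚ
headℚ []      = 0ℚ
headℚ (x ∷ _) = x

x/expm1 : Series
x/expm1 k = headℚ (invRev k)

-- Higher order Bernoulli numbers:
-- (x/(e^x-1))^m = Σ_k B^{(m)}_k x^k / k!
bernoulli : ℕ → ℕ → ℚ
bernoulli m k = ((+ (k !)) / 1) * ((x/expm1 ^S m) k)

pIntegral : ℕ → ℚ → Set
pIntegral p q = ¬ (p ∣ ℚ.denominatorℕ q)

_≡_[modℚ_] : ℚ → ℚ → ℕ → Set
x ≡ y [modℚ p ] = ∃ λ z → pIntegral p z × (x - y ≡ ((+ p) / 1) * z)

prodℕ0to : (ℕ → ℕ) → ℕ → ℕ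
prodℕ0to f zero    = f zero
prodℕ0to f (suc m) = prodℕ0to f m ℕ.* f (suc m)

-- Put ε = (-1)^p, s = n - l and, for a modulus Q, T_Q(N,r,l) = Σ_j ε^j C(N, Qj+r) C(j,l).  With k = j + 1 the sum of the
-- theorem is ε T_Q(N,r,l) for Q = p^a, r = p^a - p^(a-1) m - d and N = r + Q(n-1).
--
-- Binomial inversion writes T_{pQ}(N, r₀ + p r₁, l) as Σ_i ± T_p(N,r₀,i) T_Q(i,r₁,l).  Weisman's divisibility bound for both
-- factors leaves only the top term i = ⌊N/p⌋ modulo p^(s+1), so the modulus descends to Q = p.
--
-- For Q = p the p-th difference in N gives ε T_p(N+p,l) = T_p(N,l-1) + p Σ_i K_i T_p(N+1+i,l), where
-- K_i = (-1)^i C(p,i+1)/p ≡ 1/(i+1) modulo p.  Hence T_p / p^s is, up to sign, C(n,l) times a coefficient of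
-- (1-z)^m (-log(1-z)/z)^s modulo p.  Lagrange inversion under z = 1 - e^{-w} turns it into a coefficient of
-- (w/(e^w-1))^(m+1) (w/(1-e^{-w}))^p, whose last factor is 1 modulo p in low degrees; Wilson's theorem supplies the factorials.
module Submission where

open import Defs
open import Data.Nat using (ℕ; zero; suc; _+_; _*_; _∸_; _^_; _≤_; _<_; _⊔_; _!; z≤n; s≤s; nonTrivial⇒n>1; >-nonZero)
open import Data.Nat.Combinatorics using (_C_; nCn≡1; k>n⇒nCk≡0; nCk+nC[k+1]≡[n+1]C[k+1])
open import Data.Nat.Primality using (Prime; euclidsLemma; prime⇒nonTrivial; ¬prime[0])
open import Data.Integer as ℤ using (ℤ; +_; -1ℤ)
open import Data.List using (map; upTo; applyUpTo; zipWith)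
import Data.Rational
open import Algebra.Bundles using (CommutativeRing)
open import Algebra.Construct.Pointwise ℕ using (isAbelianGroup)
import Algebra.Solver.Ring
open import Algebra.Solver.Ring.AlmostCommutativeRing using (fromCommutativeRing; _-Raw-AlmostCommutative⟶_)
open import Data.Empty using (⊥-elim)
import Data.Integer.Properties as ℤ
open import Data.List.Properties using (map-upTo; map-applyUpTo)
open import Data.Nat.Coprimality using (coprime-divisor; recompute)
import Data.Nat.Coprimality as Coprimality
open import Data.Nat.Divisibility using (_∣_; _∤_; divides; ∣-trans; ∣1⇒≡1; >⇒∤)
open import Data.Nat.DivMod using (_/_; _%_; m≡m%n+[m/n]*n; m%n<n; m<n*o⇒m/o<n)
import Data.Nat.Properties as ℕ
open import Data.Nat.Solver renaming (module +-*-Solver to NS)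
open import Data.Product using (∃; _×_; _,_; proj₂)
open import Data.Rational as ℚ using (ℚ; 0ℚ; 1ℚ)
import Data.Rational.Properties as ℚ
open import Data.Rational.Solver using (module +-*-Solver)
open import Data.Rational.Unnormalised as ℚᵘ using (mkℚᵘ)
import Data.Rational.Unnormalised.Properties as ℚᵘ
open import Data.Sum using (_⊎_; inj₁; inj₂)
open import Function using (_∘_)
open import Level using (0ℓ)
open import Relation.Binary.Consequences using (dec⇒weaklyDec)
open import Relation.Binary.Definitions using (Tri; tri<; tri≈; tri>)
open import Relation.Binary.PropositionalEquality
import Relation.Binary.Reasoning.Setoid
open import Relation.Nullary using (Dec; yes; no)
import Relation.Nullary.Decidable

open +-*-Solver using (solve; _:=_; _:+_; _:*_; _:-_; :-_; con)

-- The hypotheses on n - l - m mark a window. Weisman's bound for modulus p gives p^s and no more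
-- exactly when N = p l + (p-1)(s+1) - j with 0 ≤ j < p - 1, and in the theorem j = p - 1 - t with t
-- = n - l - m - 1. Inside the window one coefficient, of index j, governs the quotient by p^s.
-- Below index p - 1 the numbers 1/(i+1) and the coefficients of w/(e^w-1) also have denominators
-- prime to p.
--
-- In the descent each term below the top needs one power of p more than the bound gives. An index
-- lying u below the top loses at most u powers in the factor of modulus Q and gains at least u in
-- the factor of modulus p, so a single spare power decides. The condition t ≥ 1 together with the
-- bound on d supplies it.
--
-- The prime 2 is not treated apart: (-1)^p ≡ -1 modulo p for every p, and signs that must be exact
-- are kept in the form (-1)^(p k). All congruences are between rationals, so that exact identities
-- live in a field and division by p^s is harmless.

ι : ℤ → ℚ
ι i = i ℚ./ 1

mkℚ₁ : ℤ → ℚ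
mkℚ₁ i = ℚ.mkℚ i 0 (∣1⇒≡1 ∘ proj₂)

ι≡mkℚ₁ : ∀ i → ι i ≡ mkℚ₁ i
ι≡mkℚ₁ i = ℚ.↥p/↧p≡p (mkℚ₁ i)

ι-+ : ∀ i j → ι (i ℤ.+ j) ≡ ι i ℚ.+ ι j
ι-+ i j = begin
  ι (i ℤ.+ j)                                   ≡⟨ cong ι (cong₂ ℤ._+_ (ℤ.*-identityʳ i) (ℤ.*-identityʳ j)) ⟨
  mkℚ₁ i ℚ.+ mkℚ₁ j                             ≡⟨ cong₂ ℚ._+_ (ι≡mkℚ₁ i) (ι≡mkℚ₁ j) ⟨
  ι i ℚ.+ ι j                                   ∎
  where open ≡-Reasoning

ι-* : ∀ i j → ι (i ℤ.* j) ≡ ι i ℚ.* ι j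
ι-* i j = sym (cong₂ ℚ._*_ (ι≡mkℚ₁ i) (ι≡mkℚ₁ j))

ι-neg : ∀ i → ι (ℤ.- i) ≡ ℚ.- ι i
ι-neg i = begin
  ι (ℤ.- i)      ≡⟨ ι≡mkℚ₁ (ℤ.- i) ⟩
  mkℚ₁ (ℤ.- i)   ≡⟨ neg i ⟩
  ℚ.- mkℚ₁ i     ≡⟨ cong ℚ.-_ (ι≡mkℚ₁ i) ⟨
  ℚ.- ι i        ∎
  where
  open ≡-Reasoning
  neg : ∀ i → mkℚ₁ (ℤ.- i) ≡ ℚ.- mkℚ₁ i
  neg (+ zero)    = refl
  neg ℤ.+[1+ n ]  = refl
  neg ℤ.-[1+ n ]  = refl

ι-injective : ∀ {i j} → ι i ≡ ι j → i ≡ j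
ι-injective {i} {j} eq = cong ℚ.↥_ (trans (sym (ι≡mkℚ₁ i)) (trans eq (ι≡mkℚ₁ j)))

-- Opaque, since conversion checking would otherwise evaluate the normalisation of fractions.
opaque
  ν : ℕ → ℚ
  ν n = ι (+ n)

  recip : ℕ → ℚ
  recip n = + 1 ℚ./ suc n

  ι-pos : ∀ n → ι (+ n) ≡ ν n
  ι-pos n = refl

  1/suc≡recip : ∀ n → + 1 ℚ./ suc n ≡ recip n
  1/suc≡recip n = refl

  ν-0 : ν 0 ≡ 0ℚ
  ν-0 = refl

  ν-1 : ν 1 ≡ 1ℚ
  ν-1 = refl

  ν-+ : ∀ m n → ν (m + n) ≡ ν m ℚ.+ ν n
  ν-+ m n = ι-+ (+ m) (+ n)

  ν-* : ∀ m n → ν (m * n) ≡ ν m ℚ.* ν n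
  ν-* m n = trans (cong ι (ℤ.pos-* m n)) (ι-* (+ m) (+ n))

  /-as-* : ∀ i n → i ℚ./ suc n ≡ ι i ℚ.* recip n
  /-as-* i n = begin
    i ℚ./ suc n                 ≡⟨ ℚ.fromℚᵘ-cong {mkℚᵘ i n} {mkℚᵘ i 0 ℚᵘ.* mkℚᵘ (+ 1) n} (ℚᵘ.≃-sym (ℚᵘ.≃-reflexive eq)) ⟩
    ℚ.fromℚᵘ (mkℚᵘ i 0 ℚᵘ.* mkℚᵘ (+ 1) n) ≡⟨ fromℚᵘ-homo-* (mkℚᵘ i 0) (mkℚᵘ (+ 1) n) ⟩
    ι i ℚ.* recip n             ∎
    where
    open ≡-Reasoning
    eq : mkℚᵘ i 0 ℚᵘ.* mkℚᵘ (+ 1) n ≡ mkℚᵘ i n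
    eq = cong₂ mkℚᵘ (ℤ.*-identityʳ i) (ℕ.+-identityʳ n)
    fromℚᵘ-homo-* : ∀ x y → ℚ.fromℚᵘ (x ℚᵘ.* y) ≡ ℚ.fromℚᵘ x ℚ.* ℚ.fromℚᵘ y
    fromℚᵘ-homo-* x y = ℚ.toℚᵘ-injective (ℚᵘ.≃-trans (ℚ.toℚᵘ-fromℚᵘ (x ℚᵘ.* y))
      (ℚᵘ.≃-trans (ℚᵘ.*-cong (ℚᵘ.≃-sym (ℚ.toℚᵘ-fromℚᵘ x)) (ℚᵘ.≃-sym (ℚ.toℚᵘ-fromℚᵘ y)))
        (ℚᵘ.≃-sym (ℚ.toℚᵘ-homo-* (ℚ.fromℚᵘ x) (ℚ.fromℚᵘ y)))))

  ν-recip : ∀ n → ν (suc n) ℚ.* recip n ≡ 1ℚ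
  ν-recip n = trans (sym (/-as-* (+ suc n) n))
    (ℚ.fromℚᵘ-cong {mkℚᵘ (+ suc n) n} {mkℚᵘ (+ 1) 0} (ℚᵘ.*≡* (ℤ.*-comm (+ suc n) (+ 1))))

ν-suc : ∀ n → ν (suc n) ≡ 1ℚ ℚ.+ ν n
ν-suc n = trans (ν-+ 1 n) (cong (ℚ._+ ν n) ν-1)

*-cancel-ν : ∀ n {x y} → ν (suc n) ℚ.* x ≡ ν (suc n) ℚ.* y → x ≡ y
*-cancel-ν n {x} {y} eq = begin
  x                                  ≡⟨ absorb x ⟨
  recip n ℚ.* (ν (suc n) ℚ.* x)      ≡⟨ cong (recip n ℚ.*_) eq ⟩
  recip n ℚ.* (ν (suc n) ℚ.* y)      ≡⟨ absorb y ⟩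
  y                                  ∎
  where
  open ≡-Reasoning
  absorb : ∀ z → recip n ℚ.* (ν (suc n) ℚ.* z) ≡ z
  absorb z = trans (solve 3 (λ r v z → r :* (v :* z) := (v :* r) :* z) refl (recip n) (ν (suc n)) z)
    (trans (cong (ℚ._* z) (ν-recip n)) (ℚ.*-identityˡ z))

*-zero : ∀ x {y} → y ≡ 0ℚ → x ℚ.* y ≡ 0ℚ
*-zero x refl = ℚ.*-zeroʳ x

-- Signs as rational numbers

sgn : ℕ → ℚ
sgn zero    = 1ℚ
sgn (suc k) = ℚ.- sgn k

sgn-+ : ∀ m n → sgn (m + n) ≡ sgn m ℚ.* sgn n
sgn-+ zero    n = sym (ℚ.*-identityˡ (sgn n))
sgn-+ (suc m) n = trans (cong ℚ.-_ (sgn-+ m n)) (ℚ.neg-distribˡ-* (sgn m) (sgn n))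

ι-[-1]^ : ∀ k → ι (-1ℤ ℤ.^ k) ≡ sgn k
ι-[-1]^ zero    = refl
ι-[-1]^ (suc k) = trans (cong ι (ℤ.-1*i≡-i (-1ℤ ℤ.^ k))) (trans (ι-neg (-1ℤ ℤ.^ k)) (cong ℚ.-_ (ι-[-1]^ k)))

sgn-square : ∀ n → sgn n ℚ.* sgn n ≡ 1ℚ
sgn-square zero    = refl
sgn-square (suc n) = trans (solve 1 (λ x → :- x :* :- x := x :* x) refl (sgn n)) (sgn-square n)

sgn-double : ∀ n → sgn (n + n) ≡ 1ℚ
sgn-double n = trans (sgn-+ n n) (sgn-square n)

sgn-even : ∀ m n → sgn m ≡ 1ℚ → sgn (m * n) ≡ 1ℚ
sgn-even m zero    eq = cong sgn (ℕ.*-zeroʳ m)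
sgn-even m (suc n) eq = begin
  sgn (m * suc n)         ≡⟨ cong sgn (ℕ.*-suc m n) ⟩
  sgn (m + m * n)         ≡⟨ sgn-+ m (m * n) ⟩
  sgn m ℚ.* sgn (m * n)   ≡⟨ cong₂ ℚ._*_ eq (sgn-even m n eq) ⟩
  1ℚ                      ∎
  where open ≡-Reasoning

-- One of two consecutive numbers is even. Taken at p, this makes the sign `η` trivial on multiples
-- of p, also for p = 2.
sgn-suc-* : ∀ n → sgn (suc n * n) ≡ 1ℚ
sgn-suc-* zero    = refl
sgn-suc-* (suc n) = begin
  sgn (suc (suc n) * suc n)                     ≡⟨ cong sgn (NS.solve 1 (λ n → (NS.con 2 NS.:+ n) NS.:* (NS.con 1 NS.:+ n) NS.:= (NS.con 1 NS.:+ n NS.:+ (NS.con 1 NS.:+ n)) NS.:+ (NS.con 1 NS.:+ n) NS.:* n) refl n) ⟩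
  sgn (suc n + suc n + suc n * n)               ≡⟨ sgn-+ (suc n + suc n) (suc n * n) ⟩
  sgn (suc n + suc n) ℚ.* sgn (suc n * n)       ≡⟨ cong₂ ℚ._*_ (sgn-double (suc n)) (sgn-suc-* n) ⟩
  1ℚ                                            ∎
  where
  open ≡-Reasoning

-- Finite sums

∑ : ℕ → (ℕ → ℚ) → ℚ
∑ zero    f = 0ℚ
∑ (suc n) f = f 0 ℚ.+ ∑ n (f ∘ suc)

∑-cong< : ∀ n {f g : ℕ → ℚ} → (∀ i → i < n → f i ≡ g i) → ∑ n f ≡ ∑ n g
∑-cong< zero    eq = refl
∑-cong< (suc n) eq = cong₂ ℚ._+_ (eq 0 (s≤s z≤n)) (∑-cong< n (λ i i<n → eq (suc i) (s≤s i<n)))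

∑-cong : ∀ n {f g : ℕ → ℚ} → (∀ i → f i ≡ g i) → ∑ n f ≡ ∑ n g
∑-cong n eq = ∑-cong< n (λ i _ → eq i)

∑-0 : ∀ n {f : ℕ → ℚ} → (∀ i → i < n → f i ≡ 0ℚ) → ∑ n f ≡ 0ℚ
∑-0 zero    eq = refl
∑-0 (suc n) eq = trans (cong₂ ℚ._+_ (eq 0 (s≤s z≤n)) (∑-0 n (λ i i<n → eq (suc i) (s≤s i<n)))) (ℚ.+-identityˡ 0ℚ)

∑-+ : ∀ n (f g : ℕ → ℚ) → ∑ n (λ i → f i ℚ.+ g i) ≡ ∑ n f ℚ.+ ∑ n g
∑-+ zero    f g = refl
∑-+ (suc n) f g = trans (cong (f 0 ℚ.+ g 0 ℚ.+_) (∑-+ n (f ∘ suc) (g ∘ suc)))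
  (solve 4 (λ a b c d → a :+ b :+ (c :+ d) := a :+ c :+ (b :+ d)) refl (f 0) (g 0) _ _)

∑-* : ∀ n c (f : ℕ → ℚ) → ∑ n (λ i → c ℚ.* f i) ≡ c ℚ.* ∑ n f
∑-* zero    c f = sym (ℚ.*-zeroʳ c)
∑-* (suc n) c f = trans (cong (c ℚ.* f 0 ℚ.+_) (∑-* n c (f ∘ suc))) (sym (ℚ.*-distribˡ-+ c (f 0) _))

∑-neg : ∀ n (f : ℕ → ℚ) → ∑ n (λ i → ℚ.- f i) ≡ ℚ.- ∑ n f
∑-neg zero    f = refl
∑-neg (suc n) f = trans (cong (ℚ.- f 0 ℚ.+_) (∑-neg n (f ∘ suc))) (sym (ℚ.neg-distrib-+ (f 0) _))

∑-swap : ∀ m n (f : ℕ → ℕ → ℚ) → ∑ m (λ i → ∑ n (f i)) ≡ ∑ n (λ j → ∑ m (λ i → f i j))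
∑-swap zero    n f = sym (∑-0 n (λ _ _ → refl))
∑-swap (suc m) n f = trans (cong (∑ n (f 0) ℚ.+_) (∑-swap m n (f ∘ suc)))
  (sym (∑-+ n (f 0) (λ j → ∑ m (λ i → f (suc i) j))))

∑-last : ∀ n (f : ℕ → ℚ) → ∑ (suc n) f ≡ ∑ n f ℚ.+ f n
∑-last zero    f = ℚ.+-comm (f 0) 0ℚ
∑-last (suc n) f = trans (cong (f 0 ℚ.+_) (∑-last n (f ∘ suc))) (sym (ℚ.+-assoc (f 0) _ _))

∑-extend : ∀ {m n} (f : ℕ → ℚ) → m ≤ n → (∀ i → m ≤ i → f i ≡ 0ℚ) → ∑ n f ≡ ∑ m f
∑-extend {n = n} f z≤n       eq = ∑-0 n (λ i _ → eq i z≤n)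
∑-extend         f (s≤s m≤n) eq = cong (f 0 ℚ.+_) (∑-extend (f ∘ suc) m≤n (λ i m≤i → eq (suc i) (s≤s m≤i)))

∑-single : ∀ n k (f : ℕ → ℚ) → k < n → (∀ i → i ≢ k → f i ≡ 0ℚ) → ∑ n f ≡ f k
∑-single (suc n) zero    f _         eq = trans (cong (f 0 ℚ.+_) (∑-0 n (λ i _ → eq (suc i) (λ ())))) (ℚ.+-identityʳ (f 0))
∑-single (suc n) (suc k) f (s≤s k<n) eq = trans (cong₂ ℚ._+_ (eq 0 (λ ()))
  (∑-single n k (f ∘ suc) k<n (λ i i≢k → eq (suc i) (i≢k ∘ ℕ.suc-injective)))) (ℚ.+-identityˡ (f (suc k)))

∑-1 : ∀ n → ∑ n (λ _ → 1ℚ) ≡ ν n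
∑-1 zero    = sym ν-0
∑-1 (suc n) = trans (cong (1ℚ ℚ.+_) (∑-1 n)) (sym (ν-suc n))

∑-+-split : ∀ m n (f : ℕ → ℚ) → ∑ (m + n) f ≡ ∑ m f ℚ.+ ∑ n (λ i → f (m + i))
∑-+-split zero    n f = sym (ℚ.+-identityˡ (∑ n f))
∑-+-split (suc m) n f = trans (cong (f 0 ℚ.+_) (∑-+-split m n (f ∘ suc))) (sym (ℚ.+-assoc (f 0) (∑ m (f ∘ suc)) (∑ n (λ i → f (suc m + i)))))

ι-sumℤ : ∀ (F : ℕ → ℤ) (G : ℕ → ℕ) n → ι (sumℤ (map F (map G (upTo n)))) ≡ ∑ n (λ i → ι (F (G i)))
ι-sumℤ F G n = trans (cong (λ xs → ι (sumℤ (map F xs))) (map-upTo G n)) (trans (cong (λ xs → ι (sumℤ xs)) (map-applyUpTo G F n)) (go (F ∘ G) n))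
  where
  go : ∀ (f : ℕ → ℤ) n → ι (sumℤ (applyUpTo f n)) ≡ ∑ n (λ i → ι (f i))
  go f zero    = refl
  go f (suc n) = trans (ι-+ (f 0) (sumℤ (applyUpTo (f ∘ suc) n))) (cong (ι (f 0) ℚ.+_) (go (f ∘ suc) n))

-- Binomial coefficients and finite differences

binom : ℕ → ℕ → ℚ
binom n k = ν (n C k)

binom-n-0 : ∀ n → binom n 0 ≡ 1ℚ
binom-n-0 n = ν-1

binom-n-n : ∀ n → binom n n ≡ 1ℚ
binom-n-n n = trans (cong ν (nCn≡1 n)) ν-1

binom-pascal : ∀ n k → binom (suc n) (suc k) ≡ binom n k ℚ.+ binom n (suc k)
binom-pascal n k = trans (cong ν (sym (nCk+nC[k+1]≡[n+1]C[k+1] n k))) (ν-+ (n C k) (n C suc k))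

binom-0 : ∀ {n k} → n < k → binom n k ≡ 0ℚ
binom-0 n<k = trans (cong ν (k>n⇒nCk≡0 n<k)) ν-0

-- Opposite in sign to the forward difference, so that the n-th power expands into the alternating
-- binomial sum without a factor (-1)^n.
Δ : (ℕ → ℚ) → ℕ → ℚ
Δ f N = f N ℚ.- f (suc N)

Δ^ : ℕ → (ℕ → ℚ) → ℕ → ℚ
Δ^ zero    f = f
Δ^ (suc n) f = Δ (Δ^ n f)

Δ^-cong : ∀ n {f g : ℕ → ℚ} → (∀ N → f N ≡ g N) → ∀ N → Δ^ n f N ≡ Δ^ n g N
Δ^-cong zero    eq N = eq N
Δ^-cong (suc n) eq N = cong₂ ℚ._-_ (Δ^-cong n eq N) (Δ^-cong n eq (suc N))

Δ^-Δ : ∀ n f N → Δ^ n (Δ f) N ≡ Δ^ (suc n) f N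
Δ^-Δ zero    f N = refl
Δ^-Δ (suc n) f N = cong₂ ℚ._-_ (Δ^-Δ n f N) (Δ^-Δ n f (suc N))

Δ^-expand : ∀ n f N → ∑ (suc n) (λ i → sgn i ℚ.* binom n i ℚ.* f (i + N)) ≡ Δ^ n f N
Δ^-expand zero    f N = trans (cong (λ x → 1ℚ ℚ.* x ℚ.* f N ℚ.+ 0ℚ) ν-1) (solve 1 (λ x → con 1ℚ :* con 1ℚ :* x :+ con 0ℚ := x) refl (f N))
Δ^-expand (suc n) f N = begin
  sgn 0 ℚ.* binom (suc n) 0 ℚ.* f N ℚ.+ ∑ (suc n) (λ i → sgn (suc i) ℚ.* binom (suc n) (suc i) ℚ.* f (suc i + N))
    ≡⟨ cong (sgn 0 ℚ.* binom (suc n) 0 ℚ.* f N ℚ.+_) (trans (∑-cong (suc n) split) (∑-+ (suc n) (term ∘ suc) (λ i → ℚ.- shifted i))) ⟩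
  sgn 0 ℚ.* binom (suc n) 0 ℚ.* f N ℚ.+ (∑ (suc n) (term ∘ suc) ℚ.+ ∑ (suc n) (λ i → ℚ.- shifted i))
    ≡⟨ ℚ.+-assoc (sgn 0 ℚ.* binom (suc n) 0 ℚ.* f N) _ _ ⟨
  ∑ (suc (suc n)) term ℚ.+ ∑ (suc n) (λ i → ℚ.- shifted i)
    ≡⟨ cong₂ ℚ._+_ (∑-last (suc n) term) (∑-neg (suc n) shifted) ⟩
  ∑ (suc n) term ℚ.+ term (suc n) ℚ.- ∑ (suc n) shifted
    ≡⟨ cong₂ (λ x y → ∑ (suc n) term ℚ.+ x ℚ.- y) last0 (trans (∑-cong (suc n) (λ i → cong (λ N → sgn i ℚ.* binom n i ℚ.* f N) (sym (ℕ.+-suc i N)))) (Δ^-expand n f (suc N))) ⟩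
  ∑ (suc n) term ℚ.+ 0ℚ ℚ.- Δ^ n f (suc N)
    ≡⟨ cong (ℚ._- Δ^ n f (suc N)) (trans (ℚ.+-identityʳ _) (Δ^-expand n f N)) ⟩
  Δ^ n f N ℚ.- Δ^ n f (suc N) ∎
  where
  open ≡-Reasoning
  term shifted : ℕ → ℚ
  term i    = sgn i ℚ.* binom n i ℚ.* f (i + N)
  shifted i = sgn i ℚ.* binom n i ℚ.* f (suc i + N)
  split : ∀ i → sgn (suc i) ℚ.* binom (suc n) (suc i) ℚ.* f (suc i + N) ≡ term (suc i) ℚ.+ ℚ.- shifted i
  split i = trans (cong (λ x → sgn (suc i) ℚ.* x ℚ.* f (suc i + N)) (binom-pascal n i))
    (solve 4 (λ s a b y → :- s :* (a :+ b) :* y := :- s :* b :* y :+ :- (s :* a :* y)) refl (sgn i) (binom n i) (binom n (suc i)) (f (suc i + N)))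
  last0 : term (suc n) ≡ 0ℚ
  last0 = trans (cong (λ x → sgn (suc n) ℚ.* x ℚ.* f (suc n + N)) (binom-0 (ℕ.n<1+n n)))
    (solve 2 (λ s y → s :* con 0ℚ :* y := con 0ℚ) refl (sgn (suc n)) (f (suc n + N)))

Δ-binom : ∀ K N → Δ (λ N → binom N (suc K)) N ≡ ℚ.- binom N K
Δ-binom K N = trans (cong (λ x → binom N (suc K) ℚ.- x) (binom-pascal N K))
  (solve 2 (λ a b → b :- (a :+ b) := :- a) refl (binom N K) (binom N (suc K)))

Δ^-neg : ∀ n f N → Δ^ n (λ N → ℚ.- f N) N ≡ ℚ.- Δ^ n f N
Δ^-neg zero    f N = refl
Δ^-neg (suc n) f N = trans (cong₂ ℚ._-_ (Δ^-neg n f N) (Δ^-neg n f (suc N)))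
  (sym (ℚ.neg-distrib-+ (Δ^ n f N) (ℚ.- Δ^ n f (suc N))))

Δ^-binom : ∀ n K N → Δ^ n (λ N → binom N (n + K)) N ≡ sgn n ℚ.* binom N K
Δ^-binom zero    K N = sym (ℚ.*-identityˡ (binom N K))
Δ^-binom (suc n) K N = begin
  Δ^ (suc n) (λ N → binom N (suc (n + K))) N       ≡⟨ Δ^-Δ n (λ N → binom N (suc (n + K))) N ⟨
  Δ^ n (Δ (λ N → binom N (suc (n + K)))) N         ≡⟨ Δ^-cong n (Δ-binom (n + K)) N ⟩
  Δ^ n (λ N → ℚ.- binom N (n + K)) N               ≡⟨ Δ^-neg n (λ N → binom N (n + K)) N ⟩
  ℚ.- Δ^ n (λ N → binom N (n + K)) N               ≡⟨ cong ℚ.-_ (Δ^-binom n K N) ⟩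
  ℚ.- (sgn n ℚ.* binom N K)                        ≡⟨ ℚ.neg-distribˡ-* (sgn n) (binom N K) ⟩
  sgn (suc n) ℚ.* binom N K                        ∎
  where open ≡-Reasoning

Δ^-binom-0 : ∀ n {k} N → k < n → Δ^ n (λ N → binom N k) N ≡ 0ℚ
Δ^-binom-0 (suc n) {zero}  N _         = trans (sym (Δ^-Δ n (λ _ → ν 1) N)) (trans (Δ^-cong n (λ _ → ℚ.+-inverseʳ (ν 1)) N) (Δ^-0 n N))
  where
  Δ^-0 : ∀ n N → Δ^ n (λ _ → 0ℚ) N ≡ 0ℚ
  Δ^-0 zero    N = refl
  Δ^-0 (suc n) N = cong₂ ℚ._-_ (Δ^-0 n N) (Δ^-0 n (suc N))
Δ^-binom-0 (suc n) {suc k} N (s≤s k<n) = begin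
  Δ^ (suc n) (λ N → binom N (suc k)) N   ≡⟨ Δ^-Δ n (λ N → binom N (suc k)) N ⟨
  Δ^ n (Δ (λ N → binom N (suc k))) N     ≡⟨ Δ^-cong n (Δ-binom k) N ⟩
  Δ^ n (λ N → ℚ.- binom N k) N           ≡⟨ Δ^-neg n (λ N → binom N k) N ⟩
  ℚ.- Δ^ n (λ N → binom N k) N           ≡⟨ cong ℚ.-_ (Δ^-binom-0 n N k<n) ⟩
  0ℚ                                     ∎
  where open ≡-Reasoning

Δ^-∑ : ∀ n B (c : ℕ → ℚ) (f : ℕ → ℕ → ℚ) N → Δ^ n (λ N → ∑ B (λ j → c j ℚ.* f j N)) N ≡ ∑ B (λ j → c j ℚ.* Δ^ n (f j) N)
Δ^-∑ zero    B c f N = refl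
Δ^-∑ (suc n) B c f N = begin
  Δ^ n F N ℚ.- Δ^ n F (suc N)
    ≡⟨ cong₂ ℚ._-_ (Δ^-∑ n B c f N) (Δ^-∑ n B c f (suc N)) ⟩
  ∑ B (λ j → c j ℚ.* Δ^ n (f j) N) ℚ.- ∑ B (λ j → c j ℚ.* Δ^ n (f j) (suc N))
    ≡⟨ cong (∑ B (λ j → c j ℚ.* Δ^ n (f j) N) ℚ.+_) (∑-neg B (λ j → c j ℚ.* Δ^ n (f j) (suc N))) ⟨
  ∑ B (λ j → c j ℚ.* Δ^ n (f j) N) ℚ.+ ∑ B (λ j → ℚ.- (c j ℚ.* Δ^ n (f j) (suc N)))
    ≡⟨ ∑-+ B (λ j → c j ℚ.* Δ^ n (f j) N) (λ j → ℚ.- (c j ℚ.* Δ^ n (f j) (suc N))) ⟨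
  ∑ B (λ j → c j ℚ.* Δ^ n (f j) N ℚ.- c j ℚ.* Δ^ n (f j) (suc N))
    ≡⟨ ∑-cong B (λ j → solve 3 (λ c a b → c :* a :- c :* b := c :* (a :- b)) refl (c j) (Δ^ n (f j) N) (Δ^ n (f j) (suc N))) ⟩
  ∑ B (λ j → c j ℚ.* Δ^ (suc n) (f j) N) ∎
  where
  open ≡-Reasoning
  F : ℕ → ℚ
  F N = ∑ B (λ j → c j ℚ.* f j N)

-- Reduces orthogonality of the binomial coefficients to differences of the polynomial C(N,k) at N =
-- 0: degree k < j is killed, k > j leaves C(0,k-j) = 0, and k = j leaves (-1)^j.
binom-sum-Δ^ : ∀ B j k → j < B → ∑ B (λ i → sgn i ℚ.* binom j i ℚ.* binom i k) ≡ Δ^ j (λ N → binom N k) 0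
binom-sum-Δ^ B j k j<B = begin
  ∑ B (λ i → sgn i ℚ.* binom j i ℚ.* binom i k)
    ≡⟨ ∑-extend (λ i → sgn i ℚ.* binom j i ℚ.* binom i k) j<B (λ i j<i → trans (cong (λ x → sgn i ℚ.* x ℚ.* binom i k) (binom-0 j<i))
         (solve 2 (λ s b → s :* con 0ℚ :* b := con 0ℚ) refl (sgn i) (binom i k))) ⟩
  ∑ (suc j) (λ i → sgn i ℚ.* binom j i ℚ.* binom i k)
    ≡⟨ ∑-cong (suc j) (λ i → cong (λ n → sgn i ℚ.* binom j i ℚ.* binom n k) (sym (ℕ.+-identityʳ i))) ⟩
  ∑ (suc j) (λ i → sgn i ℚ.* binom j i ℚ.* binom (i + 0) k)
    ≡⟨ Δ^-expand j (λ N → binom N k) 0 ⟩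
  Δ^ j (λ N → binom N k) 0 ∎
  where open ≡-Reasoning

binom-diagonal : ∀ B j → j < B → ∑ B (λ i → sgn i ℚ.* binom j i ℚ.* binom i j) ≡ sgn j
binom-diagonal B j j<B = trans (binom-sum-Δ^ B j j j<B) (trans (cong (λ k → Δ^ j (λ N → binom N k) 0) (sym (ℕ.+-identityʳ j)))
  (trans (Δ^-binom j 0 0) (trans (cong (sgn j ℚ.*_) (binom-n-0 0)) (ℚ.*-identityʳ (sgn j)))))

binom-orthogonal : ∀ B j k → j < B → j ≢ k → ∑ B (λ i → sgn i ℚ.* binom j i ℚ.* binom i k) ≡ 0ℚ
binom-orthogonal B j k j<B j≢k = trans (binom-sum-Δ^ B j k j<B) (vanish (ℕ.<-cmp j k))
  where
  vanish : Tri (j < k) (j ≡ k) (k < j) → Δ^ j (λ N → binom N k) 0 ≡ 0ℚ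
  vanish (tri≈ _ j≡k _) = ⊥-elim (j≢k j≡k)
  vanish (tri> _ _ k<j) = Δ^-binom-0 j 0 k<j
  vanish (tri< j<k _ _) = trans (cong (λ k → Δ^ j (λ N → binom N k) 0) (sym (ℕ.m+[n∸m]≡n (ℕ.<⇒≤ j<k))))
    (trans (Δ^-binom j (k ∸ j) 0) (*-zero (sgn j) (binom-0 (ℕ.m<n⇒0<n∸m j<k))))

-- The function (-n)^i is an eigenfunction of `Δ` with eigenvalue 1 + n. Expanded at N = 0 this is
-- the binomial theorem for (1 + n)^k.
Δ^-geometric : ∀ n k N → Δ^ k (λ i → sgn i ℚ.* ν (n ^ i)) N ≡ ν (suc n ^ k) ℚ.* (sgn N ℚ.* ν (n ^ N))
Δ^-geometric n zero    N = sym (trans (cong (ℚ._* (sgn N ℚ.* ν (n ^ N))) ν-1) (ℚ.*-identityˡ _))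
Δ^-geometric n (suc k) N = begin
  Δ^ k f N ℚ.- Δ^ k f (suc N)
    ≡⟨ cong₂ ℚ._-_ (Δ^-geometric n k N) (trans (Δ^-geometric n k (suc N)) (cong (λ x → ν (suc n ^ k) ℚ.* (sgn (suc N) ℚ.* x)) (ν-* n (n ^ N)))) ⟩
  ν (suc n ^ k) ℚ.* (sgn N ℚ.* ν (n ^ N)) ℚ.- ν (suc n ^ k) ℚ.* (sgn (suc N) ℚ.* (ν n ℚ.* ν (n ^ N)))
    ≡⟨ solve 4 (λ a s n y → a :* (s :* y) :- a :* (:- s :* (n :* y)) := (con 1ℚ :+ n) :* a :* (s :* y)) refl (ν (suc n ^ k)) (sgn N) (ν n) (ν (n ^ N)) ⟩
  (1ℚ ℚ.+ ν n) ℚ.* ν (suc n ^ k) ℚ.* (sgn N ℚ.* ν (n ^ N))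
    ≡⟨ cong (ℚ._* (sgn N ℚ.* ν (n ^ N))) (trans (cong (ℚ._* ν (suc n ^ k)) (sym (ν-suc n))) (sym (ν-* (suc n) (suc n ^ k)))) ⟩
  ν (suc n ^ suc k) ℚ.* (sgn N ℚ.* ν (n ^ N)) ∎
  where
  open ≡-Reasoning
  f : ℕ → ℚ
  f i = sgn i ℚ.* ν (n ^ i)

-- Leibniz rule for a product with the linear factor N, which has only one nonzero higher
-- difference. It carries the induction from N^n to N^(n+1).
Δ^-ν* : ∀ n (f : ℕ → ℚ) N → Δ^ (suc n) (λ N → ν N ℚ.* f N) N ≡ ν N ℚ.* Δ^ (suc n) f N ℚ.- ν (suc n) ℚ.* Δ^ n f (suc N)
Δ^-ν* zero    f N = trans (cong (λ x → ν N ℚ.* f N ℚ.- x ℚ.* f (suc N)) (ν-suc N))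
  (trans (solve 3 (λ N a b → N :* a :- (con 1ℚ :+ N) :* b := N :* (a :- b) :- con 1ℚ :* b) refl (ν N) (f N) (f (suc N)))
    (cong (λ x → ν N ℚ.* (f N ℚ.- f (suc N)) ℚ.- x ℚ.* f (suc N)) (sym ν-1)))
Δ^-ν* (suc n) f N = begin
  Δ^ (suc n) g N ℚ.- Δ^ (suc n) g (suc N)
    ≡⟨ cong₂ ℚ._-_ (Δ^-ν* n f N) (Δ^-ν* n f (suc N)) ⟩
  ν N ℚ.* A ℚ.- ν (suc n) ℚ.* B₁ ℚ.- (ν (suc N) ℚ.* (B₁ ℚ.- B₂) ℚ.- ν (suc n) ℚ.* B₂)
    ≡⟨ cong (λ x → ν N ℚ.* A ℚ.- ν (suc n) ℚ.* B₁ ℚ.- (x ℚ.* (B₁ ℚ.- B₂) ℚ.- ν (suc n) ℚ.* B₂)) (ν-suc N) ⟩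
  ν N ℚ.* A ℚ.- ν (suc n) ℚ.* B₁ ℚ.- ((1ℚ ℚ.+ ν N) ℚ.* (B₁ ℚ.- B₂) ℚ.- ν (suc n) ℚ.* B₂)
    ≡⟨ solve 5 (λ N n A B C → N :* A :- n :* B :- ((con 1ℚ :+ N) :* (B :- C) :- n :* C) := N :* (A :- (B :- C)) :- (con 1ℚ :+ n) :* (B :- C)) refl (ν N) (ν (suc n)) A B₁ B₂ ⟩
  ν N ℚ.* (A ℚ.- (B₁ ℚ.- B₂)) ℚ.- (1ℚ ℚ.+ ν (suc n)) ℚ.* (B₁ ℚ.- B₂)
    ≡⟨ cong (λ x → ν N ℚ.* (A ℚ.- (B₁ ℚ.- B₂)) ℚ.- x ℚ.* (B₁ ℚ.- B₂)) (ν-suc (suc n)) ⟨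
  ν N ℚ.* Δ^ (suc (suc n)) f N ℚ.- ν (suc (suc n)) ℚ.* Δ^ (suc n) f (suc N) ∎
  where
  open ≡-Reasoning
  g : ℕ → ℚ
  g N = ν N ℚ.* f N
  A B₁ B₂ : ℚ
  A  = Δ^ (suc n) f N
  B₁ = Δ^ n f (suc N)
  B₂ = Δ^ n f (suc (suc N))

Δ^-power : ∀ n N → Δ^ n (λ N → ν (N ^ n)) N ≡ sgn n ℚ.* ν (n !)
Δ^-power zero    N = sym (ℚ.*-identityˡ (ν 1))
Δ^-power (suc n) N = begin
  Δ^ (suc n) (λ N → ν (N ^ suc n)) N
    ≡⟨ Δ^-cong (suc n) (λ N → ν-* N (N ^ n)) N ⟩
  Δ^ (suc n) (λ N → ν N ℚ.* ν (N ^ n)) N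
    ≡⟨ Δ^-ν* n (λ N → ν (N ^ n)) N ⟩
  ν N ℚ.* (Δ^ n (λ N → ν (N ^ n)) N ℚ.- Δ^ n (λ N → ν (N ^ n)) (suc N)) ℚ.- ν (suc n) ℚ.* Δ^ n (λ N → ν (N ^ n)) (suc N)
    ≡⟨ cong₂ (λ x y → ν N ℚ.* (x ℚ.- y) ℚ.- ν (suc n) ℚ.* y) (Δ^-power n N) (Δ^-power n (suc N)) ⟩
  ν N ℚ.* (sgn n ℚ.* ν (n !) ℚ.- sgn n ℚ.* ν (n !)) ℚ.- ν (suc n) ℚ.* (sgn n ℚ.* ν (n !))
    ≡⟨ solve 4 (λ N s f n → N :* (s :* f :- s :* f) :- n :* (s :* f) := :- s :* (n :* f)) refl (ν N) (sgn n) (ν (n !)) (ν (suc n)) ⟩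
  sgn (suc n) ℚ.* (ν (suc n) ℚ.* ν (n !))
    ≡⟨ cong (sgn (suc n) ℚ.*_) (ν-* (suc n) (n !)) ⟨
  sgn (suc n) ℚ.* ν (suc n !) ∎
  where open ≡-Reasoning

binom-absorb : ∀ n k → ν (suc k) ℚ.* binom (suc n) (suc k) ≡ ν (suc n) ℚ.* binom n k
binom-absorb zero    zero    = refl
binom-absorb zero    (suc k) = trans (vanish (ν (suc (suc k))) (binom-0 {1} {suc (suc k)} (s≤s (s≤s z≤n)))) (sym (vanish (ν 1) (binom-0 {0} {suc k} (s≤s z≤n))))
  where
  vanish : ∀ x {y} → y ≡ 0ℚ → x ℚ.* y ≡ 0ℚ
  vanish x refl = ℚ.*-zeroʳ x
binom-absorb (suc n) zero    = begin
  ν 1 ℚ.* binom (suc (suc n)) 1                 ≡⟨ cong (ν 1 ℚ.*_) (binom-pascal (suc n) 0) ⟩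
  ν 1 ℚ.* (ν 1 ℚ.+ binom (suc n) 1)             ≡⟨ ℚ.*-distribˡ-+ (ν 1) (ν 1) (binom (suc n) 1) ⟩
  ν 1 ℚ.* ν 1 ℚ.+ ν 1 ℚ.* binom (suc n) 1       ≡⟨ cong (ν 1 ℚ.* ν 1 ℚ.+_) (binom-absorb n 0) ⟩
  ν 1 ℚ.* ν 1 ℚ.+ ν (suc n) ℚ.* ν 1             ≡⟨ ℚ.*-distribʳ-+ (ν 1) (ν 1) (ν (suc n)) ⟨
  (ν 1 ℚ.+ ν (suc n)) ℚ.* ν 1                   ≡⟨ cong (ℚ._* ν 1) (ν-+ 1 (suc n)) ⟨
  ν (suc (suc n)) ℚ.* ν 1                       ∎
  where open ≡-Reasoning
binom-absorb (suc n) (suc k) = begin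
  ν (2 + k) ℚ.* binom (2 + n) (2 + k)
    ≡⟨ cong (ν (2 + k) ℚ.*_) (binom-pascal (suc n) (suc k)) ⟩
  ν (2 + k) ℚ.* (binom (suc n) (suc k) ℚ.+ binom (suc n) (2 + k))
    ≡⟨ ℚ.*-distribˡ-+ (ν (2 + k)) _ _ ⟩
  ν (2 + k) ℚ.* binom (suc n) (suc k) ℚ.+ ν (2 + k) ℚ.* binom (suc n) (2 + k)
    ≡⟨ cong₂ ℚ._+_ (trans (cong (ℚ._* binom (suc n) (suc k)) (ν-suc (suc k))) (ℚ.*-distribʳ-+ (binom (suc n) (suc k)) 1ℚ (ν (suc k)))) (binom-absorb n (suc k)) ⟩
  1ℚ ℚ.* binom (suc n) (suc k) ℚ.+ ν (suc k) ℚ.* binom (suc n) (suc k) ℚ.+ ν (suc n) ℚ.* binom n (suc k)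
    ≡⟨ cong (λ x → 1ℚ ℚ.* binom (suc n) (suc k) ℚ.+ x ℚ.+ ν (suc n) ℚ.* binom n (suc k)) (binom-absorb n k) ⟩
  1ℚ ℚ.* binom (suc n) (suc k) ℚ.+ ν (suc n) ℚ.* binom n k ℚ.+ ν (suc n) ℚ.* binom n (suc k)
    ≡⟨ solve 4 (λ c m x y → con 1ℚ :* c :+ m :* x :+ m :* y := con 1ℚ :* c :+ m :* (x :+ y)) refl (binom (suc n) (suc k)) (ν (suc n)) (binom n k) (binom n (suc k)) ⟩
  1ℚ ℚ.* binom (suc n) (suc k) ℚ.+ ν (suc n) ℚ.* (binom n k ℚ.+ binom n (suc k))
    ≡⟨ cong (λ x → 1ℚ ℚ.* binom (suc n) (suc k) ℚ.+ ν (suc n) ℚ.* x) (binom-pascal n k) ⟨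
  1ℚ ℚ.* binom (suc n) (suc k) ℚ.+ ν (suc n) ℚ.* binom (suc n) (suc k)
    ≡⟨ ℚ.*-distribʳ-+ (binom (suc n) (suc k)) 1ℚ (ν (suc n)) ⟨
  (1ℚ ℚ.+ ν (suc n)) ℚ.* binom (suc n) (suc k)
    ≡⟨ cong (ℚ._* binom (suc n) (suc k)) (ν-suc (suc n)) ⟨
  ν (2 + n) ℚ.* binom (suc n) (suc k) ∎
  where open ≡-Reasoning

-- Factorials and the product in the denominator

fact-binom : ∀ u v → ν (u !) ℚ.* ν (v !) ℚ.* binom (u + v) u ≡ ν ((u + v) !)
fact-binom zero    v = trans (cong₂ (λ x y → x ℚ.* ν (v !) ℚ.* y) ν-1 (binom-n-0 v)) (solve 1 (λ x → con 1ℚ :* x :* con 1ℚ := x) refl (ν (v !)))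
fact-binom (suc u) v = begin
  ν (suc u * u !) ℚ.* ν (v !) ℚ.* binom (suc (u + v)) (suc u)             ≡⟨ cong (λ x → x ℚ.* ν (v !) ℚ.* binom (suc (u + v)) (suc u)) (ν-* (suc u) (u !)) ⟩
  ν (suc u) ℚ.* ν (u !) ℚ.* ν (v !) ℚ.* binom (suc (u + v)) (suc u)       ≡⟨ solve 4 (λ n u v b → n :* u :* v :* b := u :* v :* (n :* b)) refl (ν (suc u)) (ν (u !)) (ν (v !)) (binom (suc (u + v)) (suc u)) ⟩
  ν (u !) ℚ.* ν (v !) ℚ.* (ν (suc u) ℚ.* binom (suc (u + v)) (suc u))     ≡⟨ cong (ν (u !) ℚ.* ν (v !) ℚ.*_) (binom-absorb (u + v) u) ⟩
  ν (u !) ℚ.* ν (v !) ℚ.* (ν (suc (u + v)) ℚ.* binom (u + v) u)           ≡⟨ solve 4 (λ n u v b → u :* v :* (n :* b) := n :* (u :* v :* b)) refl (ν (suc (u + v))) (ν (u !)) (ν (v !)) (binom (u + v) u) ⟩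
  ν (suc (u + v)) ℚ.* (ν (u !) ℚ.* ν (v !) ℚ.* binom (u + v) u)           ≡⟨ cong (ν (suc (u + v)) ℚ.*_) (fact-binom u v) ⟩
  ν (suc (u + v)) ℚ.* ν ((u + v) !)                                       ≡⟨ ν-* (suc (u + v)) ((u + v) !) ⟨
  ν (suc (u + v) !)                                                       ∎
  where open ≡-Reasoning

prodℕ-fact : ∀ s m → m < s → prodℕ0to (λ k → s ∸ k) m * (s ∸ suc m) ! ≡ s !
prodℕ-fact (suc s) zero    _     = refl
prodℕ-fact s       (suc m) m+1<s = begin
  prodℕ0to (λ k → s ∸ k) m * (s ∸ suc m) * (s ∸ suc (suc m)) !       ≡⟨ ℕ.*-assoc (prodℕ0to (λ k → s ∸ k) m) (s ∸ suc m) ((s ∸ suc (suc m)) !) ⟩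
  prodℕ0to (λ k → s ∸ k) m * ((s ∸ suc m) * (s ∸ suc (suc m)) !)     ≡⟨ cong (λ k → prodℕ0to (λ k → s ∸ k) m * (k * (s ∸ suc (suc m)) !)) pred ⟩
  prodℕ0to (λ k → s ∸ k) m * (suc (s ∸ suc (suc m))) !               ≡⟨ cong (λ k → prodℕ0to (λ k → s ∸ k) m * k !) pred ⟨
  prodℕ0to (λ k → s ∸ k) m * (s ∸ suc m) !                           ≡⟨ prodℕ-fact s m (ℕ.<-trans (ℕ.n<1+n m) m+1<s) ⟩
  s !                                                                ∎
  where
  open ≡-Reasoning
  pred : s ∸ suc m ≡ suc (s ∸ suc (suc m))
  pred = ℕ.+-∸-assoc 1 m+1<s

prodℕ-pos : ∀ s m → m < s → 1 ≤ prodℕ0to (λ k → s ∸ k) m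
prodℕ-pos s zero    m<s   = m<s
prodℕ-pos s (suc m) m+1<s = ℕ.*-mono-≤ (prodℕ-pos s m (ℕ.<-trans (ℕ.n<1+n m) m+1<s)) (ℕ.m<n⇒0<n∸m m+1<s)

-- Formal power series

infix  4 _≈_
infixl 6 _⊕_
infixl 7 _⊙_

_≈_ : Series → Series → Set
f ≈ g = ∀ k → f k ≡ g k

_⊕_ : Series → Series → Series
(f ⊕ g) k = f k ℚ.+ g k

⊖_ : Series → Series
(⊖ f) k = ℚ.- f k

-- The Cauchy product by recursion on the left factor. Inductions on the index then need no
-- subtraction `k ∸ i`; `⊛≈⊙` leads back to the list form.
_⊙_ : Series → Series → Series
(f ⊙ g) zero    = f 0 ℚ.* g 0
(f ⊙ g) (suc k) = f 0 ℚ.* g (suc k) ℚ.+ ((f ∘ suc) ⊙ g) k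

constS : ℚ → Series
constS c zero    = c
constS c (suc k) = 0ℚ

⊙-cong : ∀ {f f′ g g′} → f ≈ f′ → g ≈ g′ → f ⊙ g ≈ f′ ⊙ g′
⊙-cong p q zero    = cong₂ ℚ._*_ (p 0) (q 0)
⊙-cong p q (suc k) = cong₂ ℚ._+_ (cong₂ ℚ._*_ (p 0) (q (suc k))) (⊙-cong (p ∘ suc) q k)

⊙-distribʳ : ∀ h f g → (f ⊕ g) ⊙ h ≈ (f ⊙ h) ⊕ (g ⊙ h)
⊙-distribʳ h f g zero    = ℚ.*-distribʳ-+ (h 0) (f 0) (g 0)
⊙-distribʳ h f g (suc k) = trans (cong ((f 0 ℚ.+ g 0) ℚ.* h (suc k) ℚ.+_) (⊙-distribʳ h (f ∘ suc) (g ∘ suc) k))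
  (solve 5 (λ a b c x y → (a :+ b) :* c :+ (x :+ y) := a :* c :+ x :+ (b :* c :+ y)) refl (f 0) (g 0) (h (suc k)) _ _)

⊙-scaleˡ : ∀ c f g k → ((λ i → c ℚ.* f i) ⊙ g) k ≡ c ℚ.* (f ⊙ g) k
⊙-scaleˡ c f g zero    = ℚ.*-assoc c (f 0) (g 0)
⊙-scaleˡ c f g (suc k) = trans (cong (c ℚ.* f 0 ℚ.* g (suc k) ℚ.+_) (⊙-scaleˡ c (f ∘ suc) g k))
  (solve 4 (λ c a b x → c :* a :* b :+ c :* x := c :* (a :* b :+ x)) refl c (f 0) (g (suc k)) _)

⊙-sucʳ : ∀ f g k → (f ⊙ g) (suc k) ≡ (f ⊙ (g ∘ suc)) k ℚ.+ f (suc k) ℚ.* g 0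
⊙-sucʳ f g zero    = refl
⊙-sucʳ f g (suc k) = trans (cong (f 0 ℚ.* g (suc (suc k)) ℚ.+_) (⊙-sucʳ (f ∘ suc) g k))
  (sym (ℚ.+-assoc (f 0 ℚ.* g (suc (suc k))) _ _))

⊙-comm : ∀ f g → f ⊙ g ≈ g ⊙ f
⊙-comm f g zero    = ℚ.*-comm (f 0) (g 0)
⊙-comm f g (suc k) = begin
  f 0 ℚ.* g (suc k) ℚ.+ ((f ∘ suc) ⊙ g) k   ≡⟨ cong₂ ℚ._+_ (ℚ.*-comm (f 0) (g (suc k))) (⊙-comm (f ∘ suc) g k) ⟩
  g (suc k) ℚ.* f 0 ℚ.+ (g ⊙ (f ∘ suc)) k   ≡⟨ ℚ.+-comm (g (suc k) ℚ.* f 0) _ ⟩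
  (g ⊙ (f ∘ suc)) k ℚ.+ g (suc k) ℚ.* f 0   ≡⟨ ⊙-sucʳ g f k ⟨
  (g ⊙ f) (suc k)                           ∎
  where open ≡-Reasoning

⊙-assoc : ∀ f g h → (f ⊙ g) ⊙ h ≈ f ⊙ (g ⊙ h)
⊙-assoc f g h zero    = ℚ.*-assoc (f 0) (g 0) (h 0)
⊙-assoc f g h (suc k) = begin
  f 0 ℚ.* g 0 ℚ.* h (suc k) ℚ.+ (((λ i → f 0 ℚ.* g (suc i)) ⊕ ((f ∘ suc) ⊙ g)) ⊙ h) k
    ≡⟨ cong (f 0 ℚ.* g 0 ℚ.* h (suc k) ℚ.+_) (⊙-distribʳ h (λ i → f 0 ℚ.* g (suc i)) ((f ∘ suc) ⊙ g) k) ⟩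
  f 0 ℚ.* g 0 ℚ.* h (suc k) ℚ.+ (((λ i → f 0 ℚ.* g (suc i)) ⊙ h) k ℚ.+ (((f ∘ suc) ⊙ g) ⊙ h) k)
    ≡⟨ cong₂ (λ x y → f 0 ℚ.* g 0 ℚ.* h (suc k) ℚ.+ (x ℚ.+ y)) (⊙-scaleˡ (f 0) (g ∘ suc) h k) (⊙-assoc (f ∘ suc) g h k) ⟩
  f 0 ℚ.* g 0 ℚ.* h (suc k) ℚ.+ (f 0 ℚ.* ((g ∘ suc) ⊙ h) k ℚ.+ ((f ∘ suc) ⊙ (g ⊙ h)) k)
    ≡⟨ solve 5 (λ a b c x y → a :* b :* c :+ (a :* x :+ y) := a :* (b :* c :+ x) :+ y) refl (f 0) (g 0) (h (suc k)) _ _ ⟩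
  f 0 ℚ.* (g 0 ℚ.* h (suc k) ℚ.+ ((g ∘ suc) ⊙ h) k) ℚ.+ ((f ∘ suc) ⊙ (g ⊙ h)) k ∎
  where open ≡-Reasoning

constS-⊙ : ∀ c f k → (constS c ⊙ f) k ≡ c ℚ.* f k
constS-⊙ c f zero    = refl
constS-⊙ c f (suc k) = trans (cong (c ℚ.* f (suc k) ℚ.+_) (0-⊙ f k)) (ℚ.+-identityʳ _)
  where
  0-⊙ : ∀ f k → ((λ _ → 0ℚ) ⊙ f) k ≡ 0ℚ
  0-⊙ f zero    = ℚ.*-zeroˡ (f 0)
  0-⊙ f (suc k) = trans (cong₂ ℚ._+_ (ℚ.*-zeroˡ (f (suc k))) (0-⊙ f k)) (ℚ.+-identityˡ 0ℚ)

⊙-identityˡ : ∀ f → constS 1ℚ ⊙ f ≈ f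
⊙-identityˡ f k = trans (constS-⊙ 1ℚ f k) (ℚ.*-identityˡ (f k))

seriesRing : CommutativeRing 0ℓ 0ℓ
seriesRing = record
  { Carrier = Series
  ; _≈_ = _≈_
  ; _+_ = _⊕_
  ; _*_ = _⊙_
  ; -_  = ⊖_
  ; 0#  = λ _ → 0ℚ
  ; 1#  = constS 1ℚ
  ; isCommutativeRing = record
    { isRing = record
      { +-isAbelianGroup = isAbelianGroup ℚ.+-0-isAbelianGroup
      ; *-cong = ⊙-cong
      ; *-assoc = ⊙-assoc
      ; *-identity = ⊙-identityˡ , λ f k → trans (⊙-comm f (constS 1ℚ) k) (⊙-identityˡ f k)
      ; distrib = (λ f g h k → trans (⊙-comm f (g ⊕ h) k) (trans (⊙-distribʳ f g h k)
                    (cong₂ ℚ._+_ (⊙-comm g f k) (⊙-comm h f k)))) , ⊙-distribʳ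
      }
    ; *-comm = ⊙-comm
    }
  }

constS-morphism : CommutativeRing.rawRing ℚ.+-*-commutativeRing -Raw-AlmostCommutative⟶ fromCommutativeRing seriesRing
constS-morphism = record
  { ⟦_⟧    = constS
  ; +-homo = λ { a b zero → refl ; a b (suc k) → refl }
  ; *-homo = λ { a b zero → refl ; a b (suc k) → sym (trans (constS-⊙ a (constS b) (suc k)) (ℚ.*-zeroʳ a)) }
  ; -‿homo = λ { a zero → refl ; a (suc k) → refl }
  ; 0-homo = λ { zero → refl ; (suc k) → refl }
  ; 1-homo = λ _ → refl
  }

constS-≟ : ∀ a b → Dec (constS a ≈ constS b)
constS-≟ a b = Relation.Nullary.Decidable.map′ (λ { refl k → refl }) (λ eq → eq 0) (a ℚ.≟ b)

module SeriesSolver = Algebra.Solver.Ring (CommutativeRing.rawRing ℚ.+-*-commutativeRing)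
  (fromCommutativeRing seriesRing) constS-morphism
  (dec⇒weaklyDec constS-≟)

open CommutativeRing seriesRing public using ()
  renaming (setoid to seriesSetoid; semiring to seriesSemiring; refl to ≈-refl; sym to ≈-sym; trans to ≈-trans)
open import Algebra.Properties.Semiring.Exp seriesSemiring public using () renaming (_^_ to _^ˢ_; ^-homo-* to ^ˢ-+)
module ≈-Reasoning = Relation.Binary.Reasoning.Setoid seriesSetoid

⊙-congˡ : ∀ f {g g′} → g ≈ g′ → f ⊙ g ≈ f ⊙ g′
⊙-congˡ f = ⊙-cong {f} ≈-refl

⊙-congʳ : ∀ g {f f′} → f ≈ f′ → f ⊙ g ≈ f′ ⊙ g
⊙-congʳ g p = ⊙-cong p (≈-refl {g})

⊕-cong : ∀ {f f′ g g′} → f ≈ f′ → g ≈ g′ → f ⊕ g ≈ f′ ⊕ g′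
⊕-cong p q k = cong₂ ℚ._+_ (p k) (q k)

zS : Series
zS zero          = 0ℚ
zS (suc zero)    = 1ℚ
zS (suc (suc k)) = 0ℚ

zS-⊙ : ∀ f k → (zS ⊙ f) (suc k) ≡ f k
zS-⊙ f k = trans (cong₂ ℚ._+_ (ℚ.*-zeroˡ (f (suc k))) (trans (⊙-cong {f′ = constS 1ℚ} (λ { zero → refl ; (suc i) → refl }) (≈-refl {f}) k) (⊙-identityˡ f k)))
  (ℚ.+-identityˡ (f k))

^ˢ-0 : ∀ f n → f 0 ≡ 1ℚ → (f ^ˢ n) 0 ≡ 1ℚ
^ˢ-0 f zero    eq = refl
^ˢ-0 f (suc n) eq = trans (cong₂ ℚ._*_ eq (^ˢ-0 f n eq)) (ℚ.*-identityˡ 1ℚ)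

-- The derivation z d/dz

θ : Series → Series
θ f k = ν k ℚ.* f k

θ-cong : ∀ {f g} → f ≈ g → θ f ≈ θ g
θ-cong p k = cong (ν k ℚ.*_) (p k)

θ-constS : ∀ c → θ (constS c) ≈ λ _ → 0ℚ
θ-constS c zero    = trans (cong (ℚ._* c) ν-0) (ℚ.*-zeroˡ c)
θ-constS c (suc k) = ℚ.*-zeroʳ (ν (suc k))

θ-⊙ : ∀ f g → θ (f ⊙ g) ≈ (θ f ⊙ g) ⊕ (f ⊙ θ g)
θ-⊙ f g zero    = trans (cong (ℚ._* (f 0 ℚ.* g 0)) ν-0)
  (sym (trans (cong (λ x → x ℚ.* f 0 ℚ.* g 0 ℚ.+ f 0 ℚ.* (x ℚ.* g 0)) ν-0)
    (solve 2 (λ a b → con 0ℚ :* a :* b :+ a :* (con 0ℚ :* b) := con 0ℚ :* (a :* b)) refl (f 0) (g 0))))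
θ-⊙ f g (suc k) = begin
  ν (suc k) ℚ.* (f 0 ℚ.* g (suc k) ℚ.+ (f′ ⊙ g) k)
    ≡⟨ solve 4 (λ n a b x → n :* (a :* b :+ x) := a :* (n :* b) :+ n :* x) refl (ν (suc k)) (f 0) (g (suc k)) _ ⟩
  f 0 ℚ.* θ g (suc k) ℚ.+ ν (suc k) ℚ.* (f′ ⊙ g) k
    ≡⟨ cong (λ x → f 0 ℚ.* θ g (suc k) ℚ.+ x) (trans (cong (ℚ._* (f′ ⊙ g) k) (ν-suc k)) (trans (ℚ.*-distribʳ-+ ((f′ ⊙ g) k) 1ℚ (ν k)) (cong₂ ℚ._+_ (ℚ.*-identityˡ ((f′ ⊙ g) k)) (θ-⊙ f′ g k)))) ⟩
  f 0 ℚ.* θ g (suc k) ℚ.+ ((f′ ⊙ g) k ℚ.+ ((θ f′ ⊙ g) k ℚ.+ (f′ ⊙ θ g) k))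
    ≡⟨ solve 5 (λ b a x y w → a :+ (x :+ (y :+ w)) := con 0ℚ :* b :+ (x :+ y) :+ (a :+ w)) refl (g (suc k)) (f 0 ℚ.* θ g (suc k)) ((f′ ⊙ g) k) ((θ f′ ⊙ g) k) ((f′ ⊙ θ g) k) ⟩
  0ℚ ℚ.* g (suc k) ℚ.+ ((f′ ⊙ g) k ℚ.+ (θ f′ ⊙ g) k) ℚ.+ (f 0 ℚ.* θ g (suc k) ℚ.+ (f′ ⊙ θ g) k)
    ≡⟨ cong (ℚ._+ (f ⊙ θ g) (suc k)) (cong₂ (λ x y → x ℚ.* g (suc k) ℚ.+ y)
         (sym (trans (cong (ℚ._* f 0) ν-0) (ℚ.*-zeroˡ (f 0))))
         (trans (sym (⊙-distribʳ g f′ (θ f′) k)) (⊙-congʳ g (λ i → sym (tail-θ i)) k))) ⟩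
  (θ f ⊙ g) (suc k) ℚ.+ (f ⊙ θ g) (suc k) ∎
  where
  open ≡-Reasoning
  f′ = f ∘ suc
  tail-θ : ∀ i → θ f (suc i) ≡ (f′ ⊕ θ f′) i
  tail-θ i = trans (cong (ℚ._* f′ i) (ν-suc i)) (trans (ℚ.*-distribʳ-+ (f′ i) 1ℚ (ν i)) (cong (ℚ._+ θ f′ i) (ℚ.*-identityˡ (f′ i))))

open SeriesSolver using () renaming (solve to solveˢ; _:=_ to _≔_; _:+_ to _⊞_; _:*_ to _⊡_; :-_ to ⊟_; con to κ)

constS-ν-suc : ∀ n → constS (ν (suc n)) ≈ constS 1ℚ ⊕ constS (ν n)
constS-ν-suc n zero    = ν-suc n
constS-ν-suc n (suc k) = refl

θ-^ : ∀ f n → θ (f ^ˢ suc n) ≈ constS (ν (suc n)) ⊙ (f ^ˢ n ⊙ θ f)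
θ-^ f zero    = begin
  θ (f ⊙ constS 1ℚ)                                 ≈⟨ θ-⊙ f (constS 1ℚ) ⟩
  (θ f ⊙ constS 1ℚ) ⊕ (f ⊙ θ (constS 1ℚ))           ≈⟨ ⊕-cong {θ f ⊙ constS 1ℚ} ≈-refl (⊙-congˡ f (θ-constS 1ℚ)) ⟩
  (θ f ⊙ constS 1ℚ) ⊕ (f ⊙ (λ _ → 0ℚ))              ≈⟨ ⊕-cong {θ f ⊙ constS 1ℚ} ≈-refl (⊙-congˡ f constS-0) ⟩
  (θ f ⊙ constS 1ℚ) ⊕ (f ⊙ constS 0ℚ)               ≈⟨ solveˢ 2 (λ f d → d ⊡ κ 1ℚ ⊞ f ⊡ κ 0ℚ ≔ κ 1ℚ ⊡ (κ 1ℚ ⊡ d)) ≈-refl f (θ f) ⟩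
  constS 1ℚ ⊙ (constS 1ℚ ⊙ θ f)                     ≈⟨ ⊙-congʳ (constS 1ℚ ⊙ θ f) (λ { zero → sym ν-1 ; (suc k) → refl }) ⟩
  constS (ν 1) ⊙ (constS 1ℚ ⊙ θ f)                  ∎
  where
  open ≈-Reasoning
  constS-0 : (λ _ → 0ℚ) ≈ constS 0ℚ
  constS-0 zero    = refl
  constS-0 (suc k) = refl
θ-^ f (suc n) = begin
  θ (f ⊙ f ^ˢ suc n)                                          ≈⟨ θ-⊙ f (f ^ˢ suc n) ⟩
  (θ f ⊙ f ^ˢ suc n) ⊕ (f ⊙ θ (f ^ˢ suc n))                   ≈⟨ ⊕-cong {θ f ⊙ f ^ˢ suc n} ≈-refl (⊙-congˡ f (θ-^ f n)) ⟩
  (θ f ⊙ (f ⊙ f ^ˢ n)) ⊕ (f ⊙ (constS (ν (suc n)) ⊙ (f ^ˢ n ⊙ θ f)))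
    ≈⟨ solveˢ 4 (λ f d g c → d ⊡ (f ⊡ g) ⊞ f ⊡ (c ⊡ (g ⊡ d)) ≔ (κ 1ℚ ⊞ c) ⊡ (f ⊡ g ⊡ d)) ≈-refl f (θ f) (f ^ˢ n) (constS (ν (suc n))) ⟩
  (constS 1ℚ ⊕ constS (ν (suc n))) ⊙ (f ^ˢ suc n ⊙ θ f)       ≈⟨ ⊙-congʳ (f ^ˢ suc n ⊙ θ f) (constS-ν-suc (suc n)) ⟨
  constS (ν (suc (suc n))) ⊙ (f ^ˢ suc n ⊙ θ f)               ∎
  where open ≈-Reasoning

-- If f has logarithmic derivative h / u then f ^ n has logarithmic derivative n h / u.
θ-^-log : ∀ u f h n → u ⊙ θ f ≈ f ⊙ h → u ⊙ θ (f ^ˢ n) ≈ constS (ν n) ⊙ (f ^ˢ n ⊙ h)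
θ-^-log u f h zero    eq = λ k → trans
  (trans (⊙-comm u (θ (constS 1ℚ)) k) (trans (⊙-congʳ u (λ i → trans (θ-constS 1ℚ i) (sym (0≈ i))) k) (constS-⊙ 0ℚ u k)))
  (sym (trans (trans (constS-⊙ (ν 0) (constS 1ℚ ⊙ h) k) (cong (ℚ._* (constS 1ℚ ⊙ h) k) ν-0)) (trans (ℚ.*-zeroˡ ((constS 1ℚ ⊙ h) k)) (sym (ℚ.*-zeroˡ (u k))))))
  where
  0≈ : ∀ i → constS 0ℚ i ≡ 0ℚ
  0≈ zero    = refl
  0≈ (suc i) = refl
θ-^-log u f h (suc n) eq = begin
  u ⊙ θ (f ^ˢ suc n)                                 ≈⟨ ⊙-congˡ u (θ-^ f n) ⟩
  u ⊙ (constS (ν (suc n)) ⊙ (f ^ˢ n ⊙ θ f))          ≈⟨ solveˢ 4 (λ u c g d → u ⊡ (c ⊡ (g ⊡ d)) ≔ c ⊡ (g ⊡ (u ⊡ d))) ≈-refl u (constS (ν (suc n))) (f ^ˢ n) (θ f) ⟩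
  constS (ν (suc n)) ⊙ (f ^ˢ n ⊙ (u ⊙ θ f))          ≈⟨ ⊙-congˡ (constS (ν (suc n))) (⊙-congˡ (f ^ˢ n) eq) ⟩
  constS (ν (suc n)) ⊙ (f ^ˢ n ⊙ (f ⊙ h))            ≈⟨ solveˢ 4 (λ c g f h → c ⊡ (g ⊡ (f ⊡ h)) ≔ c ⊡ (f ⊡ g ⊡ h)) ≈-refl (constS (ν (suc n))) (f ^ˢ n) f h ⟩
  constS (ν (suc n)) ⊙ (f ^ˢ suc n ⊙ h)              ∎
  where open ≈-Reasoning

-- Division and reciprocal factorials

divℕ-ν : ∀ i {d} → 1 ≤ d → ν d ℚ.* divℕ i d ≡ ι i
divℕ-ν i {suc d} _ = begin
  ν (suc d) ℚ.* (i ℚ./ suc d)          ≡⟨ cong (ν (suc d) ℚ.*_) (/-as-* i d) ⟩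
  ν (suc d) ℚ.* (ι i ℚ.* recip d)      ≡⟨ solve 3 (λ n i r → n :* (i :* r) := i :* (n :* r)) refl (ν (suc d)) (ι i) (recip d) ⟩
  ι i ℚ.* (ν (suc d) ℚ.* recip d)      ≡⟨ cong (ι i ℚ.*_) (ν-recip d) ⟩
  ι i ℚ.* 1ℚ                           ≡⟨ ℚ.*-identityʳ (ι i) ⟩
  ι i                                  ∎
  where open ≡-Reasoning

*-cancel-pos : ∀ {n x y} → 1 ≤ n → ν n ℚ.* x ≡ ν n ℚ.* y → x ≡ y
*-cancel-pos {suc n} _ = *-cancel-ν n

invfact : ℕ → ℚ
invfact k = divℕ (+ 1) (k !)

fact-invfact : ∀ k → ν (k !) ℚ.* invfact k ≡ 1ℚ
fact-invfact k = trans (divℕ-ν (+ 1) (ℕ.1≤n! k)) (trans (ι-pos 1) ν-1)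

invfact-suc : ∀ k → ν (suc k) ℚ.* invfact (suc k) ≡ invfact k
invfact-suc k = *-cancel-pos (ℕ.1≤n! k) (begin
  ν (k !) ℚ.* (ν (suc k) ℚ.* invfact (suc k))   ≡⟨ solve 3 (λ a b c → a :* (b :* c) := b :* a :* c) refl (ν (k !)) (ν (suc k)) (invfact (suc k)) ⟩
  ν (suc k) ℚ.* ν (k !) ℚ.* invfact (suc k)     ≡⟨ cong (ℚ._* invfact (suc k)) (ν-* (suc k) (k !)) ⟨
  ν (suc k !) ℚ.* invfact (suc k)               ≡⟨ fact-invfact (suc k) ⟩
  1ℚ                                            ≡⟨ fact-invfact k ⟨
  ν (k !) ℚ.* invfact k                         ∎)
  where open ≡-Reasoning

-- Bernoulli numbers through the Cauchy product

sumℚ-upTo : ∀ f n → sumℚ (map f (upTo n)) ≡ ∑ n f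
sumℚ-upTo f n = trans (cong sumℚ (map-upTo f n)) (sum-applyUpTo f n)
  where
  sum-applyUpTo : ∀ f n → sumℚ (applyUpTo f n) ≡ ∑ n f
  sum-applyUpTo f zero    = refl
  sum-applyUpTo f (suc n) = cong (f 0 ℚ.+_) (sum-applyUpTo (f ∘ suc) n)

⊙-as-∑ : ∀ f g k → ∑ (suc k) (λ i → f i ℚ.* g (k ∸ i)) ≡ (f ⊙ g) k
⊙-as-∑ f g zero    = ℚ.+-identityʳ (f 0 ℚ.* g 0)
⊙-as-∑ f g (suc k) = cong (f 0 ℚ.* g (suc k) ℚ.+_) (⊙-as-∑ (f ∘ suc) g k)

⊛≈⊙ : ∀ f g → f ⊛ g ≈ f ⊙ g
⊛≈⊙ f g k = trans (sumℚ-upTo (λ i → f i ℚ.* g (k ∸ i)) (suc k)) (⊙-as-∑ f g k)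

^S≈^ˢ : ∀ f n → f ^S n ≈ f ^ˢ n
^S≈^ˢ f zero    zero    = refl
^S≈^ˢ f zero    (suc k) = refl
^S≈^ˢ f (suc n) k       = trans (⊛≈⊙ f (f ^S n) k) (⊙-congˡ f (^S≈^ˢ f n) k)

-- `invRev n` lists the coefficients downwards from index n, so zipping it with an ascending list is
-- a Cauchy product. The recursion defining `invRev` thereby becomes the equation for the inverse
-- series.
zipWith-invRev : ∀ h n → sumℚ (zipWith ℚ._*_ (applyUpTo h (suc n)) (invRev n)) ≡ (h ⊙ x/expm1) n
zipWith-invRev h zero    = ℚ.+-identityʳ (h 0 ℚ.* 1ℚ)
zipWith-invRev h (suc n) = cong (h 0 ℚ.* x/expm1 (suc n) ℚ.+_) (zipWith-invRev (h ∘ suc) n)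

expm1/x-inverse : expm1/x ⊙ x/expm1 ≈ constS 1ℚ
expm1/x-inverse zero    = refl
expm1/x-inverse (suc n) = begin
  1ℚ ℚ.* x/expm1 (suc n) ℚ.+ ((expm1/x ∘ suc) ⊙ x/expm1) n
    ≡⟨ cong₂ ℚ._+_ (ℚ.*-identityˡ (x/expm1 (suc n))) (trans (sym (zipWith-invRev (expm1/x ∘ suc) n))
         (cong (λ l → sumℚ (zipWith ℚ._*_ l (invRev n))) (sym (map-upTo (expm1/x ∘ suc) (suc n))))) ⟩
  ℚ.- s ℚ.+ s  ≡⟨ ℚ.+-inverseˡ s ⟩
  0ℚ ∎
  where
  open ≡-Reasoning
  s = sumℚ (zipWith ℚ._*_ (map (λ j → expm1/x (suc j)) (upTo (suc n))) (invRev n))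

-- The exponential series and x/(e^x-1)

expS exp⁻S : Series
expS  k = invfact k
exp⁻S k = sgn k ℚ.* invfact k

xexp/expm1 : Series
xexp/expm1 = expS ⊙ x/expm1

θ-expS : θ expS ≈ zS ⊙ expS
θ-expS zero    = cong (ℚ._* invfact 0) ν-0
θ-expS (suc k) = trans (invfact-suc k) (sym (zS-⊙ expS k))

θ-exp⁻S : θ exp⁻S ≈ exp⁻S ⊙ (⊖ zS)
θ-exp⁻S k = trans (coeff k) (≈-trans {zS ⊙ (⊖ exp⁻S)} {exp⁻S ⊙ (⊖ zS)} (solveˢ 2 (λ z y → z ⊡ (⊟ y) ≔ y ⊡ (⊟ z)) ≈-refl zS exp⁻S) ≈-refl k)
  where
  coeff : θ exp⁻S ≈ zS ⊙ (⊖ exp⁻S)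
  coeff zero    = cong (ℚ._* (1ℚ ℚ.* invfact 0)) ν-0
  coeff (suc k) = begin
    ν (suc k) ℚ.* (ℚ.- sgn k ℚ.* invfact (suc k))    ≡⟨ solve 3 (λ n s f → n :* (:- s :* f) := :- (s :* (n :* f))) refl (ν (suc k)) (sgn k) (invfact (suc k)) ⟩
    ℚ.- (sgn k ℚ.* (ν (suc k) ℚ.* invfact (suc k)))  ≡⟨ cong (λ x → ℚ.- (sgn k ℚ.* x)) (invfact-suc k) ⟩
    ℚ.- exp⁻S k                                      ≡⟨ zS-⊙ (⊖ exp⁻S) k ⟨
    (zS ⊙ (⊖ exp⁻S)) (suc k)                         ∎
    where open ≡-Reasoning

θ≈0⇒const : ∀ f → (∀ k → θ f k ≡ 0ℚ) → f ≈ constS (f 0)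
θ≈0⇒const f eq zero    = refl
θ≈0⇒const f eq (suc k) = *-cancel-ν k (trans (eq (suc k)) (sym (ℚ.*-zeroʳ (ν (suc k)))))

-- The two logarithmic derivatives -z and z cancel, so the product is constant, and its constant
-- term is 1.
exp-inverse : exp⁻S ⊙ expS ≈ constS 1ℚ
exp-inverse = θ≈0⇒const (exp⁻S ⊙ expS) (λ k → trans (vanish k) (constS-0 k))
  where
  open ≈-Reasoning
  constS-0 : ∀ k → constS 0ℚ k ≡ 0ℚ
  constS-0 zero    = refl
  constS-0 (suc k) = refl
  vanish : θ (exp⁻S ⊙ expS) ≈ constS 0ℚ
  vanish = begin
    θ (exp⁻S ⊙ expS)                                        ≈⟨ θ-⊙ exp⁻S expS ⟩
    (θ exp⁻S ⊙ expS) ⊕ (exp⁻S ⊙ θ expS)                     ≈⟨ ⊕-cong (⊙-congʳ expS θ-exp⁻S) (⊙-congˡ exp⁻S θ-expS) ⟩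
    (exp⁻S ⊙ (⊖ zS) ⊙ expS) ⊕ (exp⁻S ⊙ (zS ⊙ expS))         ≈⟨ solveˢ 3 (λ y z x → y ⊡ (⊟ z) ⊡ x ⊞ y ⊡ (z ⊡ x) ≔ κ 0ℚ) ≈-refl exp⁻S zS expS ⟩
    constS 0ℚ                                               ∎

expS-expm1 : expS ≈ constS 1ℚ ⊕ (zS ⊙ expm1/x)
expS-expm1 zero    = refl
expS-expm1 (suc k) = sym (trans (ℚ.+-identityˡ ((zS ⊙ expm1/x) (suc k))) (zS-⊙ expm1/x k))

θ-expm1/x : θ expm1/x ≈ expS ⊕ (⊖ expm1/x)
θ-expm1/x k = begin
  ν k ℚ.* invfact (suc k)                                          ≡⟨ solve 2 (λ n f → n :* f := (con 1ℚ :+ n) :* f :+ :- f) refl (ν k) (invfact (suc k)) ⟩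
  (1ℚ ℚ.+ ν k) ℚ.* invfact (suc k) ℚ.+ ℚ.- invfact (suc k)         ≡⟨ cong (λ x → x ℚ.* invfact (suc k) ℚ.+ ℚ.- invfact (suc k)) (ν-suc k) ⟨
  ν (suc k) ℚ.* invfact (suc k) ℚ.+ ℚ.- invfact (suc k)            ≡⟨ cong (ℚ._+ ℚ.- invfact (suc k)) (invfact-suc k) ⟩
  invfact k ℚ.+ ℚ.- invfact (suc k)                                ∎
  where open ≡-Reasoning

-- Since `expm1/x ⊙ g` is 1, its derivative vanishes; the product rule, multiplied by g, is solved
-- for θ g. The exponential in θ of `expm1/x` combines with one g to `xexp/expm1`.
θ-x/expm1 : θ x/expm1 ≈ x/expm1 ⊕ (⊖ (x/expm1 ⊙ xexp/expm1))
θ-x/expm1 = begin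
  θ g                                                ≈⟨ solveˢ 1 (λ d → d ≔ κ 1ℚ ⊡ d) ≈-refl (θ g) ⟩
  constS 1ℚ ⊙ θ g                                    ≈⟨ ⊙-congʳ (θ g) expm1/x-inverse ⟨
  expm1/x ⊙ g ⊙ θ g                                  ≈⟨ solveˢ 4 (λ e g d c → e ⊡ g ⊡ d ≔ g ⊡ (c ⊡ g ⊞ e ⊡ d) ⊞ ⊟ (g ⊡ (c ⊡ g))) ≈-refl expm1/x g (θ g) (θ expm1/x) ⟩
  g ⊙ ((θ expm1/x ⊙ g) ⊕ (expm1/x ⊙ θ g)) ⊕ (⊖ (g ⊙ (θ expm1/x ⊙ g)))
                                                     ≈⟨ ⊕-cong (⊙-congˡ g (≈-sym {θ (expm1/x ⊙ g)} (θ-⊙ expm1/x g))) (≈-refl {⊖ (g ⊙ (θ expm1/x ⊙ g))}) ⟩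
  g ⊙ θ (expm1/x ⊙ g) ⊕ (⊖ (g ⊙ (θ expm1/x ⊙ g)))    ≈⟨ ⊕-cong (⊙-congˡ g (λ k → trans (θ-cong expm1/x-inverse k) (trans (θ-constS 1ℚ k) (sym (constS-0 k)))))
                                                          (λ k → cong ℚ.-_ (⊙-congˡ g (⊙-congʳ g θ-expm1/x) k)) ⟩
  g ⊙ constS 0ℚ ⊕ (⊖ (g ⊙ ((expS ⊕ (⊖ expm1/x)) ⊙ g)))
    ≈⟨ solveˢ 3 (λ g x e → g ⊡ κ 0ℚ ⊞ ⊟ (g ⊡ ((x ⊞ ⊟ e) ⊡ g)) ≔ (e ⊡ g) ⊡ g ⊞ ⊟ (g ⊡ (x ⊡ g))) ≈-refl g expS expm1/x ⟩
  expm1/x ⊙ g ⊙ g ⊕ (⊖ (g ⊙ (expS ⊙ g)))             ≈⟨ ⊕-cong (⊙-congʳ g expm1/x-inverse) (≈-refl {⊖ (g ⊙ (expS ⊙ g))}) ⟩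
  constS 1ℚ ⊙ g ⊕ (⊖ (g ⊙ (expS ⊙ g)))               ≈⟨ ⊕-cong (⊙-identityˡ g) (≈-refl {⊖ (g ⊙ (expS ⊙ g))}) ⟩
  g ⊕ (⊖ (g ⊙ (expS ⊙ g)))                           ∎
  where
  open ≈-Reasoning
  g = x/expm1
  constS-0 : ∀ k → constS 0ℚ k ≡ 0ℚ
  constS-0 zero    = refl
  constS-0 (suc k) = refl

θ-xexp/expm1 : θ xexp/expm1 ≈ xexp/expm1 ⊙ (constS 1ℚ ⊕ zS ⊕ (⊖ xexp/expm1))
θ-xexp/expm1 = begin
  θ (expS ⊙ g)                                                ≈⟨ θ-⊙ expS g ⟩
  (θ expS ⊙ g) ⊕ (expS ⊙ θ g)                                 ≈⟨ ⊕-cong (⊙-congʳ g θ-expS) (⊙-congˡ expS θ-x/expm1) ⟩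
  (zS ⊙ expS ⊙ g) ⊕ (expS ⊙ (g ⊕ (⊖ (g ⊙ (expS ⊙ g)))))
    ≈⟨ solveˢ 3 (λ z x g → z ⊡ x ⊡ g ⊞ x ⊡ (g ⊞ ⊟ (g ⊡ (x ⊡ g))) ≔ x ⊡ g ⊡ (κ 1ℚ ⊞ z ⊞ ⊟ (x ⊡ g))) ≈-refl zS expS g ⟩
  expS ⊙ g ⊙ (constS 1ℚ ⊕ zS ⊕ (⊖ (expS ⊙ g)))                ∎
  where
  open ≈-Reasoning
  g = x/expm1

xexp/expm1-shift : xexp/expm1 ≈ x/expm1 ⊕ zS
xexp/expm1-shift = begin
  expS ⊙ g                               ≈⟨ ⊙-congʳ g expS-expm1 ⟩
  (constS 1ℚ ⊕ (zS ⊙ expm1/x)) ⊙ g       ≈⟨ solveˢ 3 (λ z e g → (κ 1ℚ ⊞ z ⊡ e) ⊡ g ≔ g ⊞ z ⊡ (e ⊡ g)) ≈-refl zS expm1/x g ⟩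
  g ⊕ (zS ⊙ (expm1/x ⊙ g))               ≈⟨ ⊕-cong {g} ≈-refl (⊙-congˡ zS expm1/x-inverse) ⟩
  g ⊕ (zS ⊙ constS 1ℚ)                   ≈⟨ solveˢ 2 (λ g z → g ⊞ z ⊡ κ 1ℚ ≔ g ⊞ z) ≈-refl g zS ⟩
  g ⊕ zS                                 ∎
  where
  open ≈-Reasoning
  g = x/expm1

exp⁻-xexp/expm1 : exp⁻S ⊙ xexp/expm1 ≈ x/expm1
exp⁻-xexp/expm1 = begin
  exp⁻S ⊙ (expS ⊙ g)     ≈⟨ ⊙-assoc exp⁻S expS g ⟨
  exp⁻S ⊙ expS ⊙ g       ≈⟨ ⊙-congʳ g exp-inverse ⟩
  constS 1ℚ ⊙ g          ≈⟨ ⊙-identityˡ g ⟩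
  g                      ∎
  where
  open ≈-Reasoning
  g = x/expm1

^ˢ-⊙ : ∀ f g n → (f ⊙ g) ^ˢ n ≈ f ^ˢ n ⊙ g ^ˢ n
^ˢ-⊙ f g zero    = ≈-sym {constS 1ℚ ⊙ constS 1ℚ} (⊙-identityˡ (constS 1ℚ))
^ˢ-⊙ f g (suc n) = ≈-trans {(f ⊙ g) ⊙ (f ⊙ g) ^ˢ n} (⊙-congˡ (f ⊙ g) (^ˢ-⊙ f g n))
  (solveˢ 4 (λ f g x y → f ⊡ g ⊡ (x ⊡ y) ≔ f ⊡ x ⊡ (g ⊡ y)) ≈-refl f g (f ^ˢ n) (g ^ˢ n))

^ˢ-cong : ∀ {f g} n → f ≈ g → f ^ˢ n ≈ g ^ˢ n
^ˢ-cong zero    eq = ≈-refl {constS 1ℚ}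
^ˢ-cong (suc n) eq = ⊙-cong eq (^ˢ-cong n eq)

-- Lagrange inversion

oneMinusZ : Series
oneMinusZ = constS 1ℚ ⊕ (⊖ zS)

-- Λ = - log (1 - z) / z
Λ : Series
Λ = recip

logPow : ℕ → ℕ → Series
logPow m M = oneMinusZ ^ˢ m ⊙ Λ ^ˢ M

-- e^{-cw} (w / (1 - e^{-w}))^r
todd : ℕ → ℕ → Series
todd c r = exp⁻S ^ˢ c ⊙ xexp/expm1 ^ˢ r

θ-^-log₁ : ∀ f h n → θ f ≈ f ⊙ h → θ (f ^ˢ n) ≈ constS (ν n) ⊙ (f ^ˢ n ⊙ h)
θ-^-log₁ f h n eq = ≈-trans {θ (f ^ˢ n)} (≈-sym {constS 1ℚ ⊙ θ (f ^ˢ n)} (⊙-identityˡ (θ (f ^ˢ n))))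
  (θ-^-log (constS 1ℚ) f h n (≈-trans {constS 1ℚ ⊙ θ f} (⊙-identityˡ (θ f)) eq))

-- The logarithmic derivative is -c z + r (1 + z - G) with G = `xexp/expm1`. Its term in G raises
-- the exponent r by one, so differentiation links r with r + 1. The terms are distributed so that
-- no minus sign remains.
todd-θ : ∀ c r → (constS (ν r) ⊙ todd c (suc r)) ⊕ θ (todd c r) ⊕ (constS (ν c) ⊙ (zS ⊙ todd c r))
               ≈ (constS (ν r) ⊙ todd c r) ⊕ (constS (ν r) ⊙ (zS ⊙ todd c r))
todd-θ c r = begin
  (νr ⊙ (Yᶜ ⊙ (G ⊙ Gʳ))) ⊕ θ (Yᶜ ⊙ Gʳ) ⊕ (νc ⊙ (zS ⊙ (Yᶜ ⊙ Gʳ)))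
    ≈⟨ ⊕-cong (⊕-cong {νr ⊙ (Yᶜ ⊙ (G ⊙ Gʳ))} ≈-refl (≈-trans {θ (Yᶜ ⊙ Gʳ)} (θ-⊙ Yᶜ Gʳ)
         (⊕-cong (⊙-congʳ Gʳ (θ-^-log₁ exp⁻S (⊖ zS) c θ-exp⁻S)) (⊙-congˡ Yᶜ (θ-^-log₁ G (constS 1ℚ ⊕ zS ⊕ (⊖ G)) r θ-xexp/expm1)))))
         (≈-refl {νc ⊙ (zS ⊙ (Yᶜ ⊙ Gʳ))}) ⟩
  (νr ⊙ (Yᶜ ⊙ (G ⊙ Gʳ))) ⊕ ((νc ⊙ (Yᶜ ⊙ (⊖ zS)) ⊙ Gʳ) ⊕ (Yᶜ ⊙ (νr ⊙ (Gʳ ⊙ (constS 1ℚ ⊕ zS ⊕ (⊖ G)))))) ⊕ (νc ⊙ (zS ⊙ (Yᶜ ⊙ Gʳ)))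
    ≈⟨ solveˢ 6 (λ νr νc y g gr z → νr ⊡ (y ⊡ (g ⊡ gr)) ⊞ (νc ⊡ (y ⊡ (⊟ z)) ⊡ gr ⊞ y ⊡ (νr ⊡ (gr ⊡ (κ 1ℚ ⊞ z ⊞ ⊟ g)))) ⊞ νc ⊡ (z ⊡ (y ⊡ gr))
         ≔ νr ⊡ (y ⊡ gr) ⊞ νr ⊡ (z ⊡ (y ⊡ gr))) ≈-refl νr νc Yᶜ G Gʳ zS ⟩
  (νr ⊙ (Yᶜ ⊙ Gʳ)) ⊕ (νr ⊙ (zS ⊙ (Yᶜ ⊙ Gʳ))) ∎
  where
  open ≈-Reasoning
  νr νc G Yᶜ Gʳ : Series
  νr = constS (ν r)
  νc = constS (ν c)
  G  = xexp/expm1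
  Yᶜ = exp⁻S ^ˢ c
  Gʳ = G ^ˢ r

constS-zS-⊙ : ∀ c f j → (constS c ⊙ (zS ⊙ f)) (suc j) ≡ c ℚ.* f j
constS-zS-⊙ c f j = trans (constS-⊙ c (zS ⊙ f) (suc j)) (cong (c ℚ.*_) (zS-⊙ f j))

todd-rec : ∀ c r j → ν r ℚ.* todd c (suc r) (suc j) ℚ.+ ν (suc j) ℚ.* todd c r (suc j) ℚ.+ ν c ℚ.* todd c r j
                   ≡ ν r ℚ.* todd c r (suc j) ℚ.+ ν r ℚ.* todd c r j
todd-rec c r j = begin
  ν r ℚ.* todd c (suc r) (suc j) ℚ.+ ν (suc j) ℚ.* todd c r (suc j) ℚ.+ ν c ℚ.* todd c r j
    ≡⟨ cong₂ (λ x y → x ℚ.+ ν (suc j) ℚ.* todd c r (suc j) ℚ.+ y) (constS-⊙ (ν r) (todd c (suc r)) (suc j)) (constS-zS-⊙ (ν c) (todd c r) j) ⟨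
  ((constS (ν r) ⊙ todd c (suc r)) ⊕ θ (todd c r) ⊕ (constS (ν c) ⊙ (zS ⊙ todd c r))) (suc j)
    ≡⟨ todd-θ c r (suc j) ⟩
  ((constS (ν r) ⊙ todd c r) ⊕ (constS (ν r) ⊙ (zS ⊙ todd c r))) (suc j)
    ≡⟨ cong₂ ℚ._+_ (constS-⊙ (ν r) (todd c r) (suc j)) (constS-zS-⊙ (ν r) (todd c r) j) ⟩
  ν r ℚ.* todd c r (suc j) ℚ.+ ν r ℚ.* todd c r j ∎
  where open ≡-Reasoning

oneMinusZ-⊙ : ∀ f j → (oneMinusZ ⊙ f) (suc j) ≡ f (suc j) ℚ.- f j
oneMinusZ-⊙ f j = trans (solveˢ 2 (λ z f → (κ 1ℚ ⊞ ⊟ z) ⊡ f ≔ f ⊞ ⊟ (z ⊡ f)) ≈-refl zS f (suc j))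
  (cong (λ x → f (suc j) ℚ.- x) (zS-⊙ f j))

θ-oneMinusZ : oneMinusZ ⊙ θ oneMinusZ ≈ oneMinusZ ⊙ (⊖ zS)
θ-oneMinusZ = ⊙-congˡ oneMinusZ coeff
  where
  coeff : θ oneMinusZ ≈ ⊖ zS
  coeff zero          = cong (ℚ._* (1ℚ ℚ.- 0ℚ)) ν-0
  coeff (suc zero)    = cong (ℚ._* (0ℚ ℚ.- 1ℚ)) ν-1
  coeff (suc (suc k)) = ℚ.*-zeroʳ (ν (suc (suc k)))

-- From z Λ = -log(1-z), the sum θ Λ + Λ is the geometric series 1/(1-z).
θ-Λ : (oneMinusZ ⊙ θ Λ) ⊕ (oneMinusZ ⊙ Λ) ≈ constS 1ℚ
θ-Λ = begin
  (oneMinusZ ⊙ θ Λ) ⊕ (oneMinusZ ⊙ Λ)     ≈⟨ solveˢ 3 (λ u a b → u ⊡ a ⊞ u ⊡ b ≔ u ⊡ (a ⊞ b)) ≈-refl oneMinusZ (θ Λ) Λ ⟩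
  oneMinusZ ⊙ (θ Λ ⊕ Λ)                   ≈⟨ ⊙-congˡ oneMinusZ ones ⟩
  oneMinusZ ⊙ (λ _ → 1ℚ)                  ≈⟨ geometric ⟩
  constS 1ℚ                               ∎
  where
  open ≈-Reasoning
  ones : θ Λ ⊕ Λ ≈ λ _ → 1ℚ
  ones k = trans (solve 2 (λ n r → n :* r :+ r := (con 1ℚ :+ n) :* r) refl (ν k) (recip k))
    (trans (cong (ℚ._* recip k) (sym (ν-suc k))) (ν-recip k))
  geometric : oneMinusZ ⊙ (λ _ → 1ℚ) ≈ constS 1ℚ
  geometric zero    = refl
  geometric (suc k) = oneMinusZ-⊙ (λ _ → 1ℚ) k

logPow-θ-0 : ∀ m → (oneMinusZ ⊙ θ (logPow m 0)) ⊕ (constS (ν m) ⊙ (zS ⊙ logPow m 0)) ≈ constS 0ℚ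
logPow-θ-0 m = begin
  (u ⊙ θ (uᵐ ⊙ constS 1ℚ)) ⊕ (νm ⊙ (zS ⊙ (uᵐ ⊙ constS 1ℚ)))
    ≈⟨ ⊕-cong (⊙-congˡ u (θ-cong {uᵐ ⊙ constS 1ℚ} (solveˢ 1 (λ x → x ⊡ κ 1ℚ ≔ x) ≈-refl uᵐ))) (≈-refl {νm ⊙ (zS ⊙ (uᵐ ⊙ constS 1ℚ))}) ⟩
  (u ⊙ θ uᵐ) ⊕ (νm ⊙ (zS ⊙ (uᵐ ⊙ constS 1ℚ)))
    ≈⟨ ⊕-cong (θ-^-log u u (⊖ zS) m θ-oneMinusZ) (≈-refl {νm ⊙ (zS ⊙ (uᵐ ⊙ constS 1ℚ))}) ⟩
  (νm ⊙ (uᵐ ⊙ (⊖ zS))) ⊕ (νm ⊙ (zS ⊙ (uᵐ ⊙ constS 1ℚ)))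
    ≈⟨ solveˢ 3 (λ n x z → n ⊡ (x ⊡ (⊟ z)) ⊞ n ⊡ (z ⊡ (x ⊡ κ 1ℚ)) ≔ κ 0ℚ) ≈-refl νm uᵐ zS ⟩
  constS 0ℚ ∎
  where
  open ≈-Reasoning
  u uᵐ νm : Series
  u  = oneMinusZ
  uᵐ = u ^ˢ m
  νm = constS (ν m)

-- The factor 1 - z clears the denominators in the derivatives of both (1-z)^m and Λ; comparing
-- coefficients then gives a recurrence involving only j and j + 1.
logPow-θ-suc : ∀ m M → (oneMinusZ ⊙ θ (logPow m (suc M))) ⊕ (constS (ν (suc M)) ⊙ (oneMinusZ ⊙ logPow m (suc M)))
                        ⊕ (constS (ν m) ⊙ (zS ⊙ logPow m (suc M)))
                     ≈ constS (ν (suc M)) ⊙ logPow m M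
logPow-θ-suc m M = begin
  (u ⊙ θ (uᵐ ⊙ (Λ ⊙ Λᴹ))) ⊕ (νM ⊙ (u ⊙ (uᵐ ⊙ (Λ ⊙ Λᴹ)))) ⊕ (νm ⊙ (zS ⊙ (uᵐ ⊙ (Λ ⊙ Λᴹ))))
    ≈⟨ rest (⊙-congˡ u (≈-trans {θ (uᵐ ⊙ (Λ ⊙ Λᴹ))} (θ-⊙ uᵐ (Λ ⊙ Λᴹ)) (⊕-cong {θ uᵐ ⊙ (Λ ⊙ Λᴹ)} ≈-refl (⊙-congˡ uᵐ (θ-^ Λ M))))) ⟩
  (u ⊙ ((θ uᵐ ⊙ (Λ ⊙ Λᴹ)) ⊕ (uᵐ ⊙ (νM ⊙ (Λᴹ ⊙ θ Λ))))) ⊕ (νM ⊙ (u ⊙ (uᵐ ⊙ (Λ ⊙ Λᴹ)))) ⊕ (νm ⊙ (zS ⊙ (uᵐ ⊙ (Λ ⊙ Λᴹ))))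
    ≈⟨ solveˢ 9 (λ u x dx l d y M m z → u ⊡ (dx ⊡ (l ⊡ y) ⊞ x ⊡ (M ⊡ (y ⊡ d))) ⊞ M ⊡ (u ⊡ (x ⊡ (l ⊡ y))) ⊞ m ⊡ (z ⊡ (x ⊡ (l ⊡ y)))
         ≔ (u ⊡ dx ⊞ m ⊡ (x ⊡ z)) ⊡ (l ⊡ y) ⊞ M ⊡ (x ⊡ y) ⊡ (u ⊡ d ⊞ u ⊡ l)) ≈-refl u uᵐ (θ uᵐ) Λ (θ Λ) Λᴹ νM νm zS ⟩
  (((u ⊙ θ uᵐ) ⊕ (νm ⊙ (uᵐ ⊙ zS))) ⊙ (Λ ⊙ Λᴹ)) ⊕ (νM ⊙ (uᵐ ⊙ Λᴹ) ⊙ ((u ⊙ θ Λ) ⊕ (u ⊙ Λ)))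
    ≈⟨ ⊕-cong (⊙-congʳ (Λ ⊙ Λᴹ) (⊕-cong (θ-^-log u u (⊖ zS) m θ-oneMinusZ) (≈-refl {νm ⊙ (uᵐ ⊙ zS)}))) (⊙-congˡ (νM ⊙ (uᵐ ⊙ Λᴹ)) θ-Λ) ⟩
  (((νm ⊙ (uᵐ ⊙ (⊖ zS))) ⊕ (νm ⊙ (uᵐ ⊙ zS))) ⊙ (Λ ⊙ Λᴹ)) ⊕ (νM ⊙ (uᵐ ⊙ Λᴹ) ⊙ constS 1ℚ)
    ≈⟨ solveˢ 6 (λ x l y M m z → (m ⊡ (x ⊡ (⊟ z)) ⊞ m ⊡ (x ⊡ z)) ⊡ (l ⊡ y) ⊞ M ⊡ (x ⊡ y) ⊡ κ 1ℚ ≔ M ⊡ (x ⊡ y)) ≈-refl uᵐ Λ Λᴹ νM νm zS ⟩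
  νM ⊙ (uᵐ ⊙ Λᴹ) ∎
  where
  open ≈-Reasoning
  u uᵐ Λᴹ νm νM : Series
  u  = oneMinusZ
  uᵐ = u ^ˢ m
  Λᴹ = Λ ^ˢ M
  νm = constS (ν m)
  νM = constS (ν (suc M))
  rest : ∀ {f f′} → f ≈ f′ → f ⊕ (νM ⊙ (u ⊙ (uᵐ ⊙ (Λ ⊙ Λᴹ)))) ⊕ (νm ⊙ (zS ⊙ (uᵐ ⊙ (Λ ⊙ Λᴹ)))) ≈ f′ ⊕ (νM ⊙ (u ⊙ (uᵐ ⊙ (Λ ⊙ Λᴹ)))) ⊕ (νm ⊙ (zS ⊙ (uᵐ ⊙ (Λ ⊙ Λᴹ))))
  rest p k = cong (λ x → x ℚ.+ (νM ⊙ (u ⊙ (uᵐ ⊙ (Λ ⊙ Λᴹ)))) k ℚ.+ (νm ⊙ (zS ⊙ (uᵐ ⊙ (Λ ⊙ Λᴹ)))) k) (p k)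

logPow-rec-0 : ∀ m j → ν (suc j) ℚ.* logPow m 0 (suc j) ℚ.- ν j ℚ.* logPow m 0 j ℚ.+ ν m ℚ.* logPow m 0 j ≡ 0ℚ
logPow-rec-0 m j = trans (sym (cong₂ ℚ._+_ (oneMinusZ-⊙ (θ (logPow m 0)) j) (constS-zS-⊙ (ν m) (logPow m 0) j))) (logPow-θ-0 m (suc j))

logPow-rec-suc : ∀ m M j → ν (suc j) ℚ.* logPow m (suc M) (suc j) ℚ.- ν j ℚ.* logPow m (suc M) j
                             ℚ.+ ν (suc M) ℚ.* (logPow m (suc M) (suc j) ℚ.- logPow m (suc M) j) ℚ.+ ν m ℚ.* logPow m (suc M) j
                         ≡ ν (suc M) ℚ.* logPow m M (suc j)
logPow-rec-suc m M j = trans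
  (sym (cong₂ ℚ._+_ (cong₂ ℚ._+_ (oneMinusZ-⊙ (θ L) j)
    (trans (constS-⊙ (ν (suc M)) (oneMinusZ ⊙ L) (suc j)) (cong (ν (suc M) ℚ.*_) (oneMinusZ-⊙ L j)))) (constS-zS-⊙ (ν m) L j)))
  (trans (logPow-θ-suc m M (suc j)) (constS-⊙ (ν (suc M)) (logPow m M) (suc j)))
  where
  L : Series
  L = logPow m (suc M)

logPow-0 : ∀ m M → logPow m M 0 ≡ 1ℚ
logPow-0 m M = cong₂ ℚ._*_ (^ˢ-0 oneMinusZ m refl) (^ˢ-0 Λ M (sym (1/suc≡recip 0)))

todd-0 : ∀ c r → todd c r 0 ≡ 1ℚ
todd-0 c r = cong₂ ℚ._*_ (^ˢ-0 exp⁻S c refl) (^ˢ-0 xexp/expm1 r refl)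

-- The coefficient of z^j is a residue, computed on the right after substituting z = 1 - e^{-w};
-- instead of substituting, the proof compares the recurrences of both sides.
logPow≡todd : ∀ m M j → logPow m M j ≡ todd (suc m) (suc (M + j)) j
logPow≡todd m M zero = trans (logPow-0 m M) (sym (todd-0 (suc m) (suc (M + 0))))
logPow≡todd m zero (suc j) = *-cancel-ν j (sym (begin
  νj ℚ.* t₁
    ≡⟨ solve 5 (λ r t₁ t₂ c t₃ → r :* t₁ := r :* t₁ :+ r :* t₂ :+ c :* t₃ :- (r :* t₂ :+ c :* t₃)) refl νj t₁ t₂ νc t₃ ⟩
  νj ℚ.* t₁ ℚ.+ νj ℚ.* t₂ ℚ.+ νc ℚ.* t₃ ℚ.- (νj ℚ.* t₂ ℚ.+ νc ℚ.* t₃)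
    ≡⟨ cong (ℚ._- (νj ℚ.* t₂ ℚ.+ νc ℚ.* t₃)) (todd-rec (suc m) (suc j) j) ⟩
  -- The value `t₂` would belong to M = -1, where no induction hypothesis exists. Here r = j + 1, so
  -- its two occurrences cancel.
  νj ℚ.* t₂ ℚ.+ νj ℚ.* t₃ ℚ.- (νj ℚ.* t₂ ℚ.+ νc ℚ.* t₃)
    ≡⟨ cong₂ (λ a b → a ℚ.* t₂ ℚ.+ a ℚ.* t₃ ℚ.- (a ℚ.* t₂ ℚ.+ b ℚ.* t₃)) (ν-suc j) (ν-suc m) ⟩
  (1ℚ ℚ.+ ν j) ℚ.* t₂ ℚ.+ (1ℚ ℚ.+ ν j) ℚ.* t₃ ℚ.- ((1ℚ ℚ.+ ν j) ℚ.* t₂ ℚ.+ (1ℚ ℚ.+ ν m) ℚ.* t₃)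
    ≡⟨ cong (λ x → (1ℚ ℚ.+ ν j) ℚ.* t₂ ℚ.+ (1ℚ ℚ.+ ν j) ℚ.* x ℚ.- ((1ℚ ℚ.+ ν j) ℚ.* t₂ ℚ.+ (1ℚ ℚ.+ ν m) ℚ.* x)) (logPow≡todd m zero j) ⟨
  (1ℚ ℚ.+ ν j) ℚ.* t₂ ℚ.+ (1ℚ ℚ.+ ν j) ℚ.* l ℚ.- ((1ℚ ℚ.+ ν j) ℚ.* t₂ ℚ.+ (1ℚ ℚ.+ ν m) ℚ.* l)
    ≡⟨ solve 5 (λ j m t₂ l a → (con 1ℚ :+ j) :* t₂ :+ (con 1ℚ :+ j) :* l :- ((con 1ℚ :+ j) :* t₂ :+ (con 1ℚ :+ m) :* l) := a :- (a :- j :* l :+ m :* l))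
         refl (ν j) (ν m) t₂ l (νj ℚ.* logPow m 0 (suc j)) ⟩
  νj ℚ.* logPow m 0 (suc j) ℚ.- (νj ℚ.* logPow m 0 (suc j) ℚ.- ν j ℚ.* l ℚ.+ ν m ℚ.* l)
    ≡⟨ cong (λ x → νj ℚ.* logPow m 0 (suc j) ℚ.- x) (logPow-rec-0 m j) ⟩
  νj ℚ.* logPow m 0 (suc j) ℚ.- 0ℚ
    ≡⟨ ℚ.+-identityʳ (νj ℚ.* logPow m 0 (suc j)) ⟩
  νj ℚ.* logPow m 0 (suc j) ∎))
  where
  open ≡-Reasoning
  νj νc t₁ t₂ t₃ l : ℚ
  νj = ν (suc j)
  νc = ν (suc m)
  t₁ = todd (suc m) (suc (suc j)) (suc j)
  t₂ = todd (suc m) (suc j) (suc j)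
  t₃ = todd (suc m) (suc j) j
  l  = logPow m 0 j
logPow≡todd m (suc M) (suc j) = *-cancel-ν (M + suc j) (sym (begin
  νr ℚ.* t₁
    ≡⟨ solve 6 (λ r t₁ j t₂ c t₃ → r :* t₁ := r :* t₁ :+ j :* t₂ :+ c :* t₃ :- (j :* t₂ :+ c :* t₃)) refl νr t₁ (ν (suc j)) t₂ (ν (suc m)) t₃ ⟩
  νr ℚ.* t₁ ℚ.+ ν (suc j) ℚ.* t₂ ℚ.+ ν (suc m) ℚ.* t₃ ℚ.- (ν (suc j) ℚ.* t₂ ℚ.+ ν (suc m) ℚ.* t₃)
    ≡⟨ cong (ℚ._- (ν (suc j) ℚ.* t₂ ℚ.+ ν (suc m) ℚ.* t₃)) (todd-rec (suc m) (suc M + suc j) j) ⟩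
  νr ℚ.* t₂ ℚ.+ νr ℚ.* t₃ ℚ.- (ν (suc j) ℚ.* t₂ ℚ.+ ν (suc m) ℚ.* t₃)
    -- The hypotheses at (M, j+1) and (M+1, j) have the same exponent r = M + j + 2 on the right
    -- side, which is why a single instance of `todd-rec` suffices.
    ≡⟨ cong₂ (λ x y → νr ℚ.* x ℚ.+ νr ℚ.* y ℚ.- (ν (suc j) ℚ.* x ℚ.+ ν (suc m) ℚ.* y)) (logPow≡todd m M (suc j))
         (trans (logPow≡todd m (suc M) j) (cong (λ r → todd (suc m) r j) (cong suc (sym (ℕ.+-suc M j))))) ⟨
  νr ℚ.* l₀ ℚ.+ νr ℚ.* l₁ ℚ.- (ν (suc j) ℚ.* l₀ ℚ.+ ν (suc m) ℚ.* l₁)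
    ≡⟨ cong (λ r → r ℚ.* l₀ ℚ.+ r ℚ.* l₁ ℚ.- (ν (suc j) ℚ.* l₀ ℚ.+ ν (suc m) ℚ.* l₁)) (ν-+ (suc M) (suc j)) ⟩
  (νM ℚ.+ ν (suc j)) ℚ.* l₀ ℚ.+ (νM ℚ.+ ν (suc j)) ℚ.* l₁ ℚ.- (ν (suc j) ℚ.* l₀ ℚ.+ ν (suc m) ℚ.* l₁)
    ≡⟨ cong₂ (λ a b → (νM ℚ.+ a) ℚ.* l₀ ℚ.+ (νM ℚ.+ a) ℚ.* l₁ ℚ.- (a ℚ.* l₀ ℚ.+ b ℚ.* l₁)) (ν-suc j) (ν-suc m) ⟩
  (νM ℚ.+ (1ℚ ℚ.+ ν j)) ℚ.* l₀ ℚ.+ (νM ℚ.+ (1ℚ ℚ.+ ν j)) ℚ.* l₁ ℚ.- ((1ℚ ℚ.+ ν j) ℚ.* l₀ ℚ.+ (1ℚ ℚ.+ ν m) ℚ.* l₁)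
    ≡⟨ solve 5 (λ M j m l₀ l₁ → (M :+ (con 1ℚ :+ j)) :* l₀ :+ (M :+ (con 1ℚ :+ j)) :* l₁ :- ((con 1ℚ :+ j) :* l₀ :+ (con 1ℚ :+ m) :* l₁)
         := M :* l₀ :+ (M :* l₁ :+ j :* l₁ :- m :* l₁)) refl νM (ν j) (ν m) l₀ l₁ ⟩
  νM ℚ.* l₀ ℚ.+ (νM ℚ.* l₁ ℚ.+ ν j ℚ.* l₁ ℚ.- ν m ℚ.* l₁)
    ≡⟨ cong (ℚ._+ (νM ℚ.* l₁ ℚ.+ ν j ℚ.* l₁ ℚ.- ν m ℚ.* l₁)) (logPow-rec-suc m M j) ⟨
  ν (suc j) ℚ.* l₂ ℚ.- ν j ℚ.* l₁ ℚ.+ νM ℚ.* (l₂ ℚ.- l₁) ℚ.+ ν m ℚ.* l₁ ℚ.+ (νM ℚ.* l₁ ℚ.+ ν j ℚ.* l₁ ℚ.- ν m ℚ.* l₁)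
    ≡⟨ solve 6 (λ s M j m l₁ l₂ → s :* l₂ :- j :* l₁ :+ M :* (l₂ :- l₁) :+ m :* l₁ :+ (M :* l₁ :+ j :* l₁ :- m :* l₁) := (M :+ s) :* l₂)
         refl (ν (suc j)) νM (ν j) (ν m) l₁ l₂ ⟩
  (νM ℚ.+ ν (suc j)) ℚ.* l₂
    ≡⟨ cong (ℚ._* l₂) (ν-+ (suc M) (suc j)) ⟨
  νr ℚ.* l₂ ∎))
  where
  open ≡-Reasoning
  νr νM t₁ t₂ t₃ l₀ l₁ l₂ : ℚ
  νr = ν (suc M + suc j)
  νM = ν (suc M)
  t₁ = todd (suc m) (suc (suc M + suc j)) (suc j)
  t₂ = todd (suc m) (suc M + suc j) (suc j)
  t₃ = todd (suc m) (suc M + suc j) j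
  l₀ = logPow m M (suc j)
  l₁ = logPow m (suc M) j
  l₂ = logPow m (suc M) (suc j)

oneMinusZ-^ : ∀ m j → (oneMinusZ ^ˢ m) j ≡ sgn j ℚ.* binom m j
oneMinusZ-^ zero    zero    = sym (trans (ℚ.*-identityˡ (binom 0 0)) (binom-n-0 0))
oneMinusZ-^ zero    (suc j) = sym (trans (cong (sgn (suc j) ℚ.*_) (binom-0 {0} {suc j} (s≤s z≤n))) (ℚ.*-zeroʳ (sgn (suc j))))
oneMinusZ-^ (suc m) zero    = trans (cong (1ℚ ℚ.*_) (oneMinusZ-^ m 0)) (trans (ℚ.*-identityˡ _) (cong (1ℚ ℚ.*_) (trans (binom-n-0 m) (sym (binom-n-0 (suc m))))))
oneMinusZ-^ (suc m) (suc j) = begin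
  (oneMinusZ ⊙ oneMinusZ ^ˢ m) (suc j)                             ≡⟨ oneMinusZ-⊙ (oneMinusZ ^ˢ m) j ⟩
  (oneMinusZ ^ˢ m) (suc j) ℚ.- (oneMinusZ ^ˢ m) j                  ≡⟨ cong₂ ℚ._-_ (oneMinusZ-^ m (suc j)) (oneMinusZ-^ m j) ⟩
  ℚ.- sgn j ℚ.* binom m (suc j) ℚ.- sgn j ℚ.* binom m j            ≡⟨ solve 3 (λ s a b → :- s :* b :- s :* a := :- s :* (a :+ b)) refl (sgn j) (binom m j) (binom m (suc j)) ⟩
  ℚ.- sgn j ℚ.* (binom m j ℚ.+ binom m (suc j))                    ≡⟨ cong (ℚ.- sgn j ℚ.*_) (binom-pascal m j) ⟨
  sgn (suc j) ℚ.* binom (suc m) (suc j)                            ∎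
  where open ≡-Reasoning

-- Rationals with denominator prime to p, for p = q + 1

module _ (q : ℕ) (p-prime : Prime (suc q)) where

  p : ℕ
  p = suc q

  1<p : 1 < p
  1<p = nonTrivial⇒n>1 p {{prime⇒nonTrivial p-prime}}

  p∤* : ∀ {m n} → p ∤ m → p ∤ n → p ∤ m * n
  p∤* {m} {n} p∤m p∤n p∣mn with euclidsLemma m n p-prime p∣mn
  ... | inj₁ p∣m = p∤m p∣m
  ... | inj₂ p∣n = p∤n p∣n

  p∤1 : p ∤ 1
  p∤1 = >⇒∤ 1<p

  record Integral (x : ℚ) : Set where
    constructor integral
    field
      num     : ℤ
      den     : ℕ
      p∤den   : p ∤ den
      den*x≡num : ν den ℚ.* x ≡ ι num

  int-ι : ∀ i → Integral (ι i)
  int-ι i = integral i 1 p∤1 (trans (cong (ℚ._* ι i) ν-1) (ℚ.*-identityˡ (ι i)))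

  int-ν : ∀ n → Integral (ν n)
  int-ν n = subst Integral (ι-pos n) (int-ι (+ n))

  int-0 : Integral 0ℚ
  int-0 = subst Integral ν-0 (int-ν 0)

  int-1 : Integral 1ℚ
  int-1 = subst Integral ν-1 (int-ν 1)

  int-binom : ∀ n k → Integral (binom n k)
  int-binom n k = int-ν (n C k)

  int-+ : ∀ {x y} → Integral x → Integral y → Integral (x ℚ.+ y)
  int-+ {x} {y} (integral a m p∤m mx≡a) (integral b n p∤n ny≡b) = integral (+ n ℤ.* a ℤ.+ + m ℤ.* b) (m * n) (p∤* p∤m p∤n) (begin
    ν (m * n) ℚ.* (x ℚ.+ y)                           ≡⟨ cong (ℚ._* (x ℚ.+ y)) (ν-* m n) ⟩
    ν m ℚ.* ν n ℚ.* (x ℚ.+ y)                         ≡⟨ solve 4 (λ m n x y → m :* n :* (x :+ y) := n :* (m :* x) :+ m :* (n :* y)) refl (ν m) (ν n) x y ⟩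
    ν n ℚ.* (ν m ℚ.* x) ℚ.+ ν m ℚ.* (ν n ℚ.* y)       ≡⟨ cong₂ ℚ._+_ (cong₂ ℚ._*_ (sym (ι-pos n)) mx≡a) (cong₂ ℚ._*_ (sym (ι-pos m)) ny≡b) ⟩
    ι (+ n) ℚ.* ι a ℚ.+ ι (+ m) ℚ.* ι b               ≡⟨ cong₂ ℚ._+_ (ι-* (+ n) a) (ι-* (+ m) b) ⟨
    ι (+ n ℤ.* a) ℚ.+ ι (+ m ℤ.* b)                   ≡⟨ ι-+ (+ n ℤ.* a) (+ m ℤ.* b) ⟨
    ι (+ n ℤ.* a ℤ.+ + m ℤ.* b)                       ∎)
    where open ≡-Reasoning

  int-* : ∀ {x y} → Integral x → Integral y → Integral (x ℚ.* y)
  int-* {x} {y} (integral a m p∤m mx≡a) (integral b n p∤n ny≡b) = integral (a ℤ.* b) (m * n) (p∤* p∤m p∤n) (begin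
    ν (m * n) ℚ.* (x ℚ.* y)               ≡⟨ cong (ℚ._* (x ℚ.* y)) (ν-* m n) ⟩
    ν m ℚ.* ν n ℚ.* (x ℚ.* y)             ≡⟨ solve 4 (λ m n x y → m :* n :* (x :* y) := (m :* x) :* (n :* y)) refl (ν m) (ν n) x y ⟩
    (ν m ℚ.* x) ℚ.* (ν n ℚ.* y)           ≡⟨ cong₂ ℚ._*_ mx≡a ny≡b ⟩
    ι a ℚ.* ι b                           ≡⟨ ι-* a b ⟨
    ι (a ℤ.* b)                           ∎)
    where open ≡-Reasoning

  int-neg : ∀ {x} → Integral x → Integral (ℚ.- x)
  int-neg {x} (integral a m p∤m mx≡a) = integral (ℤ.- a) m p∤m
    (trans (sym (ℚ.neg-distribʳ-* (ν m) x)) (trans (cong ℚ.-_ mx≡a) (sym (ι-neg a))))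

  int-sgn : ∀ n → Integral (sgn n)
  int-sgn zero    = int-1
  int-sgn (suc n) = int-neg (int-sgn n)

  int-recip : ∀ k → suc k < p → Integral (recip k)
  int-recip k k<q = integral (+ 1) (suc k) (>⇒∤ k<q) (trans (ν-recip k) (sym (trans (ι-pos 1) ν-1)))

  -- The denominator of a reduced fraction divides every denominator of it.
  int⇒pIntegral : ∀ {x} → Integral x → pIntegral p x
  int⇒pIntegral {ℚ.mkℚ n D-1 coprime} (integral c d p∤d dx≡c) p∣D = p∤d (∣-trans p∣D D∣d)
    where
    open ≡-Reasoning
    x = ℚ.mkℚ n D-1 coprime
    D = suc D-1
    Dx≡n : ν D ℚ.* x ≡ ι n
    Dx≡n = trans (cong (ν D ℚ.*_) (sym (ℚ.↥p/↧p≡p x))) (divℕ-ν n {D} (s≤s z≤n))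
    dn≡cD : + d ℤ.* n ≡ c ℤ.* + D
    dn≡cD = ι-injective (begin
      ι (+ d ℤ.* n)             ≡⟨ ι-* (+ d) n ⟩
      ι (+ d) ℚ.* ι n           ≡⟨ cong₂ ℚ._*_ (ι-pos d) (sym Dx≡n) ⟩
      ν d ℚ.* (ν D ℚ.* x)       ≡⟨ solve 3 (λ d D x → d :* (D :* x) := (d :* x) :* D) refl (ν d) (ν D) x ⟩
      ν d ℚ.* x ℚ.* ν D         ≡⟨ cong₂ ℚ._*_ dx≡c (sym (ι-pos D)) ⟩
      ι c ℚ.* ι (+ D)           ≡⟨ ι-* c (+ D) ⟨
      ι (c ℤ.* + D)             ∎)
    D∣d : D ∣ d
    D∣d = coprime-divisor (Coprimality.sym (recompute coprime)) (divides ℤ.∣ c ∣ (begin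
      ℤ.∣ n ∣ * d               ≡⟨ ℕ.*-comm ℤ.∣ n ∣ d ⟩
      d * ℤ.∣ n ∣               ≡⟨ ℤ.abs-* (+ d) n ⟨
      ℤ.∣ + d ℤ.* n ∣           ≡⟨ cong ℤ.∣_∣ dn≡cD ⟩
      ℤ.∣ c ℤ.* + D ∣           ≡⟨ ℤ.abs-* c (+ D) ⟩
      ℤ.∣ c ∣ * D               ∎))

  -- Divisibility by powers of p in the ring of p-integral rationals

  powP : ℕ → ℚ
  powP zero    = 1ℚ
  powP (suc s) = ν p ℚ.* powP s

  powP-ν : ∀ s → powP s ≡ ν (p ^ s)
  powP-ν zero    = sym ν-1
  powP-ν (suc s) = trans (cong (ν p ℚ.*_) (powP-ν s)) (sym (ν-* p (p ^ s)))

  powP-+ : ∀ s t → powP (s + t) ≡ powP s ℚ.* powP t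
  powP-+ zero    t = sym (ℚ.*-identityˡ (powP t))
  powP-+ (suc s) t = trans (cong (ν p ℚ.*_) (powP-+ s t)) (sym (ℚ.*-assoc (ν p) (powP s) (powP t)))

  int-powP : ∀ s → Integral (powP s)
  int-powP s = subst Integral (sym (powP-ν s)) (int-ν (p ^ s))

  record Div (s : ℕ) (x : ℚ) : Set where
    constructor div
    field
      quot   : ℚ
      quot-integral : Integral quot
      x≡p^s*quot : x ≡ powP s ℚ.* quot

  int⇒div : ∀ {x} → Integral x → Div 0 x
  int⇒div {x} i = div x i (sym (ℚ.*-identityˡ x))

  div⇒int : ∀ {s x} → Div s x → Integral x
  div⇒int {s} (div z i refl) = int-* (int-powP s) i

  div-0 : ∀ {s} → Div s 0ℚ
  div-0 {s} = div 0ℚ int-0 (sym (ℚ.*-zeroʳ (powP s)))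

  div-+ : ∀ {s x y} → Div s x → Div s y → Div s (x ℚ.+ y)
  div-+ {s} (div a i refl) (div b j refl) = div (a ℚ.+ b) (int-+ i j) (sym (ℚ.*-distribˡ-+ (powP s) a b))

  div-neg : ∀ {s x} → Div s x → Div s (ℚ.- x)
  div-neg {s} (div a i refl) = div (ℚ.- a) (int-neg i) (ℚ.neg-distribʳ-* (powP s) a)

  div-* : ∀ {s t x y} → Div s x → Div t y → Div (s + t) (x ℚ.* y)
  div-* {s} {t} (div a i refl) (div b j refl) = div (a ℚ.* b) (int-* i j)
    (trans (solve 4 (λ p a q b → p :* a :* (q :* b) := p :* q :* (a :* b)) refl (powP s) a (powP t) b) (cong (ℚ._* (a ℚ.* b)) (sym (powP-+ s t))))

  div-*ʳ : ∀ {s x y} → Integral x → Div s y → Div s (x ℚ.* y)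
  div-*ʳ i d = div-* (int⇒div i) d

  div-*ˡ : ∀ {s x y} → Div s x → Integral y → Div s (x ℚ.* y)
  div-*ˡ {s} {x} {y} d i = subst (Div s) (ℚ.*-comm y x) (div-*ʳ i d)

  div-p : Div 1 (ν p)
  div-p = div 1ℚ int-1 (trans (sym (ℚ.*-identityʳ (ν p))) (sym (ℚ.*-identityʳ (ν p ℚ.* 1ℚ))))

  div-≤ : ∀ {s t x} → t ≤ s → Div s x → Div t x
  div-≤ {s} {t} t≤s (div a i refl) = div (powP (s ∸ t) ℚ.* a) (int-* (int-powP (s ∸ t)) i)
    (trans (cong (ℚ._* a) (trans (cong powP (sym (ℕ.m+[n∸m]≡n t≤s))) (powP-+ t (s ∸ t)))) (ℚ.*-assoc (powP t) (powP (s ∸ t)) a))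

  div-cancel : ∀ s {t x} → Div (s + t) (powP s ℚ.* x) → Div t x
  div-cancel zero    {t} {x} d = subst (Div t) (ℚ.*-identityˡ x) d
  div-cancel (suc s) {t} {x} (div a i eq) = div-cancel s (div a i (*-cancel-ν q
    (trans (sym (ℚ.*-assoc (ν p) (powP s) x)) (trans eq (ℚ.*-assoc (ν p) (powP (s + t)) a)))))

  div-∑ : ∀ {s} n {f : ℕ → ℚ} → (∀ i → i < n → Div s (f i)) → Div s (∑ n f)
  div-∑ zero    d = div-0
  div-∑ (suc n) d = div-+ (d 0 (s≤s z≤n)) (div-∑ n (λ i i<n → d (suc i) (s≤s i<n)))

  int-∑ : ∀ n {f : ℕ → ℚ} → (∀ i → Integral (f i)) → Integral (∑ n f)
  int-∑ n i = div⇒int (div-∑ n (λ k _ → int⇒div (i k)))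

  div-⊙ : ∀ {s} f g k → (∀ i → i ≤ k → Div s (f i)) → (∀ i → i ≤ k → Integral (g i)) → Div s ((f ⊙ g) k)
  div-⊙ f g zero    d i = div-*ˡ (d 0 z≤n) (i 0 z≤n)
  div-⊙ f g (suc k) d i = div-+ (div-*ˡ (d 0 z≤n) (i (suc k) ℕ.≤-refl))
    (div-⊙ (f ∘ suc) g k (λ j j≤k → d (suc j) (s≤s j≤k)) (λ j j≤k → i j (ℕ.m≤n⇒m≤1+n j≤k)))

  int-⊙ : ∀ f g k → (∀ i → i ≤ k → Integral (f i)) → (∀ i → i ≤ k → Integral (g i)) → Integral ((f ⊙ g) k)
  int-⊙ f g k i j = div⇒int (div-⊙ f g k (λ n n≤k → int⇒div (i n n≤k)) j)

  int-^ˢ : ∀ f n k → (∀ i → i ≤ k → Integral (f i)) → ∀ i → i ≤ k → Integral ((f ^ˢ n) i)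
  int-^ˢ f zero    k h zero    _   = int-1
  int-^ˢ f zero    k h (suc i) _   = int-0
  int-^ˢ f (suc n) k h i       i≤k = int-⊙ f (f ^ˢ n) i (λ j j≤i → h j (ℕ.≤-trans j≤i i≤k)) (λ j j≤i → int-^ˢ f n k h j (ℕ.≤-trans j≤i i≤k))

  -- Congruence modulo p ^ s

  record Cong (s : ℕ) (x y : ℚ) : Set where
    constructor congruent
    field
      difference : Div s (x ℚ.- y)

  cong-refl : ∀ {s x y} → x ≡ y → Cong s x y
  cong-refl {s} {x} refl = congruent (subst (Div s) (sym (ℚ.+-inverseʳ x)) div-0)

  cong-sym : ∀ {s x y} → Cong s x y → Cong s y x
  cong-sym {s} {x} {y} (congruent d) = congruent (subst (Div s) (solve 2 (λ x y → :- (x :- y) := y :- x) refl x y) (div-neg d))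

  cong-trans : ∀ {s x y z} → Cong s x y → Cong s y z → Cong s x z
  cong-trans {s} {x} {y} {z} (congruent d) (congruent e) = congruent (subst (Div s)
    (solve 3 (λ x y z → x :- y :+ (y :- z) := x :- z) refl x y z) (div-+ d e))

  cong-+ : ∀ {s x x′ y y′} → Cong s x x′ → Cong s y y′ → Cong s (x ℚ.+ y) (x′ ℚ.+ y′)
  cong-+ {s} {x} {x′} {y} {y′} (congruent d) (congruent e) = congruent (subst (Div s)
    (solve 4 (λ x x′ y y′ → x :- x′ :+ (y :- y′) := x :+ y :- (x′ :+ y′)) refl x x′ y y′) (div-+ d e))

  cong-neg : ∀ {s x x′} → Cong s x x′ → Cong s (ℚ.- x) (ℚ.- x′)
  cong-neg {s} {x} {x′} (congruent d) = congruent (subst (Div s)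
    (solve 2 (λ x x′ → :- (x :- x′) := :- x :- :- x′) refl x x′) (div-neg d))

  cong-*-div : ∀ {s t x y y′} → Div t x → Cong s y y′ → Cong (t + s) (x ℚ.* y) (x ℚ.* y′)
  cong-*-div {s} {t} {x} {y} {y′} i (congruent d) = congruent (subst (Div (t + s))
    (solve 3 (λ x y y′ → x :* (y :- y′) := x :* y :- x :* y′) refl x y y′) (div-* i d))

  cong-*ˡ : ∀ {s x y y′} → Integral x → Cong s y y′ → Cong s (x ℚ.* y) (x ℚ.* y′)
  cong-*ˡ i d = cong-*-div (int⇒div i) d

  cong-*ʳ : ∀ {s x x′ y} → Integral y → Cong s x x′ → Cong s (x ℚ.* y) (x′ ℚ.* y)
  cong-*ʳ {s} {x} {x′} {y} i d = subst₂ (Cong s) (ℚ.*-comm y x) (ℚ.*-comm y x′) (cong-*ˡ i d)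

  cong-* : ∀ {s x x′ y y′} → Integral x′ → Integral y → Cong s x x′ → Cong s y y′ → Cong s (x ℚ.* y) (x′ ℚ.* y′)
  cong-* i j d e = cong-trans (cong-*ʳ j d) (cong-*ˡ i e)

  div⇒cong-0 : ∀ {s x} → Div s x → Cong s x 0ℚ
  div⇒cong-0 {s} {x} d = congruent (subst (Div s) (sym (ℚ.+-identityʳ x)) d)

  cong-0⇒div : ∀ {s x} → Cong s x 0ℚ → Div s x
  cong-0⇒div {s} {x} (congruent d) = subst (Div s) (ℚ.+-identityʳ x) d

  cong-∑ : ∀ {s} n {f g : ℕ → ℚ} → (∀ i → i < n → Cong s (f i) (g i)) → Cong s (∑ n f) (∑ n g)
  cong-∑ zero    d = cong-refl refl
  cong-∑ (suc n) d = cong-+ (d 0 (s≤s z≤n)) (cong-∑ n (λ i i<n → d (suc i) (s≤s i<n)))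

  cong-cancel : ∀ s {t x y} → Cong (s + t) (powP s ℚ.* x) (powP s ℚ.* y) → Cong t x y
  cong-cancel s {t} {x} {y} (congruent d) = congruent (div-cancel s (subst (Div (s + t))
    (solve 3 (λ p x y → p :* x :- p :* y := p :* (x :- y)) refl (powP s) x y) d))

  cong-powP-* : ∀ s {x y} → Cong 1 x y → Cong (suc s) (powP s ℚ.* x) (powP s ℚ.* y)
  cong-powP-* s {x} {y} c = subst (λ k → Cong k (powP s ℚ.* x) (powP s ℚ.* y)) (ℕ.+-comm s 1)
    (cong-*-div (div 1ℚ int-1 (sym (ℚ.*-identityʳ (powP s)))) c)

  cong-powP-cancel : ∀ s {x y} → Cong (suc s) (powP s ℚ.* x) (powP s ℚ.* y) → Cong 1 x y
  cong-powP-cancel s {x} {y} c = cong-cancel s (subst (λ k → Cong k (powP s ℚ.* x) (powP s ℚ.* y)) (ℕ.+-comm 1 s) c)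

  cong-cancel-ν : ∀ {s x y} k → suc k < p → Cong s (ν (suc k) ℚ.* x) (ν (suc k) ℚ.* y) → Cong s x y
  cong-cancel-ν {s} {x} {y} k k<q d = subst₂ (Cong s) (cancel x) (cancel y) (cong-*ˡ (int-recip k k<q) d)
    where
    cancel : ∀ x → recip k ℚ.* (ν (suc k) ℚ.* x) ≡ x
    cancel x = trans (solve 3 (λ r n x → r :* (n :* x) := n :* r :* x) refl (recip k) (ν (suc k)) x)
      (trans (cong (ℚ._* x) (ν-recip k)) (ℚ.*-identityˡ x))

  -- How a p-th difference turns into multiplication of series: terms with i ≤ j contribute the
  -- coefficient of g at j - i, and terms with i > j are too divisible to count, just where a Cauchy
  -- product stops.
  cong-∑-⊙ : ∀ {t} n (K g : Series) (F : ℕ → ℚ) x j → j < n →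
           (∀ i i′ → i + i′ ≡ j → Cong t (F i) (x ℚ.* g i′)) → (∀ i → j < i → i < n → Div t (F i)) →
           (∀ i → i < n → Integral (K i)) → Cong t (∑ n (λ i → K i ℚ.* F i)) (x ℚ.* (K ⊙ g) j)
  cong-∑-⊙ (suc n) K g F x zero _ near far int-K = cong-trans
    (cong-+ (cong-*ˡ (int-K 0 (s≤s z≤n)) (near 0 0 refl))
      (div⇒cong-0 (div-∑ n (λ i i<n → div-*ʳ (int-K (suc i) (s≤s i<n)) (far (suc i) (s≤s z≤n) (s≤s i<n))))))
    (cong-refl (solve 3 (λ k x c → k :* (x :* c) :+ con 0ℚ := x :* (k :* c)) refl (K 0) x (g 0)))
  cong-∑-⊙ (suc n) K g F x (suc j) (s≤s j<n) near far int-K = cong-trans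
    (cong-+ (cong-*ˡ (int-K 0 (s≤s z≤n)) (near 0 (suc j) refl))
      (cong-∑-⊙ n (K ∘ suc) g (F ∘ suc) x j j<n (λ i i′ eq → near (suc i) i′ (cong suc eq))
        (λ i j<i i<n → far (suc i) (s≤s j<i) (s≤s i<n)) (λ i i<n → int-K (suc i) (s≤s i<n))))
    (cong-refl (solve 4 (λ k x c y → k :* (x :* c) :+ x :* y := x :* (k :* c :+ y)) refl (K 0) x (g (suc j)) (((K ∘ suc) ⊙ g) j)))

  cong-⊙ˡ : ∀ {s} f f′ g k → (∀ i → i ≤ k → Cong s (f i) (f′ i)) → (∀ i → i ≤ k → Integral (g i)) → Cong s ((f ⊙ g) k) ((f′ ⊙ g) k)
  cong-⊙ˡ f f′ g zero    c i = cong-*ʳ (i 0 z≤n) (c 0 z≤n)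
  cong-⊙ˡ f f′ g (suc k) c i = cong-+ (cong-*ʳ (i (suc k) ℕ.≤-refl) (c 0 z≤n))
    (cong-⊙ˡ (f ∘ suc) (f′ ∘ suc) g k (λ j j≤k → c (suc j) (s≤s j≤k)) (λ j j≤k → i j (ℕ.m≤n⇒m≤1+n j≤k)))

  cong-∑-single : ∀ {s} n k (f : ℕ → ℚ) → k < n → (∀ i → i ≢ k → Div s (f i)) → Cong s (∑ n f) (f k)
  cong-∑-single (suc n) zero    f _         d = cong-trans (cong-+ (cong-refl {x = f 0} refl) (div⇒cong-0 (div-∑ n (λ i _ → d (suc i) (λ ()))))) (cong-refl (ℚ.+-identityʳ (f 0)))
  cong-∑-single (suc n) (suc k) f (s≤s k<n) d = cong-trans (cong-+ (div⇒cong-0 (d 0 (λ ()))) (cong-∑-single n k (f ∘ suc) k<n (λ i i≢k → d (suc i) (i≢k ∘ ℕ.suc-injective))))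
    (cong-refl (ℚ.+-identityˡ (f (suc k))))

  -- Binomial coefficients and signs modulo p

  binom-p-suc : ∀ i → binom p (suc i) ≡ ν p ℚ.* (binom q i ℚ.* recip i)
  binom-p-suc i = *-cancel-ν i (begin
    ν (suc i) ℚ.* binom p (suc i)                          ≡⟨ binom-absorb q i ⟩
    ν p ℚ.* binom q i                                      ≡⟨ ℚ.*-identityʳ (ν p ℚ.* binom q i) ⟨
    ν p ℚ.* binom q i ℚ.* 1ℚ                               ≡⟨ cong (ν p ℚ.* binom q i ℚ.*_) (ν-recip i) ⟨
    ν p ℚ.* binom q i ℚ.* (ν (suc i) ℚ.* recip i)          ≡⟨ solve 4 (λ p b n r → p :* b :* (n :* r) := n :* (p :* (b :* r))) refl (ν p) (binom q i) (ν (suc i)) (recip i) ⟩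
    ν (suc i) ℚ.* (ν p ℚ.* (binom q i ℚ.* recip i))        ∎)
    where open ≡-Reasoning

  div-binom-p : ∀ i → i < q → Div 1 (binom p (suc i))
  div-binom-p i i<q = subst (Div 1) (sym (binom-p-suc i)) (div-*ˡ div-p (int-* (int-binom q i) (int-recip i (s≤s i<q))))

  -- Neighbours C(q,r) and C(q,r+1) add up to C(p,r+1), which p divides.
  binom-q-cong : ∀ r → r ≤ q → Cong 1 (binom q r) (sgn r)
  binom-q-cong zero    _   = cong-refl (binom-n-0 q)
  binom-q-cong (suc r) r<q = cong-trans (cong-refl pascal)
    (cong-trans (cong-+ (div⇒cong-0 (div-binom-p r r<q)) (cong-neg (binom-q-cong r (ℕ.<⇒≤ r<q)))) (cong-refl (ℚ.+-identityˡ (ℚ.- sgn r))))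
    where
    pascal : binom q (suc r) ≡ binom p (suc r) ℚ.+ ℚ.- binom q r
    pascal = trans (solve 2 (λ a b → b := a :+ b :+ :- a) refl (binom q r) (binom q (suc r))) (cong (ℚ._+ ℚ.- binom q r) (sym (binom-pascal q r)))

  -- Read off from C(q,q) = 1 rather than from the parity of q, which includes p = 2, where -1 ≡ 1.
  sgn-q : Cong 1 (sgn q) 1ℚ
  sgn-q = cong-trans (cong-sym (binom-q-cong q ℕ.≤-refl)) (cong-refl (binom-n-n q))

  sgn-p : Cong 1 (sgn p) (ℚ.- 1ℚ)
  sgn-p = cong-neg sgn-q

  sgn-p* : ∀ k → Cong 1 (sgn (p * k)) (sgn k)
  sgn-p* zero    = cong-refl (cong sgn (ℕ.*-zeroʳ p))
  sgn-p* (suc k) = cong-trans (cong-refl (trans (cong sgn (ℕ.*-suc p k)) (sgn-+ p (p * k))))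
    (cong-trans (cong-* (int-neg int-1) (int-sgn (p * k)) sgn-p (sgn-p* k)) (cong-refl (solve 1 (λ x → :- con 1ℚ :* x := :- x) refl (sgn k))))

  -- Upper negation modulo p, as N ≡ -1 - j. Pascal's rule in the form C(N,r) = C(N+1,r+1) -
  -- C(N,r+1) moves towards the lines N = q and r = q, where the values are known, and matches
  -- Pascal's rule for C(m,j).
  binom-cong-reflect : ∀ N r j m → N + j ≡ q → r + m ≡ q → Cong 1 (binom N r) (sgn r ℚ.* (sgn j ℚ.* binom m j))
  binom-cong-reflect N r zero m N+0≡q r+m≡q = cong-trans (cong-refl (cong (λ n → binom n r) (trans (sym (ℕ.+-identityʳ N)) N+0≡q)))
    (cong-trans (binom-q-cong r (subst (r ≤_) r+m≡q (ℕ.m≤m+n r m)))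
      (cong-refl (sym (trans (cong (λ x → sgn r ℚ.* (1ℚ ℚ.* x)) (binom-n-0 m)) (solve 1 (λ s → s :* (con 1ℚ :* con 1ℚ) := s) refl (sgn r))))))
  binom-cong-reflect N r (suc j) zero N+j≡q r+0≡q = cong-refl (trans (binom-0 N<r)
    (sym (trans (cong (λ x → sgn r ℚ.* (sgn (suc j) ℚ.* x)) (binom-0 {0} {suc j} (s≤s z≤n))) (solve 2 (λ a b → a :* (b :* con 0ℚ) := con 0ℚ) refl (sgn r) (sgn (suc j))))))
    where
    N<r : N < r
    N<r = subst (N <_) (trans N+j≡q (trans (sym r+0≡q) (ℕ.+-identityʳ r))) (ℕ.m<m+n N (s≤s z≤n))
  binom-cong-reflect N r (suc j) (suc m) N+j≡q r+m≡q = cong-trans (cong-refl pascal) (cong-trans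
    (cong-+ (binom-cong-reflect (suc N) (suc r) j m (trans (sym (ℕ.+-suc N j)) N+j≡q) (trans (sym (ℕ.+-suc r m)) r+m≡q))
      (cong-neg (binom-cong-reflect N (suc r) (suc j) m N+j≡q (trans (sym (ℕ.+-suc r m)) r+m≡q))))
    (cong-refl (trans (solve 4 (λ s t a b → :- s :* (t :* a) :+ :- (:- s :* (:- t :* b)) := s :* (:- t :* (a :+ b))) refl (sgn r) (sgn j) (binom m j) (binom m (suc j)))
      (cong (λ x → sgn r ℚ.* (sgn (suc j) ℚ.* x)) (sym (binom-pascal m j))))))
    where
    pascal : binom N r ≡ binom (suc N) (suc r) ℚ.+ ℚ.- binom N (suc r)
    pascal = trans (solve 2 (λ a b → a := a :+ b :+ :- b) refl (binom N r) (binom N (suc r))) (cong (ℚ._+ ℚ.- binom N (suc r)) (sym (binom-pascal N r)))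

  binom-cong-logPow : ∀ N r j m → N + j ≡ q → r + m ≡ q → Cong 1 (binom N r) (sgn r ℚ.* logPow m 0 j)
  binom-cong-logPow N r j m N+j≡q r+m≡q = cong-trans (binom-cong-reflect N r j m N+j≡q r+m≡q)
    (cong-refl (cong (sgn r ℚ.*_) (sym (trans (trans (⊙-comm (oneMinusZ ^ˢ m) (constS 1ℚ) j) (⊙-identityˡ (oneMinusZ ^ˢ m) j)) (oneMinusZ-^ m j)))))

  -- (-1)^i C(p,i+1) / p
  fleckCoeff : ℕ → ℚ
  fleckCoeff i = sgn i ℚ.* binom q i ℚ.* recip i

  int-fleckCoeff : ∀ i → i < q → Integral (fleckCoeff i)
  int-fleckCoeff i i<q = int-* (int-* (int-sgn i) (int-binom q i)) (int-recip i (s≤s i<q))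

  p*fleckCoeff : ∀ i → ν p ℚ.* fleckCoeff i ≡ sgn i ℚ.* binom p (suc i)
  p*fleckCoeff i = trans (solve 4 (λ p s b r → p :* (s :* b :* r) := s :* (p :* (b :* r))) refl (ν p) (sgn i) (binom q i) (recip i))
    (cong (sgn i ℚ.*_) (sym (binom-p-suc i)))

  fleckCoeff-cong : ∀ i → i < q → Cong 1 (fleckCoeff i) (Λ i)
  fleckCoeff-cong i i<q = cong-trans (cong-*ʳ (int-recip i (s≤s i<q))
    (cong-trans (cong-*ˡ (int-sgn i) (binom-q-cong i (ℕ.<⇒≤ i<q))) (cong-refl (sgn-square i)))) (cong-refl (ℚ.*-identityˡ (recip i)))

  int-Λ : ∀ i → i < q → Integral (Λ i)
  int-Λ i i<q = int-recip i (s≤s i<q)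

  int-oneMinusZ : ∀ i → Integral (oneMinusZ i)
  int-oneMinusZ zero          = int-1
  int-oneMinusZ (suc zero)    = int-neg int-1
  int-oneMinusZ (suc (suc i)) = int-0

  int-logPow : ∀ m M j → j < q → Integral (logPow m M j)
  int-logPow m M j j<q = int-⊙ (oneMinusZ ^ˢ m) (Λ ^ˢ M) j (int-^ˢ oneMinusZ m j (λ i _ → int-oneMinusZ i))
    (int-^ˢ Λ M j (λ i i≤j → int-Λ i (ℕ.≤-<-trans i≤j j<q)))

  -- Fermat and Wilson

  -- Induction on n. The binomial expansion of (n+1)^p is taken as the p-th difference of (-n)^i at
  -- 0; its inner terms contain C(p,i), and in the last one the sign (-1)^p occurs twice.
  fermat : ∀ n → Cong 1 (ν (n ^ p)) (ν n)
  fermat zero    = cong-refl refl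
  fermat (suc n) = cong-trans (cong-refl expand) (cong-trans
    (cong-+ (cong-refl first) (cong-+ (div⇒cong-0 (div-∑ q (λ i i<q → div-*ˡ (div-*ʳ (int-sgn (suc i)) (div-binom-p i i<q)) (int-f (suc i + 0))))) (cong-trans (cong-refl last) (fermat n))))
    (cong-refl (trans (cong (1ℚ ℚ.+_) (ℚ.+-identityˡ (ν n))) (sym (ν-suc n)))))
    where
    f term : ℕ → ℚ
    f i    = sgn i ℚ.* ν (n ^ i)
    term i = sgn i ℚ.* binom p i ℚ.* f (i + 0)
    int-f : ∀ i → Integral (f i)
    int-f i = int-* (int-sgn i) (int-ν (n ^ i))
    expand : ν (suc n ^ p) ≡ term 0 ℚ.+ (∑ q (term ∘ suc) ℚ.+ term p)
    expand = trans (sym (trans (Δ^-geometric n p 0) (trans (cong (λ x → ν (suc n ^ p) ℚ.* (1ℚ ℚ.* x)) ν-1) (solve 1 (λ x → x :* (con 1ℚ :* con 1ℚ) := x) refl (ν (suc n ^ p))))))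
      (trans (sym (Δ^-expand p f 0)) (cong (term 0 ℚ.+_) (∑-last q (term ∘ suc))))
    first : term 0 ≡ 1ℚ
    first = cong₂ (λ x y → 1ℚ ℚ.* x ℚ.* (1ℚ ℚ.* y)) (binom-n-0 p) ν-1
    last : term p ≡ ν (n ^ p)
    last = trans (cong₂ (λ x i → sgn p ℚ.* x ℚ.* f i) (binom-n-n p) (ℕ.+-identityʳ p))
      (trans (solve 2 (λ s y → s :* con 1ℚ :* (s :* y) := s :* s :* y) refl (sgn p) (ν (n ^ p))) (trans (cong (ℚ._* ν (n ^ p)) (sgn-square p)) (ℚ.*-identityˡ (ν (n ^ p)))))

  fermat-q : ∀ k → k < q → Cong 1 (ν (suc k ^ q)) 1ℚ
  fermat-q k k<q = cong-cancel-ν k (s≤s k<q) (cong-trans (cong-refl (sym (ν-* (suc k) (suc k ^ q))))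
    (cong-trans (fermat (suc k)) (cong-refl (sym (ℚ.*-identityʳ (ν (suc k)))))))

  div-p-power : Div 1 (ν (suc q ^ q))
  div-p-power = go q 1<p
    where
    go : ∀ k → 1 < suc k → Div 1 (ν (suc q ^ k))
    go zero    (s≤s ())
    go (suc k) _ = subst (Div 1) (sym (ν-* p (p ^ k))) (div-*ˡ div-p (int-ν (p ^ k)))

  -- The q-th difference of N ^ q at 1, evaluated exactly and then term by term with Fermat.
  wilson : Cong 1 (ν (q !)) (ℚ.- 1ℚ)
  wilson = cong-trans (cong-refl (sym (trans (sym (ℚ.*-assoc (sgn q) (sgn q) (ν (q !)))) (trans (cong (ℚ._* ν (q !)) (sgn-square q)) (ℚ.*-identityˡ (ν (q !)))))))
    (cong-* int-1 (int-* (int-sgn q) (int-ν (q !))) sgn-q sum)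
    where
    term : ℕ → ℚ
    term i = sgn i ℚ.* binom q i ℚ.* ν ((i + 1) ^ q)
    term-cong : ∀ i → i < q → Cong 1 (term i) 1ℚ
    term-cong i i<q = cong-* int-1 (int-ν ((i + 1) ^ q))
      (cong-trans (cong-*ˡ (int-sgn i) (binom-q-cong i (ℕ.<⇒≤ i<q))) (cong-refl (sgn-square i)))
      (subst (λ k → Cong 1 (ν (k ^ q)) 1ℚ) (ℕ.+-comm 1 i) (fermat-q i i<q))
    term-q : Div 1 (term q)
    term-q = div-*ʳ (int-* (int-sgn q) (int-binom q q)) (subst (λ k → Div 1 (ν (k ^ q))) (ℕ.+-comm 1 q) div-p-power)
    νq : Cong 1 (ν q) (ℚ.- 1ℚ)
    νq = congruent (subst (Div 1) (trans (ν-suc q) (solve 1 (λ x → con 1ℚ :+ x := x :- :- con 1ℚ) refl (ν q))) div-p)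
    sum : Cong 1 (sgn q ℚ.* ν (q !)) (ℚ.- 1ℚ)
    sum = cong-trans (cong-refl (trans (sym (Δ^-power q 1)) (trans (sym (Δ^-expand q (λ N → ν (N ^ q)) 1)) (∑-last q term))))
      (cong-trans (cong-+ (cong-trans (cong-∑ q term-cong) (cong-trans (cong-refl (∑-1 q)) νq)) (div⇒cong-0 term-q)) (cong-refl refl))

  -- By Wilson, u! v! C(q,u) = q! ≡ -1, and C(q,u) ≡ (-1)^u is its own inverse.
  wilson-split : ∀ u v → u + v ≡ q → Cong 1 (ν (u !) ℚ.* ν (v !)) (sgn (suc u))
  wilson-split u v u+v≡q = cong-trans (cong-refl (sym (ℚ.*-identityʳ f))) (cong-trans
    (cong-*ˡ int-f (cong-trans (cong-refl (sym (sgn-square u))) (cong-*ˡ (int-sgn u) (cong-sym (binom-q-cong u u≤q)))))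
    (cong-trans (cong-refl (trans (solve 3 (λ f s b → f :* (s :* b) := s :* (f :* b)) refl f (sgn u) (binom q u)) (cong (sgn u ℚ.*_) f*binom)))
    (cong-trans (cong-*ˡ (int-sgn u) wilson) (cong-refl (solve 1 (λ s → s :* :- con 1ℚ := :- s) refl (sgn u))))))
    where
    f : ℚ
    f = ν (u !) ℚ.* ν (v !)
    int-f : Integral f
    int-f = int-* (int-ν (u !)) (int-ν (v !))
    u≤q : u ≤ q
    u≤q = subst (u ≤_) u+v≡q (ℕ.m≤m+n u v)
    f*binom : f ℚ.* binom q u ≡ ν (q !)
    f*binom = subst (λ n → f ℚ.* binom n u ≡ ν (n !)) u+v≡q (fact-binom u v)

  -- Bernoulli numbers modulo p

  int-invfact : ∀ k → k < p → Integral (invfact k)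
  int-invfact zero    _   = int-1
  int-invfact (suc k) k<q = subst Integral (*-cancel-ν k (begin
    ν (suc k) ℚ.* (recip k ℚ.* invfact k)     ≡⟨ ℚ.*-assoc (ν (suc k)) (recip k) (invfact k) ⟨
    ν (suc k) ℚ.* recip k ℚ.* invfact k       ≡⟨ cong (ℚ._* invfact k) (ν-recip k) ⟩
    1ℚ ℚ.* invfact k                          ≡⟨ ℚ.*-identityˡ (invfact k) ⟩
    invfact k                                 ≡⟨ invfact-suc k ⟨
    ν (suc k) ℚ.* invfact (suc k)             ∎)) (int-* (int-recip k k<q) (int-invfact k (ℕ.<-trans (ℕ.n<1+n k) k<q)))
    where open ≡-Reasoning

  -- The recursion for the coefficient of index i uses reciprocal factorials up to 1/(i+1)!, so the
  -- bound q = p - 1 is where 1/p! would enter.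
  int-x/expm1 : ∀ k → k < q → ∀ i → i ≤ k → Integral (x/expm1 i)
  int-x/expm1 k       k<q zero    _         = int-1
  int-x/expm1 (suc k) k<q (suc i) (s≤s i≤k) = subst Integral
    (trans (solve 2 (λ g s → :- s := g :- (con 1ℚ :* g :+ s)) refl (x/expm1 (suc i)) (((expm1/x ∘ suc) ⊙ x/expm1) i))
      (trans (cong (λ x → x/expm1 (suc i) ℚ.- x) (expm1/x-inverse (suc i))) (ℚ.+-identityʳ (x/expm1 (suc i)))))
    (int-neg (int-⊙ (expm1/x ∘ suc) x/expm1 i
      (λ j j≤i → int-invfact (suc (suc j)) (s≤s (ℕ.≤-trans (s≤s (s≤s (ℕ.≤-trans j≤i i≤k))) k<q)))
      (λ j j≤i → int-x/expm1 k (ℕ.<-trans (ℕ.n<1+n k) k<q) j (ℕ.≤-trans j≤i i≤k))))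

  int-xexp/expm1 : ∀ i → i < q → Integral (xexp/expm1 i)
  int-xexp/expm1 i i<q = subst Integral (sym (xexp/expm1-shift i)) (int-+ (int-x/expm1 i i<q i ℕ.≤-refl) (int-zS i))
    where
    int-zS : ∀ i → Integral (zS i)
    int-zS zero          = int-0
    int-zS (suc zero)    = int-1
    int-zS (suc (suc i)) = int-0

  -- f ^ p ≡ f 0 below z ^ q, since z d/dz multiplies the coefficient at z ^ i by the unit i and kills f ^ p.
  div-^ˢp : ∀ f → (∀ i → i < q → Integral (f i)) → ∀ i → suc i < q → Div 1 ((f ^ˢ p) (suc i))
  div-^ˢp f int-f i i<q = cong-0⇒div (cong-cancel-ν i (ℕ.m≤n⇒m≤1+n i<q) (cong-trans (cong-refl (trans (θ-^ f q (suc i)) (constS-⊙ (ν p) (f ^ˢ q ⊙ θ f) (suc i))))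
    (cong-trans (div⇒cong-0 (div-*ˡ div-p (int-⊙ (f ^ˢ q) (θ f) (suc i) (int-^ˢ f q (suc i) int-f′) (λ j j≤i → int-* (int-ν j) (int-f′ j j≤i)))))
      (cong-refl (sym (ℚ.*-zeroʳ (ν (suc i))))))))
    where
    int-f′ : ∀ j → j ≤ suc i → Integral (f j)
    int-f′ j j≤i = int-f j (ℕ.≤-<-trans j≤i i<q)

  todd-cong : ∀ c k → k < q → Cong 1 (todd c (c + p) k) ((x/expm1 ^ˢ c) k)
  todd-cong c k k<q = cong-trans (cong-refl (factor k)) (unit k k<q)
    where
    G g^c : Series
    G   = xexp/expm1
    g^c = x/expm1 ^ˢ c
    factor : todd c (c + p) ≈ G ^ˢ p ⊙ g^c
    factor = begin
      exp⁻S ^ˢ c ⊙ G ^ˢ (c + p)           ≈⟨ ⊙-congˡ (exp⁻S ^ˢ c) (^ˢ-+ G c p) ⟩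
      exp⁻S ^ˢ c ⊙ (G ^ˢ c ⊙ G ^ˢ p)      ≈⟨ ⊙-assoc (exp⁻S ^ˢ c) (G ^ˢ c) (G ^ˢ p) ⟨
      exp⁻S ^ˢ c ⊙ G ^ˢ c ⊙ G ^ˢ p        ≈⟨ ⊙-congʳ (G ^ˢ p) (≈-trans {exp⁻S ^ˢ c ⊙ G ^ˢ c} (≈-sym {(exp⁻S ⊙ G) ^ˢ c} (^ˢ-⊙ exp⁻S G c)) (^ˢ-cong c exp⁻-xexp/expm1)) ⟩
      g^c ⊙ G ^ˢ p                        ≈⟨ ⊙-comm g^c (G ^ˢ p) ⟩
      G ^ˢ p ⊙ g^c                        ∎
      where open ≈-Reasoning
    G^p-0 : (G ^ˢ p) 0 ≡ 1ℚ
    G^p-0 = ^ˢ-0 G p refl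
    int-g^c : ∀ k → k < q → ∀ i → i ≤ k → Integral (g^c i)
    int-g^c k k<q = int-^ˢ x/expm1 c k (int-x/expm1 k k<q)
    unit : ∀ k → k < q → Cong 1 ((G ^ˢ p ⊙ g^c) k) (g^c k)
    unit zero    _   = cong-refl (trans (cong (ℚ._* g^c 0) G^p-0) (ℚ.*-identityˡ (g^c 0)))
    unit (suc k) k<q = cong-trans (cong-+ (cong-refl (trans (cong (ℚ._* g^c (suc k)) G^p-0) (ℚ.*-identityˡ (g^c (suc k)))))
      (div⇒cong-0 (div-⊙ ((G ^ˢ p) ∘ suc) g^c k (λ i i≤k → div-^ˢp G int-xexp/expm1 i (ℕ.≤-<-trans (s≤s i≤k) k<q))
        (int-g^c k (ℕ.<-trans (ℕ.n<1+n k) k<q))))) (cong-refl (ℚ.+-identityʳ (g^c (suc k))))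

  -- Fleck sums

  weight : ℕ → ℕ → ℚ
  weight l j = sgn (p * j) ℚ.* binom j l

  -- Terms with Q j + r > N vanish, so the truncation B is immaterial once B > N.
  fleck : (Q B N r l : ℕ) → ℚ
  fleck Q B N r l = ∑ B (λ j → weight l j ℚ.* binom N (Q * j + r))

  int-weight : ∀ l j → Integral (weight l j)
  int-weight l j = int-* (int-sgn (p * j)) (int-binom j l)

  int-fleck : ∀ Q B N r l → Integral (fleck Q B N r l)
  int-fleck Q B N r l = int-∑ B (λ j → int-* (int-weight l j) (int-binom N (Q * j + r)))

  sgn-p*suc : ∀ j → sgn (p * suc j) ≡ sgn p ℚ.* sgn (p * j)
  sgn-p*suc j = trans (cong sgn (ℕ.*-suc p j)) (sgn-+ p (p * j))

  -- The weight for l - 1, with C(j,-1) = 0, so that Pascal's rule holds uniformly in l.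
  weightPred : ℕ → ℕ → ℚ
  weightPred zero    j = 0ℚ
  weightPred (suc l) j = weight l j

  weight-suc : ∀ l j → weight l (suc j) ≡ sgn p ℚ.* (weight l j ℚ.+ weightPred l j)
  weight-suc zero    j = trans (cong₂ ℚ._*_ (sgn-p*suc j) (trans (binom-n-0 (suc j)) (sym (binom-n-0 j))))
    (solve 3 (λ a b c → a :* b :* c := a :* (b :* c :+ con 0ℚ)) refl (sgn p) (sgn (p * j)) (binom j 0))
  weight-suc (suc l) j = trans (cong₂ ℚ._*_ (sgn-p*suc j) (binom-pascal j l))
    (solve 4 (λ a b c d → a :* b :* (c :+ d) := a :* (b :* d :+ b :* c)) refl (sgn p) (sgn (p * j)) (binom j l) (binom j (suc l)))

  -- Fleck sums of modulus p: recursion, divisibility, leading term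

  module _ (B r : ℕ) (r<p : r < p) where

    fleckₚ : ℕ → ℕ → ℚ
    fleckₚ N l = fleck p B N r l

    fleckₚ-pred : ℕ → ℕ → ℚ
    fleckₚ-pred N l = ∑ B (λ j → weightPred l j ℚ.* binom N (p * j + r))

    -- A p-th difference lowers the index p j + r by p, that is, shifts j by one. The sign (-1)^p it
    -- produces cancels the one in `weight-suc`, whose Pascal split leaves the sums for l and l - 1.
    Δ^p-fleckₚ : ∀ N l → suc N < B → Δ^ p (λ N → fleckₚ N l) N ≡ fleckₚ N l ℚ.+ fleckₚ-pred N l
    Δ^p-fleckₚ N l N<B = begin
      Δ^ p (λ N → fleckₚ N l) N
        ≡⟨ Δ^-∑ p B (weight l) (λ j N → binom N (p * j + r)) N ⟩
      ∑ B (λ j → weight l j ℚ.* Δ^ p (λ N → binom N (p * j + r)) N)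
        ≡⟨ shift B N<B ⟩
      ∑ B (λ j → (weight l j ℚ.+ weightPred l j) ℚ.* binom N (p * j + r))
        ≡⟨ ∑-cong B (λ j → ℚ.*-distribʳ-+ (binom N (p * j + r)) (weight l j) (weightPred l j)) ⟩
      ∑ B (λ j → weight l j ℚ.* binom N (p * j + r) ℚ.+ weightPred l j ℚ.* binom N (p * j + r))
        ≡⟨ ∑-+ B (λ j → weight l j ℚ.* binom N (p * j + r)) (λ j → weightPred l j ℚ.* binom N (p * j + r)) ⟩
      fleckₚ N l ℚ.+ fleckₚ-pred N l ∎
      where
      open ≡-Reasoning
      term : ℕ → ℚ
      term j = (weight l j ℚ.+ weightPred l j) ℚ.* binom N (p * j + r)
      Δ^p-suc : ∀ j → weight l (suc j) ℚ.* Δ^ p (λ N → binom N (p * suc j + r)) N ≡ term j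
      Δ^p-suc j = begin
        weight l (suc j) ℚ.* Δ^ p (λ N → binom N (p * suc j + r)) N
          ≡⟨ cong (λ k → weight l (suc j) ℚ.* Δ^ p (λ N → binom N k) N) (trans (cong (_+ r) (ℕ.*-suc p j)) (ℕ.+-assoc p (p * j) r)) ⟩
        weight l (suc j) ℚ.* Δ^ p (λ N → binom N (p + (p * j + r))) N
          ≡⟨ cong₂ ℚ._*_ (weight-suc l j) (Δ^-binom p (p * j + r) N) ⟩
        sgn p ℚ.* (weight l j ℚ.+ weightPred l j) ℚ.* (sgn p ℚ.* binom N (p * j + r))
          ≡⟨ solve 3 (λ s w b → s :* w :* (s :* b) := s :* s :* (w :* b)) refl (sgn p) (weight l j ℚ.+ weightPred l j) (binom N (p * j + r)) ⟩
        sgn p ℚ.* sgn p ℚ.* term j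
          ≡⟨ trans (cong (ℚ._* term j) (sgn-square p)) (ℚ.*-identityˡ (term j)) ⟩
        term j ∎
      shift : ∀ B → suc N < B → ∑ B (λ j → weight l j ℚ.* Δ^ p (λ N → binom N (p * j + r)) N) ≡ ∑ B term
      -- There are no boundary terms: at j = 0 the polynomial has degree r < p and is killed, and
      -- the top term j = `B′` lost by the shift vanishes because p `B′` + r exceeds N.
      shift (suc B′) (s≤s N<B′) = begin
        weight l 0 ℚ.* Δ^ p (λ N → binom N (p * 0 + r)) N ℚ.+ ∑ B′ (λ j → weight l (suc j) ℚ.* Δ^ p (λ N → binom N (p * suc j + r)) N)
          ≡⟨ cong₂ ℚ._+_ (*-zero (weight l 0) (trans (cong (λ k → Δ^ p (λ N → binom N (k + r)) N) (ℕ.*-zeroʳ p)) (Δ^-binom-0 p N r<p))) (∑-cong B′ Δ^p-suc) ⟩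
        0ℚ ℚ.+ ∑ B′ term
          ≡⟨ ℚ.+-comm 0ℚ (∑ B′ term) ⟩
        ∑ B′ term ℚ.+ 0ℚ
          ≡⟨ cong (∑ B′ term ℚ.+_) (*-zero (weight l B′ ℚ.+ weightPred l B′)
               (binom-0 (ℕ.<-≤-trans N<B′ (ℕ.≤-trans (ℕ.m≤n*m B′ p) (ℕ.m≤m+n (p * B′) r))))) ⟨
        ∑ B′ term ℚ.+ term B′
          ≡⟨ ∑-last B′ term ⟨
        ∑ (suc B′) term ∎

    -- In the expanded p-th difference the term i = 0 cancels the sum for l on the other side, the
    -- term i = p is the one solved for, and every term between has a binomial coefficient divisible
    -- by p.
    fleck-rec : ∀ N l → suc N < B → fleckₚ (p + N) l ≡ sgn p ℚ.* (fleckₚ-pred N l ℚ.+ ν p ℚ.* ∑ q (λ i → fleckCoeff i ℚ.* fleckₚ (suc i + N) l))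
    fleck-rec N l N<B = begin
      fleckₚ (p + N) l
        ≡⟨ trans (sym (ℚ.*-identityˡ (fleckₚ (p + N) l))) (cong (ℚ._* fleckₚ (p + N) l) (sym (sgn-square p))) ⟩
      sgn p ℚ.* sgn p ℚ.* fleckₚ (p + N) l
        ≡⟨ solve 4 (λ s f n k → s :* s :* f := s :* (n :+ (k :+ s :* f) :- n :- k)) refl (sgn p) (fleckₚ (p + N) l) (fleckₚ N l) (ℚ.- (ν p ℚ.* S)) ⟩
      sgn p ℚ.* (fleckₚ N l ℚ.+ (ℚ.- (ν p ℚ.* S) ℚ.+ sgn p ℚ.* fleckₚ (p + N) l) ℚ.- fleckₚ N l ℚ.- ℚ.- (ν p ℚ.* S))
        ≡⟨ cong (λ x → sgn p ℚ.* (x ℚ.- fleckₚ N l ℚ.- ℚ.- (ν p ℚ.* S))) expansion ⟩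
      sgn p ℚ.* (fleckₚ N l ℚ.+ fleckₚ-pred N l ℚ.- fleckₚ N l ℚ.- ℚ.- (ν p ℚ.* S))
        ≡⟨ solve 4 (λ s n m k → s :* (n :+ m :- n :- :- k) := s :* (m :+ k)) refl (sgn p) (fleckₚ N l) (fleckₚ-pred N l) (ν p ℚ.* S) ⟩
      sgn p ℚ.* (fleckₚ-pred N l ℚ.+ ν p ℚ.* S) ∎
      where
      open ≡-Reasoning
      S : ℚ
      S = ∑ q (λ i → fleckCoeff i ℚ.* fleckₚ (suc i + N) l)
      term : ℕ → ℚ
      term i = sgn i ℚ.* binom p i ℚ.* fleckₚ (i + N) l
      inner : ∑ q (term ∘ suc) ≡ ℚ.- (ν p ℚ.* S)
      inner = begin
        ∑ q (term ∘ suc)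
          ≡⟨ ∑-cong q (λ i → trans (solve 3 (λ s b f → :- s :* b :* f := :- (s :* b :* f)) refl (sgn i) (binom p (suc i)) (fleckₚ (suc i + N) l))
               (cong ℚ.-_ (trans (cong (ℚ._* fleckₚ (suc i + N) l) (sym (p*fleckCoeff i))) (ℚ.*-assoc (ν p) (fleckCoeff i) (fleckₚ (suc i + N) l))))) ⟩
        ∑ q (λ i → ℚ.- (ν p ℚ.* (fleckCoeff i ℚ.* fleckₚ (suc i + N) l)))
          ≡⟨ ∑-neg q (λ i → ν p ℚ.* (fleckCoeff i ℚ.* fleckₚ (suc i + N) l)) ⟩
        ℚ.- ∑ q (λ i → ν p ℚ.* (fleckCoeff i ℚ.* fleckₚ (suc i + N) l))
          ≡⟨ cong ℚ.-_ (∑-* q (ν p) (λ i → fleckCoeff i ℚ.* fleckₚ (suc i + N) l)) ⟩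
        ℚ.- (ν p ℚ.* S) ∎
      expansion : fleckₚ N l ℚ.+ (ℚ.- (ν p ℚ.* S) ℚ.+ sgn p ℚ.* fleckₚ (p + N) l) ≡ fleckₚ N l ℚ.+ fleckₚ-pred N l
      expansion = begin
        fleckₚ N l ℚ.+ (ℚ.- (ν p ℚ.* S) ℚ.+ sgn p ℚ.* fleckₚ (p + N) l)
          ≡⟨ cong₂ ℚ._+_ (trans (solve 1 (λ x → x := con 1ℚ :* con 1ℚ :* x) refl (fleckₚ N l)) (cong (λ x → 1ℚ ℚ.* x ℚ.* fleckₚ N l) (sym (binom-n-0 p))))
               (cong₂ ℚ._+_ (sym inner) (trans (solve 2 (λ s x → s :* x := s :* con 1ℚ :* x) refl (sgn p) (fleckₚ (p + N) l)) (cong (λ x → sgn p ℚ.* x ℚ.* fleckₚ (p + N) l) (sym (binom-n-n p))))) ⟩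
        term 0 ℚ.+ (∑ q (term ∘ suc) ℚ.+ term p)
          ≡⟨ cong (term 0 ℚ.+_) (∑-last q (term ∘ suc)) ⟨
        ∑ (suc p) term
          ≡⟨ Δ^-expand p (λ N → fleckₚ N l) N ⟩
        Δ^ p (λ N → fleckₚ N l) N
          ≡⟨ Δ^p-fleckₚ N l N<B ⟩
        fleckₚ N l ℚ.+ fleckₚ-pred N l ∎

    fleckₚ-pred-0 : ∀ N → fleckₚ-pred N 0 ≡ 0ℚ
    fleckₚ-pred-0 N = ∑-0 B (λ j _ → ℚ.*-zeroˡ (binom N (p * j + r)))

    -- Strong induction on N along `fleck-rec`, with n as its bound. Lowering l lowers the threshold
    -- by p, as much as the argument drops. The sum already has a factor p, so s - 1 suffices there,
    -- and its smallest argument N - q matches the drop q of the threshold.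
    div-fleck-p : ∀ n N s l → N < n → suc N < B → p * l + q * s < N → Div s (fleckₚ N l)
    div-fleck-p (suc n) N zero    l _   _   _  = int⇒div (int-fleck p B N r l)
    div-fleck-p (suc n) N (suc s) l N≤n N<B lt = subst (λ N → Div (suc s) (fleckₚ N l)) (ℕ.m+[n∸m]≡n p≤N) (descend (N ∸ p) (ℕ.m+[n∸m]≡n p≤N))
      where
      p≤N : p ≤ N
      p≤N = ℕ.≤-trans (s≤s (ℕ.≤-trans (ℕ.≤-trans (ℕ.m≤m*n q (suc s)) (ℕ.m≤n+m (q * suc s) (p * l))) ℕ.≤-refl)) lt
      descend : ∀ M → p + M ≡ N → Div (suc s) (fleckₚ (p + M) l)
      descend M p+M≡N = subst (Div (suc s)) (sym (fleck-rec M l M<B)) (div-*ʳ (int-sgn p) (div-+ (pred l lt)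
        (div-* div-p (div-∑ q (λ i i<q → div-*ʳ (int-fleckCoeff i i<q)
          (div-fleck-p n (suc i + M) s l (ℕ.<-≤-trans (i+M<N i i<q) (ℕ.≤-pred N≤n)) (ℕ.<-trans (s≤s (i+M<N i i<q)) N<B) (bound i)))))))
        where
        M<B : suc M < B
        M<B = ℕ.≤-<-trans (s≤s (subst (M ≤_) p+M≡N (ℕ.m≤n+m M p))) N<B
        i+M<N : ∀ i → i < q → suc i + M < N
        i+M<N i i<q = subst (suc i + M <_) p+M≡N (s≤s (ℕ.+-monoˡ-< M i<q))
        lt′ : ∀ l → p * l + q * suc s < N → q + (p * l + q * s) < q + suc M
        lt′ l lt = subst₂ _<_ (NS.solve 3 (λ q s x → x NS.:+ q NS.:* (NS.con 1 NS.:+ s) NS.:= q NS.:+ (x NS.:+ q NS.:* s)) refl q s (p * l))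
          (trans (sym p+M≡N) (sym (ℕ.+-suc q M))) lt
        bound : ∀ i → p * l + q * s < suc i + M
        bound i = ℕ.<-≤-trans (ℕ.+-cancelˡ-< q _ _ (lt′ l lt)) (s≤s (ℕ.m≤n+m M i))
        pred : ∀ l → p * l + q * suc s < N → Div (suc s) (fleckₚ-pred M l)
        pred zero    _  = subst (Div (suc s)) (sym (fleckₚ-pred-0 M)) div-0
        pred (suc l) lt = div-fleck-p n M (suc s) l (ℕ.<-≤-trans (subst (M <_) p+M≡N (s≤s (ℕ.m≤n+m M q))) (ℕ.≤-pred N≤n)) M<B
          (ℕ.+-cancelˡ-< p _ _ (subst₂ _<_ (trans (cong (_+ q * suc s) (ℕ.*-suc p l)) (ℕ.+-assoc p (p * l) (q * suc s))) (sym p+M≡N) lt))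

    module _ (m : ℕ) (r+m≡q : r + m ≡ q) where

      -- Each step of the recursion multiplies by (-1)^p and lowers either l or s; the binomial
      -- coefficient counts the orders in which this can happen, and (-1)^r is left from the bottom
      -- case.
      lead : ℕ → ℕ → ℚ
      lead l s = sgn (p * (l + s)) ℚ.* binom (l + s) l ℚ.* sgn r

      int-lead : ∀ l s → Integral (lead l s)
      int-lead l s = int-* (int-* (int-sgn (p * (l + s))) (int-binom (l + s) l)) (int-sgn r)

      leadPred : ℕ → ℕ → ℚ
      leadPred zero    s = 0ℚ
      leadPred (suc l) s = lead l s

      lead-0 : ∀ l → lead (suc l) 0 ≡ sgn p ℚ.* lead l 0
      lead-0 l = trans (cong₂ (λ x y → x ℚ.* y ℚ.* sgn r) (trans (cong (λ k → sgn (p * suc k)) (ℕ.+-identityʳ l)) (trans (sgn-p*suc l) (cong (λ k → sgn p ℚ.* sgn (p * k)) (sym (ℕ.+-identityʳ l)))))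
        (trans (binom-l+0 (suc l)) (sym (binom-l+0 l))))
        (solve 4 (λ a b c d → a :* b :* c :* d := a :* (b :* c :* d)) refl (sgn p) (sgn (p * (l + 0))) (binom (l + 0) l) (sgn r))
        where
        binom-l+0 : ∀ l → binom (l + 0) l ≡ 1ℚ
        binom-l+0 l = trans (cong (λ k → binom k l) (ℕ.+-identityʳ l)) (binom-n-n l)

      lead-suc : ∀ l s → lead l (suc s) ≡ sgn p ℚ.* (leadPred l (suc s) ℚ.+ lead l s)
      lead-suc zero    s = trans (cong₂ (λ x y → x ℚ.* y ℚ.* sgn r) (sgn-p*suc s) (trans (binom-n-0 (suc s)) (sym (binom-n-0 s))))
        (solve 4 (λ a b c d → a :* b :* c :* d := a :* (con 0ℚ :+ b :* c :* d)) refl (sgn p) (sgn (p * s)) (binom s 0) (sgn r))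
      lead-suc (suc l) s = trans (cong₂ (λ x y → x ℚ.* y ℚ.* sgn r) (sgn-p*suc (l + suc s))
          (trans (binom-pascal (l + suc s) l) (cong (λ k → binom (l + suc s) l ℚ.+ binom k (suc l)) (ℕ.+-suc l s))))
        (trans (solve 5 (λ a b c d e → a :* b :* (c :+ d) :* e := a :* (b :* c :* e :+ b :* d :* e)) refl (sgn p) (sgn (p * (l + suc s))) (binom (l + suc s) l) (binom (suc l + s) (suc l)) (sgn r))
          (cong (λ k → sgn p ℚ.* (lead l (suc s) ℚ.+ sgn (p * k) ℚ.* binom (suc l + s) (suc l) ℚ.* sgn r)) (ℕ.+-suc l s)))

      -- Used for N + j = p l + q (s + 1) with j < q: the range in which `div-fleck-p` reaches p^s
      -- but not p^(s+1).
      Leading : ℕ → ℕ → ℕ → ℕ → Set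
      Leading N l s j = Cong (suc s) (fleckₚ N l) (powP s ℚ.* (lead l s ℚ.* logPow m s j))

      -- With N ≤ q and j < q the equation leaves only l = s = 0, where the sum reduces to the
      -- single term C(N,r).
      leading-small : ∀ N l s j → N ≤ q → suc N < B → j < q → N + j ≡ p * l + q * suc s → Leading N l s j
      leading-small N zero zero j N≤q N<B j<q eq = cong-trans (cong-refl single)
        (cong-trans (binom-cong-logPow N r j m (trans eq (cong₂ _+_ (ℕ.*-zeroʳ p) (ℕ.*-identityʳ q))) r+m≡q)
          (cong-refl (sym unfold-lead)))
        where
        vanish : ∀ j → j ≢ 0 → weight 0 j ℚ.* binom N (p * j + r) ≡ 0ℚ
        vanish zero    j≢0 = ⊥-elim (j≢0 refl)
        vanish (suc j) j≢0 = *-zero (weight 0 (suc j)) (binom-0 (ℕ.≤-<-trans N≤q (ℕ.≤-trans (ℕ.m≤m*n p (suc j)) (ℕ.m≤m+n (p * suc j) r))))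
        weight-0 : weight 0 0 ≡ 1ℚ
        weight-0 = cong₂ ℚ._*_ (cong sgn (ℕ.*-zeroʳ p)) (binom-n-0 0)
        single : fleckₚ N 0 ≡ binom N r
        single = trans (∑-single B 0 (λ j → weight 0 j ℚ.* binom N (p * j + r)) (ℕ.≤-<-trans z≤n N<B) vanish)
          (trans (cong₂ ℚ._*_ weight-0 (cong (λ k → binom N (k + r)) (ℕ.*-zeroʳ p))) (ℚ.*-identityˡ (binom N r)))
        unfold-lead : 1ℚ ℚ.* (lead 0 0 ℚ.* logPow m 0 j) ≡ sgn r ℚ.* logPow m 0 j
        unfold-lead = trans (cong (λ x → 1ℚ ℚ.* (x ℚ.* sgn r ℚ.* logPow m 0 j)) weight-0)
          (solve 2 (λ a b → con 1ℚ :* (con 1ℚ :* a :* b) := a :* b) refl (sgn r) (logPow m 0 j))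
      leading-small N zero (suc s) j N≤q N<B j<q eq = ⊥-elim (ℕ.<-irrefl eq (ℕ.<-≤-trans (ℕ.+-mono-≤-< N≤q j<q)
        (ℕ.≤-trans (ℕ.≤-trans (ℕ.m≤m+n (q + q) (q * s)) (ℕ.≤-reflexive (NS.solve 2 (λ q s → q NS.:+ q NS.:+ q NS.:* s NS.:= q NS.:* (NS.con 2 NS.:+ s)) refl q s))) (ℕ.m≤n+m (q * suc (suc s)) (p * 0)))))
      leading-small N (suc l) s j N≤q N<B j<q eq = ⊥-elim (ℕ.<-irrefl eq (ℕ.<-≤-trans (ℕ.+-mono-≤-< N≤q j<q)
        (ℕ.+-mono-≤ (ℕ.≤-trans (ℕ.n≤1+n q) (ℕ.m≤m*n p (suc l))) (ℕ.m≤m*n q (suc s)))))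

      Λ⊙logPow : ∀ s j → (Λ ⊙ logPow m s) j ≡ logPow m (suc s) j
      Λ⊙logPow s = SeriesSolver.solve 3 (λ a b c → a SeriesSolver.:* (b SeriesSolver.:* c) SeriesSolver.:= b SeriesSolver.:* (a SeriesSolver.:* c)) ≈-refl Λ (oneMinusZ ^ˢ m) (Λ ^ˢ s)

      -- Along `fleck-rec`, the sum with coefficients 1/(i+1) raises s and multiplies the series by
      -- `Λ`, while the other term raises l and keeps the series; Pascal's rule for `lead` merges
      -- the two.
      leading : ∀ n N l s j → N < n → suc N < B → j < q → N + j ≡ p * l + q * suc s → Leading N l s j
      leading (suc n) N l s j N<n N<B j<q eq with N ℕ.≤? q
      ... | yes N≤q = leading-small N l s j N≤q N<B j<q eq
      ... | no  N≰q = subst (λ N → Leading N l s j) p+M≡N (descend (N ∸ p) p+M≡N l s eq)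
        where
        p+M≡N : p + (N ∸ p) ≡ N
        p+M≡N = ℕ.m+[n∸m]≡n (ℕ.≰⇒> N≰q)
        descend : ∀ M → p + M ≡ N → ∀ l s → N + j ≡ p * l + q * suc s → Leading (p + M) l s j
        descend M p+M≡N l s eq = cong-trans (cong-refl (fleck-rec M l M<B)) (step l s eq)
          where
          M<B : suc M < B
          M<B = ℕ.≤-<-trans (s≤s (subst (M ≤_) p+M≡N (ℕ.m≤n+m M p))) N<B
          i+M<N : ∀ i → i < q → suc i + M < N
          i+M<N i i<q = subst (suc i + M <_) p+M≡N (s≤s (ℕ.+-monoˡ-< M i<q))
          S : ℕ → ℚ
          S l = ∑ q (λ i → fleckCoeff i ℚ.* fleckₚ (suc i + M) l)
          pred : ∀ l s → N + j ≡ p * suc l + q * suc s → Leading M l s j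
          pred l s eq = leading n M l s j (ℕ.<-≤-trans (subst (M <_) p+M≡N (s≤s (ℕ.m≤n+m M q))) (ℕ.≤-pred N<n)) M<B j<q
            (ℕ.+-cancelˡ-≡ p _ _ (trans (sym (ℕ.+-assoc p M j)) (trans (cong (_+ j) p+M≡N) (trans eq (trans (cong (_+ q * suc s) (ℕ.*-suc p l)) (ℕ.+-assoc p (p * l) (q * suc s)))))))
          pred′ : ∀ l s → N + j ≡ p * l + q * suc s → Cong (suc s) (fleckₚ-pred M l) (powP s ℚ.* (leadPred l s ℚ.* logPow m s j))
          pred′ zero    s eq = cong-refl (trans (fleckₚ-pred-0 M) (solve 2 (λ a b → con 0ℚ := a :* (con 0ℚ :* b)) refl (powP s) (logPow m s j)))
          pred′ (suc l) s eq = pred l s eq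
          inner : ∀ l s → N + j ≡ p * l + q * suc (suc s) → Cong (suc (suc s)) (ν p ℚ.* S l) (powP (suc s) ℚ.* (lead l s ℚ.* logPow m (suc s) j))
          inner l s eq = cong-trans (cong-*-div div-p (cong-trans
              (cong-∑-⊙ q fleckCoeff (logPow m s) (λ i → fleckₚ (suc i + M) l) (powP s ℚ.* lead l s) j j<q near far int-fleckCoeff)
              (subst (λ k → Cong k (powP s ℚ.* lead l s ℚ.* (fleckCoeff ⊙ logPow m s) j) (powP s ℚ.* lead l s ℚ.* (Λ ⊙ logPow m s) j)) (ℕ.+-comm s 1)
                (cong-*-div (div (lead l s) (int-lead l s) refl)
                  (cong-⊙ˡ fleckCoeff Λ (logPow m s) j (λ i i≤j → fleckCoeff-cong i (ℕ.≤-<-trans i≤j j<q)) (λ i i≤j → int-logPow m s i (ℕ.≤-<-trans i≤j j<q)))))))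
            (cong-refl (trans (cong (λ x → ν p ℚ.* (powP s ℚ.* lead l s ℚ.* x)) (Λ⊙logPow s j))
              (solve 4 (λ p x l y → p :* (x :* l :* y) := p :* x :* (l :* y)) refl (ν p) (powP s) (lead l s) (logPow m (suc s) j))))
            where
            total : suc M + j ≡ p * l + q * suc s
            total = ℕ.+-cancelˡ-≡ q _ _ (trans (NS.solve 3 (λ q M j → q NS.:+ (NS.con 1 NS.:+ M NS.:+ j) NS.:= NS.con 1 NS.:+ q NS.:+ M NS.:+ j) refl q M j)
              (trans (cong (_+ j) p+M≡N) (trans eq (NS.solve 3 (λ q s x → x NS.:+ q NS.:* (NS.con 2 NS.:+ s) NS.:= q NS.:+ (x NS.:+ q NS.:* (NS.con 1 NS.:+ s))) refl q s (p * l)))))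
            near : ∀ i i′ → i + i′ ≡ j → Cong (suc s) (fleckₚ (suc i + M) l) (powP s ℚ.* lead l s ℚ.* logPow m s i′)
            near i i′ i+i′≡j = cong-trans (leading n (suc i + M) l s i′ (ℕ.<-≤-trans (i+M<N i i<q) (ℕ.≤-pred N<n)) (ℕ.<-trans (s≤s (i+M<N i i<q)) N<B)
                (ℕ.≤-<-trans (subst (i′ ≤_) i+i′≡j (ℕ.m≤n+m i′ i)) j<q)
                (trans (NS.solve 3 (λ i M i′ → NS.con 1 NS.:+ i NS.:+ M NS.:+ i′ NS.:= NS.con 1 NS.:+ M NS.:+ (i NS.:+ i′)) refl i M i′) (trans (cong (λ k → suc M + k) i+i′≡j) total)))
              (cong-refl (sym (ℚ.*-assoc (powP s) (lead l s) (logPow m s i′))))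
              where
              i<q : i < q
              i<q = ℕ.≤-<-trans (subst (i ≤_) i+i′≡j (ℕ.m≤m+n i i′)) j<q
            -- For i > j the argument has passed the threshold for s + 1, so the term carries a
            -- further factor p.
            far : ∀ i → j < i → i < q → Div (suc s) (fleckₚ (suc i + M) l)
            far i j<i i<q = div-fleck-p n (suc i + M) (suc s) l (ℕ.<-≤-trans (i+M<N i i<q) (ℕ.≤-pred N<n)) (ℕ.<-trans (s≤s (i+M<N i i<q)) N<B)
              (subst₂ _<_ total (cong suc (ℕ.+-comm M i)) (s≤s (ℕ.+-monoʳ-< M j<i)))
          int-S : ∀ l → Integral (S l)
          int-S l = div⇒int (div-∑ q (λ i i<q → div-*ʳ (int-fleckCoeff i i<q) (int⇒div (int-fleck p B (suc i + M) r l))))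
          step : ∀ l s → N + j ≡ p * l + q * suc s →
                 Cong (suc s) (sgn p ℚ.* (fleckₚ-pred M l ℚ.+ ν p ℚ.* S l)) (powP s ℚ.* (lead l s ℚ.* logPow m s j))
          step zero    zero    eq = ⊥-elim (N≰q (subst (N ≤_) (trans eq (cong₂ _+_ (ℕ.*-zeroʳ p) (ℕ.*-identityʳ q))) (ℕ.m≤m+n N j)))
          -- For s = 0 the modulus is p itself, so the sum multiplied by p drops out.
          step (suc l) zero    eq = cong-trans (cong-*ˡ (int-sgn p) (cong-+ (pred l 0 eq) (div⇒cong-0 (div-*ˡ div-p (int-S (suc l))))))
            (cong-refl (trans (solve 3 (λ s a b → s :* (con 1ℚ :* (a :* b) :+ con 0ℚ) := con 1ℚ :* (s :* a :* b)) refl (sgn p) (lead l 0) (logPow m 0 j))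
              (cong (λ x → 1ℚ ℚ.* (x ℚ.* logPow m 0 j)) (sym (lead-0 l)))))
          step l       (suc s) eq = cong-trans (cong-*ˡ (int-sgn p) (cong-+ (pred′ l (suc s) eq) (inner l s eq)))
            (cong-refl (trans (solve 5 (λ s x a b y → s :* (x :* (a :* y) :+ x :* (b :* y)) := x :* (s :* (a :+ b) :* y)) refl (sgn p) (powP (suc s)) (leadPred l (suc s)) (lead l s) (logPow m (suc s) j))
              (cong (λ x → powP (suc s) ℚ.* (x ℚ.* logPow m (suc s) j)) (sym (lead-suc l s)))))

  -- Passing from modulus p Q to modulus Q

  -- The sign (-(-1)^p)^k, which is 1 for odd p.
  η : ℕ → ℚ
  η k = sgn (suc p * k)

  η-square : ∀ k → η k ℚ.* η k ≡ 1ℚ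
  η-square k = sgn-square (suc p * k)

  η-split : ∀ k → η k ≡ sgn (p * k) ℚ.* sgn k
  η-split k = trans (sgn-+ k (p * k)) (ℚ.*-comm (sgn k) (sgn (p * k)))

  η-+ : ∀ j k → η (j + k) ≡ η j ℚ.* η k
  η-+ j k = trans (cong sgn (ℕ.*-distribˡ-+ (suc p) j k)) (sgn-+ (suc p * j) (suc p * k))

  η-p* : ∀ k → η (p * k) ≡ 1ℚ
  η-p* k = trans (cong sgn (sym (ℕ.*-assoc (suc p) p k))) (sgn-even (suc p * p) k (sgn-suc-* p))

  -- As a function of i, the Fleck sum is the binomial transform of (-1)^(p j) C(N, p j + r);
  -- orthogonality undoes it.
  fleck-invert : ∀ B N r k → N < B → ∑ B (λ i → sgn i ℚ.* binom i k ℚ.* fleck p B N r i) ≡ η k ℚ.* binom N (p * k + r)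
  fleck-invert B N r k N<B = begin
    ∑ B (λ i → sgn i ℚ.* binom i k ℚ.* fleck p B N r i)
      ≡⟨ ∑-cong B (λ i → sym (∑-* B (sgn i ℚ.* binom i k) (λ j → weight i j ℚ.* c j))) ⟩
    ∑ B (λ i → ∑ B (λ j → sgn i ℚ.* binom i k ℚ.* (sgn (p * j) ℚ.* binom j i ℚ.* c j)))
      ≡⟨ ∑-swap B B (λ i j → sgn i ℚ.* binom i k ℚ.* (sgn (p * j) ℚ.* binom j i ℚ.* c j)) ⟩
    ∑ B (λ j → ∑ B (λ i → sgn i ℚ.* binom i k ℚ.* (sgn (p * j) ℚ.* binom j i ℚ.* c j)))
      ≡⟨ ∑-cong B (λ j → trans (∑-cong B (λ i → solve 5 (λ s a e b c → s :* a :* (e :* b :* c) := e :* c :* (s :* b :* a)) refl (sgn i) (binom i k) (sgn (p * j)) (binom j i) (c j)))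
           (∑-* B (sgn (p * j) ℚ.* c j) (λ i → sgn i ℚ.* binom j i ℚ.* binom i k))) ⟩
    ∑ B term
      ≡⟨ collapse ⟩
    η k ℚ.* c k ∎
    where
    open ≡-Reasoning
    c term : ℕ → ℚ
    c j    = binom N (p * j + r)
    term j = sgn (p * j) ℚ.* c j ℚ.* ∑ B (λ i → sgn i ℚ.* binom j i ℚ.* binom i k)
    vanish : ∀ j → j < B → j ≢ k → term j ≡ 0ℚ
    vanish j j<B j≢k = *-zero (sgn (p * j) ℚ.* c j) (binom-orthogonal B j k j<B j≢k)
    c-0 : ∀ j → B ≤ j → c j ≡ 0ℚ
    c-0 j B≤j = binom-0 (ℕ.<-≤-trans N<B (ℕ.≤-trans B≤j (ℕ.≤-trans (ℕ.m≤n*m j p) (ℕ.m≤m+n (p * j) r))))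
    vanish-all : ∀ j → j ≢ k → term j ≡ 0ℚ
    vanish-all j j≢k with j ℕ.<? B
    ... | yes j<B = vanish j j<B j≢k
    ... | no  j≮B = trans (cong (λ x → sgn (p * j) ℚ.* x ℚ.* s) (c-0 j (ℕ.≮⇒≥ j≮B))) (solve 2 (λ a b → a :* con 0ℚ :* b := con 0ℚ) refl (sgn (p * j)) s)
      where
      s : ℚ
      s = ∑ B (λ i → sgn i ℚ.* binom j i ℚ.* binom i k)
    collapse : ∑ B term ≡ η k ℚ.* c k
    -- An index k beyond the truncation makes both sides vanish, the right one because p k + r > N.
    collapse with k ℕ.<? B
    ... | yes k<B = trans (∑-single B k term k<B vanish-all) (trans (cong (sgn (p * k) ℚ.* c k ℚ.*_) (binom-diagonal B k k<B))
        (trans (solve 3 (λ e c s → e :* c :* s := e :* s :* c) refl (sgn (p * k)) (c k) (sgn k)) (cong (ℚ._* c k) (sym (η-split k)))))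
    ... | no  k≮B = trans (∑-0 B (λ j j<B → vanish j j<B (λ j≡k → k≮B (subst (_< B) j≡k j<B)))) (sym (*-zero (η k) (c-0 k (ℕ.≮⇒≥ k≮B))))

  -- The inversion formula is inserted for each binomial coefficient of N and the sums are
  -- exchanged. Since Q = p `Q′` is a multiple of p, the sign `η` (Q k + r₁) is the same for all k
  -- and can be taken out.
  fleck-compose : ∀ Q′ B N r₀ r₁ l → N < B →
    fleck (p * (p * Q′)) B N (r₀ + p * r₁) l ≡ η r₁ ℚ.* ∑ B (λ i → sgn i ℚ.* fleck p B N r₀ i ℚ.* fleck (p * Q′) B i r₁ l)
  fleck-compose Q′ B N r₀ r₁ l N<B = begin
    ∑ B (λ k → weight l k ℚ.* binom N (p * Q * k + (r₀ + p * r₁)))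
      ≡⟨ ∑-cong B invert ⟩
    ∑ B (λ k → η r₁ ℚ.* ∑ B (λ i → weight l k ℚ.* (sgn i ℚ.* binom i (Q * k + r₁) ℚ.* fleck p B N r₀ i)))
      ≡⟨ ∑-* B (η r₁) (λ k → ∑ B (λ i → weight l k ℚ.* (sgn i ℚ.* binom i (Q * k + r₁) ℚ.* fleck p B N r₀ i))) ⟩
    η r₁ ℚ.* ∑ B (λ k → ∑ B (λ i → weight l k ℚ.* (sgn i ℚ.* binom i (Q * k + r₁) ℚ.* fleck p B N r₀ i)))
      ≡⟨ cong (η r₁ ℚ.*_) (∑-swap B B (λ k i → weight l k ℚ.* (sgn i ℚ.* binom i (Q * k + r₁) ℚ.* fleck p B N r₀ i))) ⟩
    η r₁ ℚ.* ∑ B (λ i → ∑ B (λ k → weight l k ℚ.* (sgn i ℚ.* binom i (Q * k + r₁) ℚ.* fleck p B N r₀ i)))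
      ≡⟨ cong (η r₁ ℚ.*_) (∑-cong B (λ i → trans
           (∑-cong B (λ k → solve 4 (λ w s b f → w :* (s :* b :* f) := s :* f :* (w :* b)) refl (weight l k) (sgn i) (binom i (Q * k + r₁)) (fleck p B N r₀ i)))
           (∑-* B (sgn i ℚ.* fleck p B N r₀ i) (λ k → weight l k ℚ.* binom i (Q * k + r₁))))) ⟩
    η r₁ ℚ.* ∑ B (λ i → sgn i ℚ.* fleck p B N r₀ i ℚ.* fleck Q B i r₁ l) ∎
    where
    open ≡-Reasoning
    Q : ℕ
    Q = p * Q′
    η-digit : ∀ k → η (Q * k + r₁) ≡ η r₁
    η-digit k = trans (η-+ (Q * k) r₁) (trans (cong (λ n → η n ℚ.* η r₁) (ℕ.*-assoc p Q′ k)) (trans (cong (ℚ._* η r₁) (η-p* (Q′ * k))) (ℚ.*-identityˡ (η r₁))))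
    invert : ∀ k → weight l k ℚ.* binom N (p * Q * k + (r₀ + p * r₁))
                 ≡ η r₁ ℚ.* ∑ B (λ i → weight l k ℚ.* (sgn i ℚ.* binom i (Q * k + r₁) ℚ.* fleck p B N r₀ i))
    invert k = sym (begin
      η r₁ ℚ.* ∑ B (λ i → weight l k ℚ.* (sgn i ℚ.* binom i (Q * k + r₁) ℚ.* fleck p B N r₀ i))
        ≡⟨ cong (η r₁ ℚ.*_) (trans (∑-* B (weight l k) (λ i → sgn i ℚ.* binom i (Q * k + r₁) ℚ.* fleck p B N r₀ i)) (cong (weight l k ℚ.*_) (fleck-invert B N r₀ (Q * k + r₁) N<B))) ⟩
      η r₁ ℚ.* (weight l k ℚ.* (η (Q * k + r₁) ℚ.* binom N (p * (Q * k + r₁) + r₀)))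
        ≡⟨ cong₂ (λ x n → η r₁ ℚ.* (weight l k ℚ.* (x ℚ.* binom N n))) (η-digit k)
             (NS.solve 5 (λ p Q k r₀ r₁ → p NS.:* (Q NS.:* k NS.:+ r₁) NS.:+ r₀ NS.:= p NS.:* Q NS.:* k NS.:+ (r₀ NS.:+ p NS.:* r₁)) refl p Q k r₀ r₁) ⟩
      η r₁ ℚ.* (weight l k ℚ.* (η r₁ ℚ.* b))
        ≡⟨ solve 3 (λ e w b → e :* (w :* (e :* b)) := e :* e :* (w :* b)) refl (η r₁) (weight l k) b ⟩
      η r₁ ℚ.* η r₁ ℚ.* (weight l k ℚ.* b)
        ≡⟨ trans (cong (ℚ._* (weight l k ℚ.* b)) (η-square r₁)) (ℚ.*-identityˡ (weight l k ℚ.* b)) ⟩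
      weight l k ℚ.* b ∎)
      where
      b : ℚ
      b = binom N (p * Q * k + (r₀ + p * r₁))

  -- Divisibility and reduction for prime power moduli

  1≤p^ : ∀ a → 1 ≤ p ^ a
  1≤p^ a = ℕ.m^n>0 p a

  -- The smallest N from which Weisman's bound for modulus p^(a+1) provides p^s; at a = 0 it says p
  -- l + (p-1) s < N.
  threshold : ℕ → ℕ → ℕ → ℕ
  threshold a l s = p ^ a * (p * l + q * s + 1)

  -- One more power of p costs p^a (p-1) ≥ 1 in N, so missing the threshold by u loses at most u
  -- powers.
  threshold-+ : ∀ a l u v → threshold a l v + u ≤ threshold a l (u + v)
  threshold-+ a l u v = begin
    p ^ a * (p * l + q * v + 1) + u                       ≤⟨ ℕ.+-monoʳ-≤ (p ^ a * (p * l + q * v + 1)) u≤ ⟩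
    p ^ a * (p * l + q * v + 1) + p ^ a * (q * u)         ≡⟨ NS.solve 5 (λ P x q u v → P NS.:* (x NS.:+ q NS.:* v NS.:+ NS.con 1) NS.:+ P NS.:* (q NS.:* u) NS.:= P NS.:* (x NS.:+ q NS.:* (u NS.:+ v) NS.:+ NS.con 1)) refl (p ^ a) (p * l) q u v ⟩
    threshold a l (u + v)                                 ∎
    where
    open ℕ.≤-Reasoning
    u≤ : u ≤ p ^ a * (q * u)
    u≤ = ℕ.≤-trans (ℕ.≤-reflexive (sym (ℕ.*-identityˡ u)))
      (ℕ.≤-trans (ℕ.*-monoˡ-≤ u (ℕ.*-mono-≤ (1≤p^ a) (ℕ.≤-pred 1<p))) (ℕ.≤-reflexive (ℕ.*-assoc (p ^ a) q u)))

  fleck-p-0 : ∀ B N r i → N < p * i + r → fleck p B N r i ≡ 0ℚ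
  fleck-p-0 B N r i N< = ∑-0 B vanish
    where
    vanish : ∀ j → j < B → weight i j ℚ.* binom N (p * j + r) ≡ 0ℚ
    vanish j _ with j ℕ.<? i
    ... | yes j<i = trans (cong (λ x → sgn (p * j) ℚ.* x ℚ.* binom N (p * j + r)) (binom-0 j<i)) (solve 2 (λ a b → a :* con 0ℚ :* b := con 0ℚ) refl (sgn (p * j)) (binom N (p * j + r)))
    ... | no  j≮i = *-zero (weight i j) (binom-0 (ℕ.<-≤-trans N< (ℕ.+-monoˡ-≤ r (ℕ.*-monoʳ-≤ p (ℕ.≮⇒≥ j≮i)))))

  -- Because p (i + u) = p i + q u + u, the strict inequality of `div-fleck-p` holds once u ≥ 1.
  div-fleck-p-deficit : ∀ B N r i u → r < p → suc N < B → p * (i + u) ≤ N → 1 ≤ u → Div u (fleck p B N r i)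
  div-fleck-p-deficit B N r i u r<p N<B le 1≤u = div-fleck-p B r r<p (suc N) N u i (ℕ.n<1+n N) N<B
    (ℕ.<-≤-trans (ℕ.m<m+n (p * i + q * u) 1≤u) (ℕ.≤-trans (ℕ.≤-reflexive
      (NS.solve 3 (λ q i u → (NS.con 1 NS.:+ q) NS.:* i NS.:+ q NS.:* u NS.:+ u NS.:= (NS.con 1 NS.:+ q) NS.:* (i NS.:+ u)) refl q i u)) le))

  -- In `fleck-compose` each product is divisible on its own: p times the threshold for a is the one
  -- for a + 1, so whatever the factor of modulus p^(a+1) lacks is made up by the factor of modulus
  -- p.
  div-fleck : ∀ a B N s l r → r < p ^ suc a → suc N < B → threshold a l s ≤ N → Div s (fleck (p ^ suc a) B N r l)
  div-fleck zero B N s l r r<p N<B K≤N = subst (λ Q → Div s (fleck Q B N r l)) (sym (ℕ.*-identityʳ p))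
    (div-fleck-p B r (subst (r <_) (ℕ.*-identityʳ p) r<p) (suc N) N s l (ℕ.n<1+n N) N<B
      (ℕ.≤-trans (ℕ.≤-reflexive (trans (ℕ.+-comm 1 (p * l + q * s)) (sym (ℕ.*-identityˡ (p * l + q * s + 1))))) K≤N))
  div-fleck (suc a) B N s l r r<p N<B K≤N = subst (λ r → Div s (fleck (p ^ suc (suc a)) B N r l)) digits
    (subst (Div s) (sym (fleck-compose (p ^ a) B N r₀ r₁ l (ℕ.<-trans (ℕ.n<1+n N) N<B)))
      (div-*ʳ (int-sgn (suc p * r₁)) (div-∑ B term)))
    where
    r₀ r₁ K : ℕ
    r₀ = r % p
    r₁ = r / p
    K  = threshold a l s
    digits : r₀ + p * r₁ ≡ r
    digits = trans (cong (λ k → r₀ + k) (ℕ.*-comm p r₁)) (sym (m≡m%n+[m/n]*n r p))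
    r₁< : r₁ < p ^ suc a
    r₁< = m<n*o⇒m/o<n (subst (r <_) (ℕ.*-comm p (p ^ suc a)) r<p)
    pK≤N : p * K ≤ N
    pK≤N = ℕ.≤-trans (ℕ.≤-reflexive (sym (ℕ.*-assoc p (p ^ a) (p * l + q * s + 1)))) K≤N
    -- If i falls short of the threshold K by u, then p^u divides the inner sum.
    below : ∀ i u → i + u ≡ K → 1 ≤ u → i ≤ N → Div s (fleck p B N r₀ i ℚ.* fleck (p ^ suc a) B i r₁ l)
    below i u i+u≡K 1≤u i≤N with ℕ.≤-total s u
    ... | inj₁ s≤u = div-*ˡ (div-≤ s≤u (div-fleck-p-deficit B N r₀ i u (m%n<n r p) N<B (subst (λ k → p * k ≤ N) (sym i+u≡K) pK≤N) 1≤u)) (int-fleck (p ^ suc a) B i r₁ l)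
    ... | inj₂ u≤s = subst (λ s → Div s _) (ℕ.m+[n∸m]≡n u≤s)
      (div-* (div-fleck-p-deficit B N r₀ i u (m%n<n r p) N<B (subst (λ k → p * k ≤ N) (sym i+u≡K) pK≤N) 1≤u)
        (div-fleck a B i (s ∸ u) l r₁ r₁< (ℕ.≤-<-trans (s≤s i≤N) N<B)
          (ℕ.+-cancelʳ-≤ u _ _ (ℕ.≤-trans (threshold-+ a l u (s ∸ u)) (ℕ.≤-reflexive (trans (cong (threshold a l) (ℕ.m+[n∸m]≡n u≤s)) (sym i+u≡K)))))))
    product : ∀ i → Div s (fleck p B N r₀ i ℚ.* fleck (p ^ suc a) B i r₁ l)
    product i with i ℕ.≤? N
    ... | no  i≰N = subst (Div s) (sym (trans (cong (ℚ._* fleck (p ^ suc a) B i r₁ l) (fleck-p-0 B N r₀ i (ℕ.<-≤-trans (ℕ.≰⇒> i≰N) (ℕ.≤-trans (ℕ.m≤n*m i p) (ℕ.m≤m+n (p * i) r₀))))) (ℚ.*-zeroˡ (fleck (p ^ suc a) B i r₁ l)))) div-0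
    ... | yes i≤N with i ℕ.<? K
    ...   | no  i≮K = div-*ʳ (int-fleck p B N r₀ i) (div-fleck a B i s l r₁ r₁< (ℕ.≤-<-trans (s≤s i≤N) N<B) (ℕ.≮⇒≥ i≮K))
    ...   | yes i<K = below i (K ∸ i) (ℕ.m+[n∸m]≡n (ℕ.<⇒≤ i<K)) (ℕ.m<n⇒0<n∸m i<K) i≤N
    term : ∀ i → i < B → Div s (sgn i ℚ.* fleck p B N r₀ i ℚ.* fleck (p ^ suc a) B i r₁ l)
    term i _ = subst (Div s) (sym (ℚ.*-assoc (sgn i) (fleck p B N r₀ i) (fleck (p ^ suc a) B i r₁ l))) (div-*ʳ (int-sgn i) (product i))

  -- The weight C(j,i₀) excludes j < i₀, and the other binomial coefficient excludes j > i₀.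
  fleck-p-top : ∀ B i₀ r₀ → i₀ < B → fleck p B (p * i₀ + r₀) r₀ i₀ ≡ sgn (p * i₀)
  fleck-p-top B i₀ r₀ i₀<B = trans (∑-single B i₀ term i₀<B vanish)
    (trans (cong₂ (λ x y → sgn (p * i₀) ℚ.* x ℚ.* y) (binom-n-n i₀) (binom-n-n (p * i₀ + r₀))) (solve 1 (λ s → s :* con 1ℚ :* con 1ℚ := s) refl (sgn (p * i₀))))
    where
    term : ℕ → ℚ
    term j = weight i₀ j ℚ.* binom (p * i₀ + r₀) (p * j + r₀)
    vanish : ∀ j → j ≢ i₀ → term j ≡ 0ℚ
    vanish j j≢i₀ with ℕ.<-cmp j i₀
    ... | tri≈ _ j≡i₀ _ = ⊥-elim (j≢i₀ j≡i₀)
    ... | tri< j<i₀ _ _ = trans (cong (λ x → sgn (p * j) ℚ.* x ℚ.* binom (p * i₀ + r₀) (p * j + r₀)) (binom-0 j<i₀)) (solve 2 (λ a b → a :* con 0ℚ :* b := con 0ℚ) refl (sgn (p * j)) (binom (p * i₀ + r₀) (p * j + r₀)))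
    ... | tri> _ _ i₀<j = *-zero (weight i₀ j) (binom-0 (ℕ.+-monoˡ-< r₀ (ℕ.*-monoʳ-< p i₀<j)))

  -- Modulo p^(s+1) only the term i = i₀ of fleck-compose survives.
  fleck-reduce : ∀ a B i₀ r₀ r₁ x s l → r₀ < p → r₁ < p ^ suc a → i₀ ≡ r₁ + p * x → suc (p * i₀ + r₀) < B →
    threshold a l s < i₀ ⊎ (r₀ ≡ q × threshold a l s ≤ i₀) →
    Cong (suc s) (fleck (p ^ suc (suc a)) B (p * i₀ + r₀) (r₀ + p * r₁) l) (fleck (p ^ suc a) B i₀ r₁ l)
  fleck-reduce a B i₀ r₀ r₁ x s l r₀<p r₁< i₀≡ N<B large = cong-trans (cong-refl (fleck-compose (p ^ a) B N r₀ r₁ l (ℕ.<-trans (ℕ.n<1+n N) N<B)))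
    (cong-trans (cong-*ˡ (int-sgn (suc p * r₁)) (cong-∑-single B i₀ term i₀<B small)) (cong-refl main))
    where
    N : ℕ
    N = p * i₀ + r₀
    lower : ℕ → ℚ
    lower i = fleck (p ^ suc a) B i r₁ l
    term : ℕ → ℚ
    term i = sgn i ℚ.* fleck p B N r₀ i ℚ.* lower i
    i₀≤N : i₀ ≤ N
    i₀≤N = ℕ.≤-trans (ℕ.m≤n*m i₀ p) (ℕ.m≤m+n (p * i₀) r₀)
    i₀<B : i₀ < B
    i₀<B = ℕ.≤-<-trans (ℕ.≤-trans i₀≤N (ℕ.n≤1+n N)) N<B
    main : η r₁ ℚ.* term i₀ ≡ lower i₀
    main = begin
      η r₁ ℚ.* (sgn i₀ ℚ.* fleck p B N r₀ i₀ ℚ.* lower i₀)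
        ≡⟨ cong (λ y → η r₁ ℚ.* (sgn i₀ ℚ.* y ℚ.* lower i₀)) (fleck-p-top B i₀ r₀ i₀<B) ⟩
      η r₁ ℚ.* (sgn i₀ ℚ.* sgn (p * i₀) ℚ.* lower i₀)
        ≡⟨ cong (λ y → η r₁ ℚ.* (y ℚ.* lower i₀)) (trans (ℚ.*-comm (sgn i₀) (sgn (p * i₀))) (sym (η-split i₀))) ⟩
      -- The indices i₀ and r₁ differ by a multiple of p, so their signs agree and cancel.
      η r₁ ℚ.* (η i₀ ℚ.* lower i₀)
        ≡⟨ cong (λ y → η r₁ ℚ.* (y ℚ.* lower i₀)) (trans (cong η i₀≡) (trans (η-+ r₁ (p * x)) (cong (η r₁ ℚ.*_) (η-p* x)))) ⟩
      η r₁ ℚ.* (η r₁ ℚ.* 1ℚ ℚ.* lower i₀)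
        ≡⟨ solve 2 (λ e y → e :* (e :* con 1ℚ :* y) := e :* e :* y) refl (η r₁) (lower i₀) ⟩
      η r₁ ℚ.* η r₁ ℚ.* lower i₀
        ≡⟨ trans (cong (ℚ._* lower i₀) (η-square r₁)) (ℚ.*-identityˡ (lower i₀)) ⟩
      lower i₀ ∎
      where open ≡-Reasoning
    -- The deficit u of i below i₀ is paid by the first factor, with one unit to spare.
    pay : ∀ i u w → i ≤ N → Div w (fleck p B N r₀ i) → w ≡ suc u → threshold a l s ≤ i + u → Div (suc s) (fleck p B N r₀ i ℚ.* lower i)
    pay i u .(suc u) i≤N d refl K≤ with ℕ.≤-total s u
    ... | inj₁ s≤u = div-*ˡ (div-≤ (s≤s s≤u) d) (int-fleck (p ^ suc a) B i r₁ l)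
    ... | inj₂ u≤s = subst (λ s → Div (suc s) (fleck p B N r₀ i ℚ.* lower i)) (ℕ.m+[n∸m]≡n u≤s)
      (div-* d (div-fleck a B i (s ∸ u) l r₁ r₁< (ℕ.≤-<-trans (s≤s i≤N) N<B)
        (ℕ.+-cancelʳ-≤ u _ _ (ℕ.≤-trans (threshold-+ a l u (s ∸ u)) (ℕ.≤-trans (ℕ.≤-reflexive (cong (threshold a l) (ℕ.m+[n∸m]≡n u≤s))) K≤)))))
    below : ∀ i u → i + suc u ≡ i₀ → Div (suc s) (fleck p B N r₀ i ℚ.* lower i)
    below i u i+u≡i₀ = go large
      where
      i≤N : i ≤ N
      i≤N = ℕ.≤-trans (subst (i ≤_) i+u≡i₀ (ℕ.m≤m+n i (suc u))) i₀≤N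
      go : threshold a l s < i₀ ⊎ (r₀ ≡ q × threshold a l s ≤ i₀) → Div (suc s) (fleck p B N r₀ i ℚ.* lower i)
      -- The spare power is in the second factor: i lies u + 1 below i₀ but at most u below the
      -- threshold.
      go (inj₁ K<i₀) = pay i u (suc u) i≤N
        (div-fleck-p-deficit B N r₀ i (suc u) r₀<p N<B (subst (λ k → p * k ≤ N) (sym i+u≡i₀) (ℕ.m≤m+n (p * i₀) r₀)) (s≤s z≤n)) refl
        (ℕ.≤-pred (ℕ.≤-trans K<i₀ (ℕ.≤-reflexive (trans (sym i+u≡i₀) (ℕ.+-suc i u)))))
      -- Now i may lie u + 1 below the threshold. The spare power comes from the last digit: r₀ = q
      -- raises N = p i₀ + r₀ by q, the price of one more power in the first factor.
      go (inj₂ (r₀≡q , K≤i₀)) = pay i (suc u) (suc (suc u)) i≤N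
        (div-fleck-p B r₀ r₀<p (suc N) N (suc (suc u)) i (ℕ.n<1+n N) N<B bound) refl
        (subst (threshold a l s ≤_) (sym i+u≡i₀) K≤i₀)
        where
        bound : p * i + q * suc (suc u) < N
        bound = ℕ.<-≤-trans (ℕ.m<m+n (p * i + q * suc (suc u)) (s≤s (z≤n {u})))
          (ℕ.≤-reflexive (trans (NS.solve 3 (λ q i u → (NS.con 1 NS.:+ q) NS.:* i NS.:+ q NS.:* (NS.con 2 NS.:+ u) NS.:+ (NS.con 1 NS.:+ u) NS.:= (NS.con 1 NS.:+ q) NS.:* (i NS.:+ (NS.con 1 NS.:+ u)) NS.:+ q) refl q i u)
            (cong₂ (λ j r → p * j + r) i+u≡i₀ (sym r₀≡q))))
    small : ∀ i → i ≢ i₀ → Div (suc s) (term i)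
    small i i≢i₀ = subst (Div (suc s)) (sym (ℚ.*-assoc (sgn i) (fleck p B N r₀ i) (lower i))) (div-*ʳ (int-sgn i) (cases (ℕ.<-cmp i i₀)))
      where
      cases : Tri (i < i₀) (i ≡ i₀) (i₀ < i) → Div (suc s) (fleck p B N r₀ i ℚ.* lower i)
      cases (tri≈ _ i≡i₀ _) = ⊥-elim (i≢i₀ i≡i₀)
      cases (tri> _ _ i₀<i) = subst (Div (suc s)) (sym (trans (cong (ℚ._* lower i) (fleck-p-0 B N r₀ i (ℕ.+-monoˡ-< r₀ (ℕ.*-monoʳ-< p i₀<i)))) (ℚ.*-zeroˡ (lower i)))) div-0
      cases (tri< i<i₀ _ _) = below i (i₀ ∸ suc i) (trans (ℕ.+-suc i (i₀ ∸ suc i)) (ℕ.m+[n∸m]≡n i<i₀))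

  -- The condition d ≤ max (p^(a-2), 1) of the theorem, with a and d replaced by a + 1 and d + 1.
  AdmissibleShift : ℕ → ℕ → Set
  AdmissibleShift zero    d = d ≡ 0
  AdmissibleShift (suc a) d = d < p ^ a

  admissible-/ : ∀ a d → AdmissibleShift (suc a) d → AdmissibleShift a (d / p)
  admissible-/ zero    zero d<1 = refl
  admissible-/ zero    (suc d) (s≤s ())
  admissible-/ (suc a) d d<p^a = m<n*o⇒m/o<n (subst (d <_) (ℕ.*-comm p (p ^ a)) d<p^a)

  admissible-< : ∀ a d → AdmissibleShift a d → suc d ≤ p ^ a
  admissible-< zero    d refl  = ℕ.≤-refl
  admissible-< (suc a) d d<p^a = ℕ.≤-trans d<p^a (ℕ.m≤n*m (p ^ a) p)

  -- Descent to modulus p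

  module _ (l m t n′ r⋆ : ℕ) (1≤t : 1 ≤ t) (n≡ : suc n′ ≡ l + (m + suc t)) (r⋆+m≡q : r⋆ + m ≡ q) where

    order : ℕ
    order = m + suc t

    m≤q : m ≤ q
    m≤q = subst (m ≤_) r⋆+m≡q (ℕ.m≤n+m m r⋆)

    -- The residue keeps its shape: removing the last digit of p^(a+1) - p^a m - d - 1 lowers a by
    -- one and replaces d by `d / p`, while `n′` is unchanged. At the bottom d = 0 and the residue
    -- is `r⋆` = q - m.
    fleck-chain : ∀ a B d r → AdmissibleShift a d → r + p ^ a * m + suc d ≡ p ^ suc a → suc (r + p ^ suc a * n′) < B →
      Cong (suc order) (fleck (p ^ suc a) B (r + p ^ suc a * n′) r l) (fleck p B (r⋆ + p * n′) r⋆ l)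
    fleck-chain zero B d r refl r+≡ N<B = cong-refl (cong₂ (λ Q r → fleck Q B (r + Q * n′) r l) (ℕ.*-identityʳ p) r≡r⋆)
      where
      r≡r⋆ : r ≡ r⋆
      r≡r⋆ = ℕ.+-cancelʳ-≡ (suc m) r r⋆ (trans (NS.solve 2 (λ r m → r NS.:+ (NS.con 1 NS.:+ m) NS.:= r NS.:+ NS.con 1 NS.:* m NS.:+ NS.con 1) refl r m)
        (trans r+≡ (trans (ℕ.*-identityʳ p) (trans (cong suc (sym r⋆+m≡q)) (sym (ℕ.+-suc r⋆ m))))))
    fleck-chain (suc a) B d r adm r+≡ N<B = cong-trans (cong-refl (cong₂ (λ N r → fleck (p ^ suc (suc a)) B N r l) (sym N≡) r≡))
      (cong-trans (fleck-reduce a B i₀ r₀ r₁ (p ^ a * n′) order l r₀<p r₁< (cong (λ k → r₁ + k) (ℕ.*-assoc p (p ^ a) n′)) (subst (λ N → suc N < B) (sym N≡) N<B) large)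
        (fleck-chain a B x r₁ (admissible-/ a d adm) (trans (ℕ.+-assoc r₁ (p ^ a * m) (suc x)) r₁+) (ℕ.≤-<-trans (s≤s i₀≤N) N<B)))
      where
      -- For d = x p + y the last digit of r is q - y, and its other digits form the residue r₁ belonging to the shift x.
      x y r₀ r₁ i₀ P : ℕ
      P  = p ^ a
      x  = d / p
      y  = d % p
      r₀ = q ∸ y
      r₁ = p * P ∸ (P * m + suc x)
      i₀ = r₁ + p * P * n′
      y≤q : y ≤ q
      y≤q = ℕ.≤-pred (m%n<n d p)
      r₀<p : r₀ < p
      r₀<p = s≤s (ℕ.m∸n≤m q y)
      r₁+ : r₁ + (P * m + suc x) ≡ p * P
      r₁+ = ℕ.m∸n+n≡m (ℕ.≤-trans (ℕ.+-mono-≤ (ℕ.*-monoʳ-≤ P m≤q) (admissible-< a x (admissible-/ a d adm)))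
        (ℕ.≤-reflexive (NS.solve 2 (λ q P → P NS.:* q NS.:+ P NS.:= (NS.con 1 NS.:+ q) NS.:* P) refl q P)))
      r₁< : r₁ < p * P
      r₁< = subst (r₁ <_) r₁+ (ℕ.m<m+n r₁ (ℕ.≤-trans (s≤s z≤n) (ℕ.m≤n+m (suc x) (P * m))))
      r≡ : r ≡ r₀ + p * r₁
      r≡ = ℕ.+-cancelʳ-≡ (p * P * m + suc d) r (r₀ + p * r₁) (begin
        r + (p * P * m + suc d)                                 ≡⟨ ℕ.+-assoc r (p * P * m) (suc d) ⟨
        r + p * P * m + suc d                                   ≡⟨ r+≡ ⟩
        p * (p * P)                                             ≡⟨ cong (p *_) r₁+ ⟨
        p * (r₁ + (P * m + suc x))                              ≡⟨ NS.solve 5 (λ p r₁ P m x → p NS.:* (r₁ NS.:+ (P NS.:* m NS.:+ (NS.con 1 NS.:+ x))) NS.:= p NS.:+ (p NS.:* r₁ NS.:+ p NS.:* P NS.:* m NS.:+ x NS.:* p)) refl p r₁ P m x ⟩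
        p + (p * r₁ + p * P * m + x * p)                        ≡⟨ cong (λ k → suc k + (p * r₁ + p * P * m + x * p)) (ℕ.m∸n+n≡m y≤q) ⟨
        suc (r₀ + y) + (p * r₁ + p * P * m + x * p)             ≡⟨ NS.solve 5 (λ r₀ y w z v → NS.con 1 NS.:+ (r₀ NS.:+ y) NS.:+ (w NS.:+ z NS.:+ v) NS.:= r₀ NS.:+ w NS.:+ (z NS.:+ (NS.con 1 NS.:+ (y NS.:+ v)))) refl r₀ y (p * r₁) (p * P * m) (x * p) ⟩
        r₀ + p * r₁ + (p * P * m + suc (y + x * p))             ≡⟨ cong (λ k → r₀ + p * r₁ + (p * P * m + suc k)) (m≡m%n+[m/n]*n d p) ⟨
        r₀ + p * r₁ + (p * P * m + suc d)                       ∎)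
        where open ≡-Reasoning
      N≡ : p * i₀ + r₀ ≡ r + p * (p * P) * n′
      N≡ = trans (NS.solve 5 (λ p P r₀ r₁ n → p NS.:* (r₁ NS.:+ p NS.:* P NS.:* n) NS.:+ r₀ NS.:= r₀ NS.:+ p NS.:* r₁ NS.:+ p NS.:* (p NS.:* P) NS.:* n) refl p P r₀ r₁ n′)
        (cong (_+ p * (p * P) * n′) (sym r≡))
      i₀≤N : i₀ ≤ r + p * (p * P) * n′
      i₀≤N = subst (i₀ ≤_) N≡ (ℕ.≤-trans (ℕ.m≤n*m i₀ p) (ℕ.m≤m+n (p * i₀) r₀))
      -- The top index exceeds the threshold by p^a t - (x + 1). The first part is what n = l + m +
      -- t + 1 leaves after the threshold for s = m + t + 1 is subtracted; the second is the loss
      -- caused by the shift.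
      surplus : i₀ + suc x ≡ threshold a l order + P * t
      surplus = ℕ.+-cancelʳ-≡ (P * m) _ _ (begin
        i₀ + suc x + P * m                            ≡⟨ NS.solve 4 (λ r₁ u x v → r₁ NS.:+ u NS.:+ x NS.:+ v NS.:= r₁ NS.:+ (v NS.:+ x) NS.:+ u) refl r₁ (p * P * n′) (suc x) (P * m) ⟩
        r₁ + (P * m + suc x) + p * P * n′             ≡⟨ cong (_+ p * P * n′) r₁+ ⟩
        p * P + p * P * n′                            ≡⟨ ℕ.*-suc (p * P) n′ ⟨
        p * P * suc n′                                ≡⟨ cong (p * P *_) n≡ ⟩
        p * P * (l + (m + suc t))                     ≡⟨ NS.solve 5 (λ q P l m t → (NS.con 1 NS.:+ q) NS.:* P NS.:* (l NS.:+ (m NS.:+ (NS.con 1 NS.:+ t)))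
                                                           NS.:= P NS.:* ((NS.con 1 NS.:+ q) NS.:* l NS.:+ q NS.:* (m NS.:+ (NS.con 1 NS.:+ t)) NS.:+ NS.con 1) NS.:+ P NS.:* t NS.:+ P NS.:* m) refl q P l m t ⟩
        threshold a l order + P * t + P * m           ∎)
        where open ≡-Reasoning
      large : threshold a l order < i₀ ⊎ (r₀ ≡ q × threshold a l order ≤ i₀)
      large = go a d adm surplus
        where
        go : ∀ a d → AdmissibleShift (suc a) d → ∀ {K i} → i + suc (d / p) ≡ K + p ^ a * t → K < i ⊎ (q ∸ d % p ≡ q × K ≤ i)
        -- With t = 1 the threshold is only just met, but d = 0 makes the last digit equal to q.
        go zero    zero    _ {K} {i} eq = inj₂ (refl , ℕ.+-cancelʳ-≤ 1 K i (ℕ.≤-trans (ℕ.+-monoʳ-≤ K (ℕ.≤-trans 1≤t (ℕ.≤-reflexive (sym (ℕ.*-identityˡ t))))) (ℕ.≤-reflexive (sym eq))))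
        go zero    (suc d) (s≤s ())
        -- The bound on d gives x + 1 ≤ p^a < p^(a+1) t, in the lowered a of this clause, so the
        -- threshold is strictly exceeded.
        go (suc a) d adm {K} {i} eq = inj₁ (ℕ.+-cancelʳ-≤ (suc (d / p)) (suc K) i (begin
          suc K + suc (d / p)       ≤⟨ ℕ.+-monoʳ-≤ (suc K) (admissible-/ (suc a) d adm) ⟩
          suc K + p ^ a             ≡⟨ ℕ.+-suc K (p ^ a) ⟨
          K + suc (p ^ a)           ≤⟨ ℕ.+-monoʳ-≤ K (ℕ.≤-trans (ℕ.m<m*n (p ^ a) p {{>-nonZero (1≤p^ a)}} 1<p) (ℕ.≤-reflexive (ℕ.*-comm (p ^ a) p))) ⟩
          K + p ^ suc a             ≤⟨ ℕ.+-monoʳ-≤ K (ℕ.m≤m*n (p ^ suc a) t {{>-nonZero 1≤t}}) ⟩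
          K + p ^ suc a * t         ≡⟨ eq ⟨
          i + suc (d / p)           ∎))
          where open ℕ.≤-Reasoning

  -- Evaluation of both sides of the congruence

  cong⇒≡modℚ : ∀ {x y} → Cong 1 x y → x ≡ y [modℚ p ]
  cong⇒≡modℚ (congruent (div z int-z eq)) = z , int⇒pIntegral int-z ,
    trans eq (cong (ℚ._* z) (trans (ℚ.*-identityʳ (ν p)) (sym (ι-pos p))))

  module _ (l m t n′ r⋆ : ℕ) (1≤t : 1 ≤ t) (t≤q : t ≤ q) (n≡ : suc n′ ≡ l + (m + suc t)) (r⋆+m≡q : r⋆ + m ≡ q) where

    private
      s j n : ℕ
      s = m + suc t
      n = l + s
      j = q ∸ t
      t+j≡q : t + j ≡ q
      t+j≡q = ℕ.m+[n∸m]≡n t≤q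
      j<q : j < q
      j<q = subst (j <_) t+j≡q (ℕ.m<n+m j 1≤t)
      g : ℚ
      g = (x/expm1 ^ˢ suc m) j
      int-g : Integral g
      int-g = int-^ˢ x/expm1 (suc m) j (int-x/expm1 j j<q) j ℕ.≤-refl

    leading-value : Cong 1 (sgn p ℚ.* (sgn (p * n) ℚ.* binom n l ℚ.* sgn r⋆ ℚ.* logPow m s j)) (sgn (suc l) ℚ.* binom n l ℚ.* (sgn (suc t) ℚ.* g))
    leading-value = cong-trans (cong-refl (solve 5 (λ a b c d e → a :* (b :* c :* d :* e) := a :* b :* d :* (c :* e)) refl (sgn p) (sgn (p * n)) (binom n l) (sgn r⋆) (logPow m s j)))
      (cong-trans (cong-* (int-* (int-sgn (suc l)) (int-sgn (suc t))) (int-* (int-binom n l) (int-logPow m s j j<q)) signs (cong-*ˡ (int-binom n l) value))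
        (cong-refl (solve 4 (λ a b c d → a :* b :* (c :* d) := a :* c :* (b :* d)) refl (sgn (suc l)) (sgn (suc t)) (binom n l) g)))
      where
      value : Cong 1 (logPow m s j) g
      -- Since t + j = p - 1, the exponent s + j + 1 from Lagrange inversion equals (m + 1) + p.
      -- This is what `todd-cong` requires, and it fixes the order m + 1 of the Bernoulli number.
      value = cong-trans (cong-refl (trans (logPow≡todd m s j) (cong (λ r → todd (suc m) r j)
        (trans (NS.solve 3 (λ m t j → NS.con 1 NS.:+ (m NS.:+ (NS.con 1 NS.:+ t) NS.:+ j) NS.:= NS.con 1 NS.:+ m NS.:+ (NS.con 1 NS.:+ (t NS.:+ j))) refl m t j) (cong (λ k → suc m + suc k) t+j≡q)))))
        (todd-cong (suc m) j j<q)
      r⋆≡m : Cong 1 (sgn r⋆) (sgn m)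
      r⋆≡m = cong-trans (cong-refl (trans (trans (sym (ℚ.*-identityʳ (sgn r⋆))) (cong (sgn r⋆ ℚ.*_) (sym (sgn-square m))))
          (trans (sym (ℚ.*-assoc (sgn r⋆) (sgn m) (sgn m))) (cong (ℚ._* sgn m) (trans (sym (sgn-+ r⋆ m)) (cong sgn r⋆+m≡q))))))
        (cong-trans (cong-*ʳ (int-sgn m) sgn-q) (cong-refl (ℚ.*-identityˡ (sgn m))))
      -- Modulo p, (-1)^(p(n+1)) becomes (-1)^(n+1) and (-1)^`r⋆` becomes (-1)^m; then n + 1 + m =
      -- (l + 1) + (t + 1) + 2 m.
      signs : Cong 1 (sgn p ℚ.* sgn (p * n) ℚ.* sgn r⋆) (sgn (suc l) ℚ.* sgn (suc t))
      signs = cong-trans (cong-* (int-sgn (suc n)) (int-sgn r⋆) (cong-trans (cong-refl (sym (sgn-p*suc n))) (sgn-p* (suc n))) r⋆≡m)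
        (cong-refl (begin
          sgn (suc n) ℚ.* sgn m                                     ≡⟨ cong (ℚ._* sgn m) (trans (sgn-+ (suc l) s) (cong (sgn (suc l) ℚ.*_) (sgn-+ m (suc t)))) ⟩
          sgn (suc l) ℚ.* (sgn m ℚ.* sgn (suc t)) ℚ.* sgn m         ≡⟨ solve 3 (λ a b c → a :* (b :* c) :* b := b :* b :* (a :* c)) refl (sgn (suc l)) (sgn m) (sgn (suc t)) ⟩
          sgn m ℚ.* sgn m ℚ.* (sgn (suc l) ℚ.* sgn (suc t))         ≡⟨ trans (cong (ℚ._* (sgn (suc l) ℚ.* sgn (suc t))) (sgn-square m)) (ℚ.*-identityˡ _) ⟩
          sgn (suc l) ℚ.* sgn (suc t)                               ∎))
        where open ≡-Reasoning

    fleck-value : ∀ a B d r → AdmissibleShift a d → r + p ^ a * m + suc d ≡ p ^ suc a → suc (r + p ^ suc a * n′) < B →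
      Cong (suc s) (sgn p ℚ.* fleck (p ^ suc a) B (r + p ^ suc a * n′) r l) (powP s ℚ.* (sgn (suc l) ℚ.* binom n l ℚ.* (sgn (suc t) ℚ.* g)))
    fleck-value a B d r adm r+≡ N<B = cong-trans
      (cong-*ˡ (int-sgn p) (cong-trans (fleck-chain l m t n′ r⋆ 1≤t n≡ r⋆+m≡q a B d r adm r+≡ N<B)
        (leading B r⋆ r⋆<p m r⋆+m≡q (suc N⋆) N⋆ l s j (ℕ.n<1+n N⋆) N⋆<B j<q N⋆+j)))
      (cong-trans (cong-refl (solve 4 (λ e x y z → e :* (x :* (y :* z)) := x :* (e :* (y :* z))) refl (sgn p) (powP s) (sgn (p * n) ℚ.* binom n l ℚ.* sgn r⋆) (logPow m s j)))
        (cong-powP-* s leading-value))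
      where
      N⋆ : ℕ
      N⋆ = r⋆ + p * n′
      r⋆<p : r⋆ < p
      r⋆<p = s≤s (subst (r⋆ ≤_) r⋆+m≡q (ℕ.m≤m+n r⋆ m))
      N⋆+j : N⋆ + j ≡ p * l + q * suc s
      -- Places `N⋆` in the window of `leading` with j = q - t. The summand m + t + p is added to
      -- both sides to avoid subtraction.
      N⋆+j = ℕ.+-cancelʳ-≡ (m + t + p) (N⋆ + j) (p * l + q * suc s) (begin
        r⋆ + p * n′ + j + (m + t + p)                   ≡⟨ NS.solve 6 (λ r p n j m t → r NS.:+ p NS.:* n NS.:+ j NS.:+ (m NS.:+ t NS.:+ p) NS.:= (r NS.:+ m) NS.:+ (t NS.:+ j) NS.:+ p NS.:* (NS.con 1 NS.:+ n)) refl r⋆ p n′ j m t ⟩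
        (r⋆ + m) + (t + j) + p * suc n′                 ≡⟨ cong₂ (λ x y → x + y + p * suc n′) r⋆+m≡q t+j≡q ⟩
        q + q + p * suc n′                              ≡⟨ cong (λ k → q + q + p * k) n≡ ⟩
        q + q + p * (l + s)                             ≡⟨ NS.solve 4 (λ q l m t → q NS.:+ q NS.:+ (NS.con 1 NS.:+ q) NS.:* (l NS.:+ (m NS.:+ (NS.con 1 NS.:+ t)))
                                                             NS.:= (NS.con 1 NS.:+ q) NS.:* l NS.:+ q NS.:* (NS.con 1 NS.:+ (m NS.:+ (NS.con 1 NS.:+ t))) NS.:+ (m NS.:+ t NS.:+ (NS.con 1 NS.:+ q))) refl q l m t ⟩
        p * l + q * suc s + (m + t + p)                 ∎)
        where open ≡-Reasoning
      r⋆≤r : r⋆ ≤ r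
      r⋆≤r = ℕ.+-cancelʳ-≤ (p ^ a * m + suc d) r⋆ r (begin
        r⋆ + (p ^ a * m + suc d)               ≤⟨ ℕ.+-mono-≤ (ℕ.≤-trans (ℕ.≤-reflexive (sym (ℕ.*-identityˡ r⋆))) (ℕ.*-monoˡ-≤ r⋆ (1≤p^ a))) (ℕ.+-monoʳ-≤ (p ^ a * m) (admissible-< a d adm)) ⟩
        p ^ a * r⋆ + (p ^ a * m + p ^ a)       ≡⟨ NS.solve 3 (λ P r m → P NS.:* r NS.:+ (P NS.:* m NS.:+ P) NS.:= (NS.con 1 NS.:+ (r NS.:+ m)) NS.:* P) refl (p ^ a) r⋆ m ⟩
        suc (r⋆ + m) * p ^ a                   ≡⟨ cong (λ k → suc k * p ^ a) r⋆+m≡q ⟩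
        p ^ suc a                              ≡⟨ r+≡ ⟨
        r + p ^ a * m + suc d                  ≡⟨ ℕ.+-assoc r (p ^ a * m) (suc d) ⟩
        r + (p ^ a * m + suc d)                ∎)
        where open ℕ.≤-Reasoning
      N⋆<B : suc N⋆ < B
      N⋆<B = ℕ.≤-<-trans (s≤s (ℕ.+-mono-≤ r⋆≤r (ℕ.*-monoˡ-≤ n′ (ℕ.m≤m*n p (p ^ a) {{>-nonZero (1≤p^ a)}})))) N<B

    summand : ℕ → ℕ → ℕ → ℤ
    summand a d k = (+ ((p ^ suc a * n ∸ p ^ a * m ∸ suc d) C (p ^ suc a * k ∸ p ^ a * m ∸ suc d))) ℤ.* (-1ℤ ℤ.^ (p * k)) ℤ.* (+ ((k ∸ 1) C l))

    -- Extending l ≤ j < n to j < B adds only zeros: C(j,l) vanishes below l, and from n on the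
    -- lower index of the other binomial coefficient exceeds the upper.
    sum-as-fleck : ∀ a B d r → r + p ^ a * m + suc d ≡ p ^ suc a → suc (r + p ^ suc a * n′) < B → n ≤ B →
      ι (sumℤ (map (summand a d) (map (λ i → l + 1 + i) (upTo s)))) ≡ sgn p ℚ.* fleck (p ^ suc a) B (r + p ^ suc a * n′) r l
    sum-as-fleck a B d r r+≡ N<B n≤B = begin
      ι (sumℤ (map (summand a d) (map (λ i → l + 1 + i) (upTo s))))
        ≡⟨ ι-sumℤ (summand a d) (λ i → l + 1 + i) s ⟩
      ∑ s (λ i → ι (summand a d (l + 1 + i)))
        ≡⟨ ∑-cong s (λ i → trans (cong (λ k → ι (summand a d k)) (cong (_+ i) (ℕ.+-comm l 1))) (summand-suc (l + i))) ⟩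
      ∑ s (λ i → sgn p ℚ.* term (l + i))
        ≡⟨ ∑-* s (sgn p) (λ i → term (l + i)) ⟩
      sgn p ℚ.* ∑ s (λ i → term (l + i))
        ≡⟨ cong (sgn p ℚ.*_) (trans (sym (ℚ.+-identityˡ _)) (trans (cong (ℚ._+ ∑ s (λ i → term (l + i))) (sym (∑-0 l low))) (sym (∑-+-split l s term)))) ⟩
      sgn p ℚ.* ∑ n term
        ≡⟨ cong (sgn p ℚ.*_) (∑-extend term n≤B high) ⟨
      sgn p ℚ.* ∑ B term ∎
      where
      open ≡-Reasoning
      Q N : ℕ
      Q = p ^ suc a
      N = r + Q * n′
      term : ℕ → ℚ
      term j = weight l j ℚ.* binom N (Q * j + r)
      shift : ∀ k → Q * suc k ∸ p ^ a * m ∸ suc d ≡ Q * k + r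
      shift k = begin
        Q * suc k ∸ p ^ a * m ∸ suc d                            ≡⟨ ℕ.∸-+-assoc (Q * suc k) (p ^ a * m) (suc d) ⟩
        Q * suc k ∸ (p ^ a * m + suc d)                          ≡⟨ cong (_∸ (p ^ a * m + suc d)) (trans (ℕ.*-suc Q k) (trans (ℕ.+-comm Q (Q * k)) (cong (λ x → Q * k + x) (sym (trans (sym (ℕ.+-assoc r (p ^ a * m) (suc d))) r+≡))))) ⟩
        Q * k + (r + (p ^ a * m + suc d)) ∸ (p ^ a * m + suc d)  ≡⟨ cong (_∸ (p ^ a * m + suc d)) (ℕ.+-assoc (Q * k) r (p ^ a * m + suc d)) ⟨
        Q * k + r + (p ^ a * m + suc d) ∸ (p ^ a * m + suc d)    ≡⟨ ℕ.m+n∸n≡m (Q * k + r) (p ^ a * m + suc d) ⟩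
        Q * k + r                                                ∎
      top : Q * n ∸ p ^ a * m ∸ suc d ≡ N
      top = trans (cong (λ k → Q * k ∸ p ^ a * m ∸ suc d) (sym n≡)) (trans (shift n′) (ℕ.+-comm (Q * n′) r))
      summand-suc : ∀ k → ι (summand a d (suc k)) ≡ sgn p ℚ.* term k
      summand-suc k = begin
        ι (summand a d (suc k))
          ≡⟨ trans (ι-* (+ (A C D) ℤ.* (-1ℤ ℤ.^ (p * suc k))) (+ (k C l))) (cong (ℚ._* ι (+ (k C l))) (ι-* (+ (A C D)) (-1ℤ ℤ.^ (p * suc k)))) ⟩
        ι (+ (A C D)) ℚ.* ι (-1ℤ ℤ.^ (p * suc k)) ℚ.* ι (+ (k C l))
          ≡⟨ cong₂ ℚ._*_ (cong₂ ℚ._*_ (trans (ι-pos (A C D)) (cong₂ binom top (shift k))) (trans (ι-[-1]^ (p * suc k)) (sgn-p*suc k))) (ι-pos (k C l)) ⟩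
        binom N (Q * k + r) ℚ.* (sgn p ℚ.* sgn (p * k)) ℚ.* binom k l
          ≡⟨ solve 4 (λ b e f c → b :* (e :* f) :* c := e :* (f :* c :* b)) refl (binom N (Q * k + r)) (sgn p) (sgn (p * k)) (binom k l) ⟩
        sgn p ℚ.* term k ∎
        where
        A D : ℕ
        A = Q * n ∸ p ^ a * m ∸ suc d
        D = Q * suc k ∸ p ^ a * m ∸ suc d
      low : ∀ j → j < l → term j ≡ 0ℚ
      low j j<l = trans (cong (λ x → sgn (p * j) ℚ.* x ℚ.* binom N (Q * j + r)) (binom-0 j<l)) (solve 2 (λ a b → a :* con 0ℚ :* b := con 0ℚ) refl (sgn (p * j)) (binom N (Q * j + r)))
      high : ∀ j → n ≤ j → term j ≡ 0ℚ
      high j n≤j = *-zero (weight l j) (binom-0 (subst (_< Q * j + r) (ℕ.+-comm (Q * n′) r)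
        (ℕ.+-monoˡ-< r (ℕ.*-monoʳ-< Q {{>-nonZero (1≤p^ (suc a))}} (ℕ.≤-trans (ℕ.≤-reflexive n≡) n≤j)))))

    -- The product in the denominator is s!/t!, so the quotient is (-1)^(l+1) C(n,l) t!. This t!
    -- meets the j! of the Bernoulli number, and t + j = q allows `wilson-split`.
    rhs-value : Cong 1 (divℕ ((-1ℤ ℤ.^ (l + 1)) ℤ.* (+ (n !))) ((l !) * prodℕ0to (λ k → s ∸ k) m) ℚ.* bernoulli (m + 1) j)
                       (sgn (suc l) ℚ.* binom n l ℚ.* (sgn (suc t) ℚ.* g))
    rhs-value = cong-trans (cong-refl (trans (cong₂ ℚ._*_ quotient (cong₂ ℚ._*_ (ι-pos (j !)) (trans (^S≈^ˢ x/expm1 (m + 1) j) (cong (λ c → (x/expm1 ^ˢ c) j) (ℕ.+-comm m 1)))))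
        (solve 5 (λ a b c d e → a :* b :* c :* (d :* e) := a :* b :* (c :* d :* e)) refl (sgn (suc l)) (binom n l) (ν (t !)) (ν (j !)) g)))
      (cong-*ˡ (int-* (int-sgn (suc l)) (int-binom n l)) (cong-*ʳ int-g (wilson-split t j t+j≡q)))
      where
      open ≡-Reasoning
      m<s : m < s
      m<s = ℕ.m<m+n m (s≤s z≤n)
      Π : ℕ
      Π = prodℕ0to (λ k → s ∸ k) m
      s∸ : s ∸ suc m ≡ t
      s∸ = trans (cong (_∸ suc m) (ℕ.+-suc m t)) (ℕ.m+n∸m≡n (suc m) t)
      quotient : divℕ ((-1ℤ ℤ.^ (l + 1)) ℤ.* (+ (n !))) (l ! * Π) ≡ sgn (suc l) ℚ.* binom n l ℚ.* ν (t !)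
      quotient = *-cancel-pos (ℕ.*-mono-≤ (ℕ.1≤n! l) (prodℕ-pos s m m<s)) (begin
        ν (l ! * Π) ℚ.* divℕ ((-1ℤ ℤ.^ (l + 1)) ℤ.* (+ (n !))) (l ! * Π)
          ≡⟨ divℕ-ν ((-1ℤ ℤ.^ (l + 1)) ℤ.* (+ (n !))) (ℕ.*-mono-≤ (ℕ.1≤n! l) (prodℕ-pos s m m<s)) ⟩
        ι ((-1ℤ ℤ.^ (l + 1)) ℤ.* (+ (n !)))
          ≡⟨ trans (ι-* (-1ℤ ℤ.^ (l + 1)) (+ (n !))) (cong₂ ℚ._*_ (trans (ι-[-1]^ (l + 1)) (cong sgn (ℕ.+-comm l 1))) (ι-pos (n !))) ⟩
        sgn (suc l) ℚ.* ν (n !)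
          ≡⟨ cong (sgn (suc l) ℚ.*_) (fact-binom l s) ⟨
        sgn (suc l) ℚ.* (ν (l !) ℚ.* ν (s !) ℚ.* binom n l)
          ≡⟨ cong (λ x → sgn (suc l) ℚ.* (ν (l !) ℚ.* x ℚ.* binom n l)) (trans (cong ν (trans (sym (prodℕ-fact s m m<s)) (cong (λ k → Π * k !) s∸))) (ν-* Π (t !))) ⟩
        sgn (suc l) ℚ.* (ν (l !) ℚ.* (ν Π ℚ.* ν (t !)) ℚ.* binom n l)
          ≡⟨ solve 5 (λ a b c d e → a :* (b :* (c :* d) :* e) := b :* c :* (a :* e :* d)) refl (sgn (suc l)) (ν (l !)) (ν Π) (ν (t !)) (binom n l) ⟩
        ν (l !) ℚ.* ν Π ℚ.* (sgn (suc l) ℚ.* binom n l ℚ.* ν (t !))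
          ≡⟨ cong (ℚ._* (sgn (suc l) ℚ.* binom n l ℚ.* ν (t !))) (ν-* (l !) Π) ⟨
        ν (l ! * Π) ℚ.* (sgn (suc l) ℚ.* binom n l ℚ.* ν (t !)) ∎)

    fleck-bernoulli : ∀ a d r → AdmissibleShift a d → r + p ^ a * m + suc d ≡ p ^ suc a →
      divℕ (sumℤ (map (summand a d) (map (λ i → l + 1 + i) (upTo s)))) (p ^ s)
        ≡ divℕ ((-1ℤ ℤ.^ (l + 1)) ℤ.* (+ (n !))) ((l !) * prodℕ0to (λ k → s ∸ k) m) ℚ.* bernoulli (m + 1) j
        [modℚ p ]
    fleck-bernoulli a d r adm r+≡ = cong⇒≡modℚ (cong-trans (cong-powP-cancel s
        (cong-trans (cong-refl lhs) (fleck-value a B d r adm r+≡ (ℕ.m<m+n (suc N) (s≤s z≤n))))) (cong-sym rhs-value))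
      where
      N B : ℕ
      N = r + p ^ suc a * n′
      B = suc N + suc n
      S : ℤ
      S = sumℤ (map (summand a d) (map (λ i → l + 1 + i) (upTo s)))
      lhs : powP s ℚ.* divℕ S (p ^ s) ≡ sgn p ℚ.* fleck (p ^ suc a) B N r l
      lhs = trans (cong (ℚ._* divℕ S (p ^ s)) (powP-ν s)) (trans (divℕ-ν S (1≤p^ s))
        (sum-as-fleck a B d r r+≡ (ℕ.m<m+n (suc N) (s≤s z≤n)) (ℕ.≤-trans (ℕ.n≤1+n n) (ℕ.m≤n+m (suc n) (suc N)))))

-- The hypotheses of the theorem in terms of q, t and the lowered a and d

admissible-≤ : ∀ q p-prime a d → suc d ≤ (suc q ^ (suc a ∸ 2)) ⊔ 1 → AdmissibleShift q p-prime a d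
admissible-≤ q p-prime zero    zero    _        = refl
admissible-≤ q p-prime zero    (suc d) (s≤s ())
admissible-≤ q p-prime (suc a) d       d≤       = ℕ.≤-trans d≤ (ℕ.≤-reflexive (ℕ.m≥n⇒m⊔n≡m (ℕ.m^n>0 (suc q) a)))

-- A truncated difference that is at least 2 was not truncated, so n is recovered from it exactly.
decompose : ∀ {q} l m n → 2 ≤ n ∸ l ∸ m → n ∸ l ∸ m ≤ suc q → ∃ λ t → n ≡ l + (m + suc t) × 1 ≤ t × t ≤ q
decompose l m n 2≤ ≤p with n ∸ l ∸ m in eq
decompose l m n (s≤s 1≤t) (s≤s t≤q) | suc t = t , n≡ , 1≤t , t≤q
  where
  m<n∸l : m < n ∸ l
  m<n∸l = ℕ.m∸n≢0⇒n<m (λ eq₀ → ℕ.0≢1+n (trans (sym eq₀) eq))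
  l<n : l < n
  l<n = ℕ.m∸n≢0⇒n<m (λ eq₀ → ℕ.n≮0 (subst (m <_) eq₀ m<n∸l))
  n≡ : n ≡ l + (m + suc t)
  n≡ = trans (sym (ℕ.m+[n∸m]≡n (ℕ.<⇒≤ l<n))) (cong (λ k → l + k) (trans (sym (ℕ.m+[n∸m]≡n (ℕ.<⇒≤ m<n∸l))) (cong (λ k → m + k) eq)))

bernoulli-index : ∀ q l m t → suc q + l + m ∸ (l + (m + suc t)) ≡ q ∸ t
bernoulli-index q l m t = trans (cong₂ _∸_ (NS.solve 3 (λ q l m → NS.con 1 NS.:+ q NS.:+ l NS.:+ m NS.:= l NS.:+ m NS.:+ (NS.con 1 NS.:+ q)) refl q l m)
  (sym (ℕ.+-assoc l m (suc t)))) (ℕ.[m+n]∸[m+o]≡n∸o (l + m) (suc q) (suc t))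

theorem1p4 : (p a l m n : ℕ) → Prime p → 1 ≤ a → m < p → 2 ≤ n ∸ l ∸ m → n ∸ l ∸ m ≤ p →
    (d : ℕ) → 1 ≤ d → d ≤ (p ^ (a ∸ 2)) ⊔ 1 →
    divℕ (sumℤ (map (λ k → (+ ((p ^ a * n ∸ p ^ (a ∸ 1) * m ∸ d) C (p ^ a * k ∸ p ^ (a ∸ 1) * m ∸ d)))
                          ℤ.* (-1ℤ ℤ.^ (p * k)) ℤ.* (+ ((k ∸ 1) C l)))
                   (map (λ i → l + 1 + i) (upTo (n ∸ l)))))
         (p ^ (n ∸ l))
      ≡ divℕ ((-1ℤ ℤ.^ (l + 1)) ℤ.* (+ (n !))) ((l !) * prodℕ0to (λ k → n ∸ l ∸ k) m)
          Data.Rational.* bernoulli (m + 1) (p + l + m ∸ n)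
      [modℚ p ]
theorem1p4 zero    a       l m n p-prime _ _ _ _ d _ _ = ⊥-elim (¬prime[0] p-prime)
theorem1p4 (suc q) (suc a) l m n p-prime _ m<p 2≤t t≤p (suc d) _ d≤ with decompose l m n 2≤t t≤p
... | t , refl , 1≤t , t≤q rewrite ℕ.m+n∸m≡n l (m + suc t) | bernoulli-index q l m t =
  fleck-bernoulli q p-prime l m t (l + (m + t)) (q ∸ m) 1≤t t≤q
    (sym (trans (cong (λ k → l + k) (ℕ.+-suc m t)) (ℕ.+-suc l (m + t)))) (ℕ.m∸n+n≡m (ℕ.≤-pred m<p)) a d r adm
    (trans (ℕ.+-assoc r (suc q ^ a * m) (suc d)) (ℕ.m∸n+n≡m shift≤))
  where
  adm : AdmissibleShift q p-prime a d
  adm = admissible-≤ q p-prime a d d≤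
  shift≤ : suc q ^ a * m + suc d ≤ suc q ^ suc a
  shift≤ = ℕ.≤-trans (ℕ.+-mono-≤ (ℕ.*-monoʳ-≤ (suc q ^ a) (ℕ.≤-pred m<p)) (admissible-< q p-prime a d adm))
    (ℕ.≤-reflexive (NS.solve 2 (λ q P → P NS.:* q NS.:+ P NS.:= (NS.con 1 NS.:+ q) NS.:* P) refl q (suc q ^ a)))
  r : ℕ
  r = suc q ^ suc a ∸ (suc q ^ a * m + suc d)
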